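{- There exist absolute constants $C,k>0$ such that the following holds for every prime power $q$. Let $A$ and $X$ be nonempty subsets of $\mathbb{F}_q^*$ and let $K\ge 1$ be a real number such that $C(\log q)^k K^{1505}\le |X|$. Suppose \[ \sum_{\xi\in X}E(A,\xi A)\ \ge\ \frac{|A|^3|X|}{K}. \] Then there exist an element $\bar a\in A$, a subfield $F\subseteq\mathbb{F}_q$, and an $F$-vector space $V\subseteq\mathbb{F}_q$ such that \[ |V\cap(A-\bar a)|\ \ge\ C^{ -1}(\log q)^{ -k}\max\{K^{ -704}|V|,\ K^{ -85}|A|\}. \] Further (for the same $\bar a$, $F$, $V$), there is an element $x_0\in X$ and subsets $A_1\subseteq A-\bar a$ and $X'\subseteq x_0^{ -1}X$ such that $F$ is the subfield generated by $X'$, $V$ is the $F$-vector space generated by $A_1$, and \[ |A_1|\ge C^{ -1}(\log q)^{ -k}K^{ -85}|A|\quad\text{and}\quad |X'|\ge C^{ -1}(\log q)^{ -k}K^{ -5}|X|. \] Moreover, if $E(A,\xi A)\ge |A|^3/K$ for all $\xi\in X$, then the same conclusions hold with the stronger bound $|X'|\ge C^{ -1}(\log q)^{ -k}K^{ -4}|X|$, and under only the weaker requirement $C(\log q)^kK^{1504}\le |X|$ in place of $C(\log q)^kK^{1505}\le|X|$.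
   Context: $\mathbb{F}_q$ is the finite field with $q$ elements, $\mathbb{F}_q^*=\mathbb{F}_q\setminus\{0\}$. For $A\subseteq\mathbb{F}_q$ and $\xi\in\mathbb{F}_q^*$, $E(A,\xi A)=|\{(a_1,a_2,a_3,a_4)\in A^4: a_1-a_2=\xi(a_3-a_4)\}|$. Also $A-\bar a=\{a-\bar a:a\in A\}$ and $x_0^{ -1}X=\{x_0^{ -1}x:x\in X\}$. -}

module Defs where

open import Level using (0ℓ) renaming (suc to lsuc)
open import Algebra.Bundles using (CommutativeRing)
open import Data.Fin.Base using (Fin)
import Data.Fin.Properties as Fin
open import Data.Fin.Subset using (Subset; ⁅_⁆; ⋃; _∩_; _⊆_; ∣_∣) renaming (_∈_ to _∈ˢ_)
open import Data.Fin.Subset.Properties using (_∈?_)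
open import Data.Integer.Base as ℤ using (+_; +≤+)
import Data.Integer.Properties as ℤ
open import Data.List.Base using (List; map; filter; length; cartesianProduct; allFin)
open import Data.Nat.Base as ℕ using (ℕ; zero; suc; s≤s; z≤n)
open import Data.Nat.Induction using (<-rec)
open import Data.Nat.ListAction using (sum)
open import Data.Nat.Logarithm
open import Data.Nat.Primality using (Prime; prime⇒nonTrivial)
import Data.Nat.Properties as ℕ
open import Data.Product.Base using (∃-syntax; _×_; _,_; proj₁; proj₂)
open import Data.Rational.Base as ℚ using (ℚ; mkℚ; 0ℚ; 1ℚ)
import Data.Rational.Properties as ℚ
open import Data.Rational.Solver using (module +-*-Solver)
open import Data.Rational.Unnormalised.Base as ℚᵘ using (mkℚᵘ; *≤*)
import Data.Rational.Unnormalised.Properties as ℚᵘ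
open import Data.Sum.Base using (inj₁; inj₂)
open import Function.Bundles using (Inverse)
open import Relation.Binary.PropositionalEquality
  using (_≡_; refl; sym; trans; cong; cong₂; subst; subst₂; setoid)
open import Relation.Nullary using (¬_; Dec)
open import Relation.Nullary.Decidable using (map′)
open import Relation.Nullary.Negation using (contradiction)

Cauchy : (ℕ → ℚ) → Set
Cauchy f = ∀ ε → 0ℚ ℚ.< ε →
           ∃[ N ] (∀ m n → N ℕ.≤ m → N ℕ.≤ n → ℚ.∣ f m ℚ.- f n ∣ ℚ.≤ ε)

record ℝ : Set where
  constructor mkℝ
  field
    seq    : ℕ → ℚ
    cauchy : Cauchy seq

open ℝ public

infix 4 _≤_

_≤_ : ℝ → ℝ → Set
x ≤ y = ∀ ε → 0ℚ ℚ.< ε → ∃[ N ] (∀ n → N ℕ.≤ n → seq x n ℚ.≤ seq y n ℚ.+ ε)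

Positive : ℝ → Set
Positive x = ∃[ δ ] (0ℚ ℚ.< δ × ∃[ N ] (∀ n → N ℕ.≤ n → δ ℚ.≤ seq x n))

∣p∣≤q : ∀ {p q} → p ℚ.≤ q → ℚ.- p ℚ.≤ q → ℚ.∣ p ∣ ℚ.≤ q
∣p∣≤q {p} p≤q -p≤q with ℚ.∣p∣≡p∨∣p∣≡-p p
... | inj₁ eq = subst (ℚ._≤ _) (sym eq) p≤q
... | inj₂ eq = subst (ℚ._≤ _) (sym eq) -p≤q

p≤∣p∣ : ∀ p → p ℚ.≤ ℚ.∣ p ∣
p≤∣p∣ p with ℚ.≤-total 0ℚ p
... | inj₁ 0≤p = ℚ.≤-reflexive (sym (ℚ.0≤p⇒∣p∣≡p 0≤p))
... | inj₂ p≤0 = ℚ.≤-trans p≤0 (ℚ.0≤∣p∣ p)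

swap-∣-∣ : ∀ p q → ℚ.∣ p ℚ.- q ∣ ≡ ℚ.∣ q ℚ.- p ∣
swap-∣-∣ p q = trans (cong ℚ.∣_∣ lem) (ℚ.∣-p∣≡∣p∣ (q ℚ.- p))
  where
  open +-*-Solver
  lem : p ℚ.- q ≡ ℚ.- (q ℚ.- p)
  lem = solve 2 (λ a b → a :- b := :- (b :- a)) refl p q

∣-∣≤⇒≤+ : ∀ {p q ε} → ℚ.∣ p ℚ.- q ∣ ℚ.≤ ε → p ℚ.≤ q ℚ.+ ε
∣-∣≤⇒≤+ {p} {q} {ε} h = begin
  p                ≡⟨ solve 2 (λ a b → a := b :+ (a :- b)) refl p q ⟩
  q ℚ.+ (p ℚ.- q)  ≤⟨ ℚ.+-monoʳ-≤ q (ℚ.≤-trans (p≤∣p∣ (p ℚ.- q)) h) ⟩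
  q ℚ.+ ε          ∎
  where
  open ℚ.≤-Reasoning
  open +-*-Solver

≤+⇒-≤ : ∀ {p q ε} → p ℚ.≤ q ℚ.+ ε → p ℚ.- q ℚ.≤ ε
≤+⇒-≤ {p} {q} {ε} h = begin
  p ℚ.- q          ≤⟨ ℚ.+-monoˡ-≤ (ℚ.- q) h ⟩
  q ℚ.+ ε ℚ.- q    ≡⟨ solve 2 (λ b e → b :+ e :- b := e) refl q ε ⟩
  ε                ∎
  where
  open ℚ.≤-Reasoning
  open +-*-Solver

≤+⇒∣-∣≤ : ∀ {p q ε} → p ℚ.≤ q ℚ.+ ε → q ℚ.≤ p ℚ.+ ε → ℚ.∣ p ℚ.- q ∣ ℚ.≤ ε
≤+⇒∣-∣≤ {p} {q} h h′ = ∣p∣≤q (≤+⇒-≤ h) (subst (ℚ._≤ _) lem (≤+⇒-≤ h′))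
  where
  open +-*-Solver
  lem : q ℚ.- p ≡ ℚ.- (p ℚ.- q)
  lem = solve 2 (λ a b → b :- a := :- (a :- b)) refl p q

cauchy⁺ : (f : ℕ → ℚ) →
          (∀ ε → 0ℚ ℚ.< ε →
           ∃[ N ] (∀ m n → N ℕ.≤ m → N ℕ.≤ n → f m ℚ.≤ f n ℚ.+ ε)) → ℝ
cauchy⁺ f h = mkℝ f λ ε 0<ε → let (N , p) = h ε 0<ε in
  N , λ m n N≤m N≤n → ≤+⇒∣-∣≤ (p m n N≤m N≤n) (p n m N≤n N≤m)

0<1 : 0ℚ ℚ.< 1ℚ
0<1 = ℚ.*<* (ℤ.+<+ (s≤s z≤n))

*-pos : ∀ {p q} → 0ℚ ℚ.< p → 0ℚ ℚ.< q → 0ℚ ℚ.< p ℚ.* q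
*-pos {p} {q} 0<p 0<q =
  ℚ.positive⁻¹ (p ℚ.* q) {{ℚ.pos*pos⇒pos p {{ℚ.positive 0<p}} q {{ℚ.positive 0<q}}}}

*-mono : ∀ {a b c d} → 0ℚ ℚ.≤ c → 0ℚ ℚ.≤ b → a ℚ.≤ b → c ℚ.≤ d →
         a ℚ.* c ℚ.≤ b ℚ.* d
*-mono {a} {b} {c} {d} 0≤c 0≤b a≤b c≤d = ℚ.≤-trans
  (ℚ.*-monoʳ-≤-nonNeg c {{ℚ.nonNegative 0≤c}} a≤b)
  (ℚ.*-monoˡ-≤-nonNeg b {{ℚ.nonNegative 0≤b}} c≤d)

nz : ∀ {p} → 0ℚ ℚ.< p → ℚ.NonZero p
nz {p} 0<p = ℚ.pos⇒nonZero p {{ℚ.positive 0<p}}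

inv : (p : ℚ) → 0ℚ ℚ.< p → ℚ
inv p 0<p = (ℚ.1/ p) {{nz 0<p}}

inv-pos : ∀ p (0<p : 0ℚ ℚ.< p) → 0ℚ ℚ.< inv p 0<p
inv-pos p 0<p = ℚ.positive⁻¹ (inv p 0<p) {{ℚ.1/pos⇒pos p {{ℚ.positive 0<p}}}}

inv-r : ∀ p (0<p : 0ℚ ℚ.< p) → p ℚ.* inv p 0<p ≡ 1ℚ
inv-r p 0<p = ℚ.*-inverseʳ p {{nz 0<p}}

inv-anti : ∀ p q (0<p : 0ℚ ℚ.< p) (0<q : 0ℚ ℚ.< q) →
           p ℚ.≤ q → inv q 0<q ℚ.≤ inv p 0<p
inv-anti p q 0<p 0<q p≤q = begin
  q′                  ≡⟨ trans (sym (ℚ.*-identityʳ q′)) (cong (q′ ℚ.*_) (sym (inv-r p 0<p))) ⟩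
  q′ ℚ.* (p ℚ.* p′)   ≡⟨ sym (ℚ.*-assoc q′ p p′) ⟩
  (q′ ℚ.* p) ℚ.* p′   ≤⟨ ℚ.*-monoʳ-≤-nonNeg p′ {{ℚ.nonNegative (ℚ.<⇒≤ (inv-pos p 0<p))}}
                           (ℚ.*-monoˡ-≤-nonNeg q′ {{ℚ.nonNegative (ℚ.<⇒≤ (inv-pos q 0<q))}} p≤q) ⟩
  (q′ ℚ.* q) ℚ.* p′   ≡⟨ cong (ℚ._* p′) (trans (ℚ.*-comm q′ q) (inv-r q 0<q)) ⟩
  1ℚ ℚ.* p′           ≡⟨ ℚ.*-identityˡ p′ ⟩
  p′                  ∎
  where
  open ℚ.≤-Reasoning
  p′ = inv p 0<p
  q′ = inv q 0<q

fromℚ : ℚ → ℝ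
fromℚ p = cauchy⁺ (λ _ → p) λ ε 0<ε → 0 , λ _ _ _ _ →
  ℚ.≤-trans (ℚ.≤-reflexive (sym (ℚ.+-identityʳ p))) (ℚ.+-monoʳ-≤ p (ℚ.<⇒≤ 0<ε))

bounded : ∀ x → ∃[ B ] (0ℚ ℚ.< B × ∃[ N ] (∀ n → N ℕ.≤ n → ℚ.∣ seq x n ∣ ℚ.≤ B))
bounded x = B , 0<B , N , bound
  where
  N = proj₁ (cauchy x 1ℚ 0<1)
  B = ℚ.∣ seq x N ∣ ℚ.+ 1ℚ
  0<B : 0ℚ ℚ.< B
  0<B = ℚ.<-≤-trans 0<1 (ℚ.≤-trans (ℚ.≤-reflexive (sym (ℚ.+-identityˡ 1ℚ)))
          (ℚ.+-monoˡ-≤ 1ℚ (ℚ.0≤∣p∣ (seq x N))))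
  bound : ∀ n → N ℕ.≤ n → ℚ.∣ seq x n ∣ ℚ.≤ B
  bound n N≤n = begin
    ℚ.∣ xn ∣                     ≡⟨ cong ℚ.∣_∣ (solve 2 (λ a b → a := b :+ (a :- b)) refl xn xN) ⟩
    ℚ.∣ xN ℚ.+ (xn ℚ.- xN) ∣     ≤⟨ ℚ.∣p+q∣≤∣p∣+∣q∣ xN (xn ℚ.- xN) ⟩
    ℚ.∣ xN ∣ ℚ.+ ℚ.∣ xn ℚ.- xN ∣ ≤⟨ ℚ.+-monoʳ-≤ ℚ.∣ xN ∣ (proj₂ (cauchy x 1ℚ 0<1) n N N≤n ℕ.≤-refl) ⟩
    B                            ∎
    where
    open ℚ.≤-Reasoning
    open +-*-Solver
    xn = seq x n
    xN = seq x N

fromℕ : ℕ → ℝ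
fromℕ n = fromℚ (+ n ℚ./ 1)

infixl 7 _*_
infixl 6 _⊔_

mul-diff : ∀ a b c d → a ℚ.* b ℚ.- c ℚ.* d ≡ a ℚ.* (b ℚ.- d) ℚ.+ (a ℚ.- c) ℚ.* d
mul-diff = solve 4 (λ a b c d → a :* b :- c :* d := a :* (b :- d) :+ (a :- c) :* d) refl
  where open +-*-Solver

mul-ε : ∀ ε i a b → a ℚ.* (ε ℚ.* i) ℚ.+ (ε ℚ.* i) ℚ.* b ≡ ε ℚ.* ((a ℚ.+ b) ℚ.* i)
mul-ε ε i a b = begin-equality
  a ℚ.* (ε ℚ.* i) ℚ.+ (ε ℚ.* i) ℚ.* b   ≡⟨ cong (ℚ._+ (ε ℚ.* i) ℚ.* b) (ℚ.*-comm a (ε ℚ.* i)) ⟩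
  (ε ℚ.* i) ℚ.* a ℚ.+ (ε ℚ.* i) ℚ.* b   ≡⟨ sym (ℚ.*-distribˡ-+ (ε ℚ.* i) a b) ⟩
  (ε ℚ.* i) ℚ.* (a ℚ.+ b)               ≡⟨ ℚ.*-assoc ε i (a ℚ.+ b) ⟩
  ε ℚ.* (i ℚ.* (a ℚ.+ b))               ≡⟨ cong (ε ℚ.*_) (ℚ.*-comm i (a ℚ.+ b)) ⟩
  ε ℚ.* ((a ℚ.+ b) ℚ.* i)               ∎
  where open ℚ.≤-Reasoning

∣mul-diff∣ : ∀ a b c d {A D δ} → 0ℚ ℚ.≤ A → 0ℚ ℚ.≤ δ →
             ℚ.∣ a ∣ ℚ.≤ A → ℚ.∣ d ∣ ℚ.≤ D → ℚ.∣ a ℚ.- c ∣ ℚ.≤ δ → ℚ.∣ b ℚ.- d ∣ ℚ.≤ δ →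
             ℚ.∣ a ℚ.* b ℚ.- c ℚ.* d ∣ ℚ.≤ A ℚ.* δ ℚ.+ δ ℚ.* D
∣mul-diff∣ a b c d {A} {D} {δ} 0≤A 0≤δ ∣a∣≤A ∣d∣≤D ∣a-c∣≤δ ∣b-d∣≤δ = begin
  ℚ.∣ a ℚ.* b ℚ.- c ℚ.* d ∣
    ≡⟨ cong ℚ.∣_∣ (mul-diff a b c d) ⟩
  ℚ.∣ a ℚ.* (b ℚ.- d) ℚ.+ (a ℚ.- c) ℚ.* d ∣
    ≤⟨ ℚ.∣p+q∣≤∣p∣+∣q∣ (a ℚ.* (b ℚ.- d)) ((a ℚ.- c) ℚ.* d) ⟩
  ℚ.∣ a ℚ.* (b ℚ.- d) ∣ ℚ.+ ℚ.∣ (a ℚ.- c) ℚ.* d ∣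
    ≡⟨ cong₂ ℚ._+_ (ℚ.∣p*q∣≡∣p∣*∣q∣ a (b ℚ.- d)) (ℚ.∣p*q∣≡∣p∣*∣q∣ (a ℚ.- c) d) ⟩
  ℚ.∣ a ∣ ℚ.* ℚ.∣ b ℚ.- d ∣ ℚ.+ ℚ.∣ a ℚ.- c ∣ ℚ.* ℚ.∣ d ∣
    ≤⟨ ℚ.+-mono-≤ (*-mono (ℚ.0≤∣p∣ (b ℚ.- d)) 0≤A ∣a∣≤A ∣b-d∣≤δ)
                  (*-mono (ℚ.0≤∣p∣ d) 0≤δ ∣a-c∣≤δ ∣d∣≤D) ⟩
  A ℚ.* δ ℚ.+ δ ℚ.* D ∎
  where open ℚ.≤-Reasoning

Bounded : ℝ → Set
Bounded x = ∃[ B ] (0ℚ ℚ.< B × ∃[ N ] (∀ n → N ℕ.≤ n → ℚ.∣ seq x n ∣ ℚ.≤ B))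

*-cauchy : (x y : ℝ) → Bounded x → Bounded y → Cauchy (λ n → seq x n ℚ.* seq y n)
*-cauchy x y (A , 0<A , M , a) (B , 0<B , N , b) ε 0<ε =
  (M ℕ.⊔ N) ℕ.⊔ (P ℕ.⊔ Q) , λ m n ≤m ≤n → subst (_ ℚ.≤_) eq
    (∣mul-diff∣ (seq x m) (seq y m) (seq x n) (seq y n) (ℚ.<⇒≤ 0<A) (ℚ.<⇒≤ 0<δ)
      (a m (ℕ.m⊔n≤o⇒m≤o M N (MN≤ ≤m)))
      (b n (ℕ.m⊔n≤o⇒n≤o M N (MN≤ ≤n)))
      (proj₂ cx m n (ℕ.m⊔n≤o⇒m≤o P Q (PQ≤ ≤m)) (ℕ.m⊔n≤o⇒m≤o P Q (PQ≤ ≤n)))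
      (proj₂ cy m n (ℕ.m⊔n≤o⇒n≤o P Q (PQ≤ ≤m)) (ℕ.m⊔n≤o⇒n≤o P Q (PQ≤ ≤n))))
  where
  0<S = ℚ.+-mono-< 0<A 0<B
  i   = inv (A ℚ.+ B) 0<S
  0<δ = *-pos 0<ε (inv-pos (A ℚ.+ B) 0<S)
  cx  = cauchy x (ε ℚ.* i) 0<δ
  cy  = cauchy y (ε ℚ.* i) 0<δ
  P   = proj₁ cx
  Q   = proj₁ cy
  eq  = trans (mul-ε ε i A B) (trans (cong (ε ℚ.*_) (inv-r (A ℚ.+ B) 0<S)) (ℚ.*-identityʳ ε))
  MN≤ : ∀ {n} → (M ℕ.⊔ N) ℕ.⊔ (P ℕ.⊔ Q) ℕ.≤ n → M ℕ.⊔ N ℕ.≤ n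
  MN≤ = ℕ.m⊔n≤o⇒m≤o (M ℕ.⊔ N) (P ℕ.⊔ Q)
  PQ≤ : ∀ {n} → (M ℕ.⊔ N) ℕ.⊔ (P ℕ.⊔ Q) ℕ.≤ n → P ℕ.⊔ Q ℕ.≤ n
  PQ≤ = ℕ.m⊔n≤o⇒n≤o (M ℕ.⊔ N) (P ℕ.⊔ Q)

_*_ : ℝ → ℝ → ℝ
x * y = mkℝ (λ n → seq x n ℚ.* seq y n) (*-cauchy x y (bounded x) (bounded y))

⊔-≤+ : ∀ {a b c d ε} → ℚ.∣ a ℚ.- c ∣ ℚ.≤ ε → ℚ.∣ b ℚ.- d ∣ ℚ.≤ ε →
       a ℚ.⊔ b ℚ.≤ c ℚ.⊔ d ℚ.+ ε
⊔-≤+ {a} {b} {c} {d} {ε} h k = ℚ.⊔-lub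
  (ℚ.≤-trans (∣-∣≤⇒≤+ {a} {c} h) (ℚ.+-monoˡ-≤ ε (ℚ.p≤p⊔q c d)))
  (ℚ.≤-trans (∣-∣≤⇒≤+ {b} {d} k) (ℚ.+-monoˡ-≤ ε (ℚ.p≤q⊔p c d)))

_⊔_ : ℝ → ℝ → ℝ
x ⊔ y = cauchy⁺ (λ n → seq x n ℚ.⊔ seq y n) λ ε 0<ε →
  let (M , cx) = cauchy x ε 0<ε
      (N , cy) = cauchy y ε 0<ε
  in M ℕ.⊔ N , λ m n ≤m ≤n → ⊔-≤+ {seq x m} {seq y m} {seq x n} {seq y n}
       (cx m n (ℕ.m⊔n≤o⇒m≤o M N ≤m) (ℕ.m⊔n≤o⇒m≤o M N ≤n))
       (cy m n (ℕ.m⊔n≤o⇒n≤o M N ≤m) (ℕ.m⊔n≤o⇒n≤o M N ≤n))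

record ℝ⁺ : Set where
  constructor mkℝ⁺
  field
    value    : ℝ
    positive : Positive value

open ℝ⁺ public

infix  9 _⁻¹⁺
infixr 8 _^⁺_
infixl 7 _*⁺_

1⁺ : ℝ⁺
1⁺ = mkℝ⁺ (fromℕ 1) (1ℚ , 0<1 , 0 , λ _ _ → ℚ.≤-refl)

_*⁺_ : ℝ⁺ → ℝ⁺ → ℝ⁺
mkℝ⁺ x (δ , 0<δ , M , p) *⁺ mkℝ⁺ y (η , 0<η , N , q) =
  mkℝ⁺ (x * y) (δ ℚ.* η , *-pos 0<δ 0<η , M ℕ.⊔ N , λ n ≤n →
    let δ≤x = p n (ℕ.m⊔n≤o⇒m≤o M N ≤n)
    in *-mono (ℚ.<⇒≤ 0<η) (ℚ.<⇒≤ (ℚ.<-≤-trans 0<δ δ≤x)) δ≤x (q n (ℕ.m⊔n≤o⇒n≤o M N ≤n)))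

_^⁺_ : ℝ⁺ → ℕ → ℝ⁺
x ^⁺ zero  = 1⁺
x ^⁺ suc n = x *⁺ x ^⁺ n

diff-inv : ∀ a b (0<a : 0ℚ ℚ.< a) (0<b : 0ℚ ℚ.< b) →
           inv a 0<a ℚ.- inv b 0<b ≡ (b ℚ.- a) ℚ.* (inv a 0<a ℚ.* inv b 0<b)
diff-inv a b 0<a 0<b = sym (begin-equality
  (b ℚ.- a) ℚ.* (a′ ℚ.* b′)
    ≡⟨ ring a b a′ b′ ⟩
  a′ ℚ.* (b ℚ.* b′) ℚ.- b′ ℚ.* (a ℚ.* a′)
    ≡⟨ cong₂ (λ u v → a′ ℚ.* u ℚ.- b′ ℚ.* v) (inv-r b 0<b) (inv-r a 0<a) ⟩
  a′ ℚ.* 1ℚ ℚ.- b′ ℚ.* 1ℚ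
    ≡⟨ cong₂ ℚ._-_ (ℚ.*-identityʳ a′) (ℚ.*-identityʳ b′) ⟩
  a′ ℚ.- b′ ∎)
  where
  open ℚ.≤-Reasoning
  a′ = inv a 0<a
  b′ = inv b 0<b
  ring : ∀ a b c d → (b ℚ.- a) ℚ.* (c ℚ.* d) ≡ c ℚ.* (b ℚ.* d) ℚ.- d ℚ.* (a ℚ.* c)
  ring = solve 4 (λ a b c d → (b :- a) :* (c :* d) := c :* (b :* d) :- d :* (a :* c)) refl
    where open +-*-Solver

∣diff-inv∣ : ∀ {δ ε a b} (0<δ : 0ℚ ℚ.< δ) (0<a : 0ℚ ℚ.< a) (0<b : 0ℚ ℚ.< b) → 0ℚ ℚ.< ε →
             δ ℚ.≤ a → δ ℚ.≤ b → ℚ.∣ b ℚ.- a ∣ ℚ.≤ ε ℚ.* (δ ℚ.* δ) →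
             ℚ.∣ inv a 0<a ℚ.- inv b 0<b ∣ ℚ.≤ ε
∣diff-inv∣ {δ} {ε} {a} {b} 0<δ 0<a 0<b 0<ε δ≤a δ≤b h = begin
  ℚ.∣ a′ ℚ.- b′ ∣
    ≡⟨ trans (cong ℚ.∣_∣ (diff-inv a b 0<a 0<b)) (ℚ.∣p*q∣≡∣p∣*∣q∣ (b ℚ.- a) (a′ ℚ.* b′)) ⟩
  ℚ.∣ b ℚ.- a ∣ ℚ.* ℚ.∣ a′ ℚ.* b′ ∣
    ≡⟨ cong (ℚ.∣ b ℚ.- a ∣ ℚ.*_) (ℚ.0≤p⇒∣p∣≡p 0≤a′b′) ⟩
  ℚ.∣ b ℚ.- a ∣ ℚ.* (a′ ℚ.* b′)
    ≤⟨ *-mono 0≤a′b′ (ℚ.<⇒≤ (*-pos 0<ε (*-pos 0<δ 0<δ))) h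
         (*-mono (ℚ.<⇒≤ (inv-pos b 0<b)) (ℚ.<⇒≤ (inv-pos δ 0<δ))
           (inv-anti δ a 0<δ 0<a δ≤a) (inv-anti δ b 0<δ 0<b δ≤b)) ⟩
  ε ℚ.* (δ ℚ.* δ) ℚ.* (δ′ ℚ.* δ′)
    ≡⟨ ring ε δ δ′ ⟩
  ε ℚ.* ((δ ℚ.* δ′) ℚ.* (δ ℚ.* δ′))
    ≡⟨ cong (λ u → ε ℚ.* (u ℚ.* u)) (inv-r δ 0<δ) ⟩
  ε ℚ.* 1ℚ
    ≡⟨ ℚ.*-identityʳ ε ⟩
  ε ∎
  where
  open ℚ.≤-Reasoning
  a′ = inv a 0<a
  b′ = inv b 0<b
  δ′ = inv δ 0<δ
  0≤a′b′ = ℚ.<⇒≤ (*-pos (inv-pos a 0<a) (inv-pos b 0<b))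
  ring : ∀ e d d′ → e ℚ.* (d ℚ.* d) ℚ.* (d′ ℚ.* d′) ≡ e ℚ.* ((d ℚ.* d′) ℚ.* (d ℚ.* d′))
  ring = solve 3 (λ e d d′ → e :* (d :* d) :* (d′ :* d′) := e :* ((d :* d′) :* (d :* d′))) refl
    where open +-*-Solver

-- The sequence of x is cut off below by its eventual lower bound δ, so
-- that every term can be inverted; only finitely many terms change.
_⁻¹⁺ : ℝ⁺ → ℝ⁺
mkℝ⁺ x (δ , 0<δ , _ , _) ⁻¹⁺ = mkℝ⁺ (mkℝ z z-cauchy) (z-positive (bounded y))
  where
  y : ℝ
  y = x ⊔ fromℚ δ
  δ≤y : ∀ n → δ ℚ.≤ seq y n
  δ≤y n = ℚ.p≤q⊔p (seq x n) δ
  0<y : ∀ n → 0ℚ ℚ.< seq y n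
  0<y n = ℚ.<-≤-trans 0<δ (δ≤y n)
  z : ℕ → ℚ
  z n = inv (seq y n) (0<y n)
  z-cauchy : Cauchy z
  z-cauchy ε 0<ε = proj₁ c , λ m n ≤m ≤n →
    ∣diff-inv∣ 0<δ (0<y m) (0<y n) 0<ε (δ≤y m) (δ≤y n) (proj₂ c n m ≤n ≤m)
    where c = cauchy y (ε ℚ.* (δ ℚ.* δ)) (*-pos 0<ε (*-pos 0<δ 0<δ))
  z-positive : Bounded y → Positive (mkℝ z z-cauchy)
  z-positive (B , 0<B , N , b) = inv B 0<B , inv-pos B 0<B , N , λ n N≤n →
    inv-anti (seq y n) B (0<y n) 0<B (ℚ.≤-trans (p≤∣p∣ (seq y n)) (b n N≤n))

/-mono : ∀ a b m n → a ℕ.* suc n ℕ.≤ b ℕ.* suc m →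
         + a ℚ./ suc m ℚ.≤ + b ℚ./ suc n
/-mono a b m n h = ℚ.toℚᵘ-cancel-≤ (begin
  ℚ.toℚᵘ (+ a ℚ./ suc m)  ≃⟨ ℚ.toℚᵘ-fromℚᵘ (mkℚᵘ (+ a) m) ⟩
  mkℚᵘ (+ a) m            ≤⟨ *≤* (subst₂ ℤ._≤_ (ℤ.pos-* a (suc n)) (ℤ.pos-* b (suc m)) (+≤+ h)) ⟩
  mkℚᵘ (+ b) n            ≃⟨ ℚᵘ.≃-sym (ℚ.toℚᵘ-fromℚᵘ (mkℚᵘ (+ b) n)) ⟩
  ℚ.toℚᵘ (+ b ℚ./ suc n)  ∎)
  where open ℚᵘ.≤-Reasoning

/-+ : ∀ a b m → + (a ℕ.+ b) ℚ./ suc m ≡ (+ a ℚ./ suc m) ℚ.+ (+ b ℚ./ suc m)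
/-+ a b m = ℚ.toℚᵘ-injective (begin
  ℚ.toℚᵘ (+ (a ℕ.+ b) ℚ./ suc m)                       ≈⟨ ℚ.toℚᵘ-fromℚᵘ (mkℚᵘ (+ (a ℕ.+ b)) m) ⟩
  mkℚᵘ (+ (a ℕ.+ b)) m                                 ≈⟨ ℚᵘ.*≡* eq ⟩
  mkℚᵘ (+ a) m ℚᵘ.+ mkℚᵘ (+ b) m                       ≈⟨ ℚᵘ.+-cong (ℚᵘ.≃-sym (ℚ.toℚᵘ-fromℚᵘ (mkℚᵘ (+ a) m)))
                                                            (ℚᵘ.≃-sym (ℚ.toℚᵘ-fromℚᵘ (mkℚᵘ (+ b) m))) ⟩
  ℚ.toℚᵘ (+ a ℚ./ suc m) ℚᵘ.+ ℚ.toℚᵘ (+ b ℚ./ suc m)   ≈⟨ ℚᵘ.≃-sym (ℚ.toℚᵘ-homo-+ (+ a ℚ./ suc m) (+ b ℚ./ suc m)) ⟩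
  ℚ.toℚᵘ ((+ a ℚ./ suc m) ℚ.+ (+ b ℚ./ suc m))         ∎)
  where
  open import Relation.Binary.Reasoning.Setoid ℚᵘ.≃-setoid
  s = + suc m
  eq : + (a ℕ.+ b) ℤ.* (s ℤ.* s) ≡ (+ a ℤ.* s ℤ.+ + b ℤ.* s) ℤ.* s
  eq = trans (cong (ℤ._* (s ℤ.* s)) (ℤ.pos-+ a b))
      (trans (sym (ℤ.*-assoc (+ a ℤ.+ + b) s s))
             (cong (ℤ._* s) (ℤ.*-distribʳ-+ s (+ a) (+ b))))

1/n≤ε : ∀ ε → 0ℚ ℚ.< ε → ∃[ N ] (∀ n → N ℕ.≤ n → + 1 ℚ./ suc n ℚ.≤ ε)
1/n≤ε ε@(mkℚ (+ zero) _ _) 0<ε = contradiction (ℚ.positive 0<ε) λ ()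
1/n≤ε ε@(mkℚ ℤ.-[1+ _ ] _ _) 0<ε = contradiction (ℚ.positive 0<ε) λ ()
1/n≤ε ε@(mkℚ (+ suc p) d _) 0<ε = d , λ n d≤n → ℚ.≤-trans
  (/-mono 1 (suc p) n d
    (ℕ.*-mono-≤ {1} {suc p} {suc d} {suc n} (s≤s z≤n) (s≤s d≤n)))
  (ℚ.≤-reflexive (ℚ.↥p/↧p≡p ε))

2⌊n/2⌋≤n : ∀ n → 2 ℕ.* ℕ.⌊ n /2⌋ ℕ.≤ n
2⌊n/2⌋≤n zero          = z≤n
2⌊n/2⌋≤n (suc zero)    = z≤n
2⌊n/2⌋≤n (suc (suc n)) = subst (ℕ._≤ suc (suc n)) (sym (ℕ.*-suc 2 ℕ.⌊ n /2⌋))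
  (s≤s (s≤s (2⌊n/2⌋≤n n)))

2^⌊log₂n⌋≤n : ∀ n → 1 ℕ.≤ n → 2 ℕ.^ ⌊log₂ n ⌋ ℕ.≤ n
2^⌊log₂n⌋≤n = <-rec (λ n → 1 ℕ.≤ n → 2 ℕ.^ ⌊log₂ n ⌋ ℕ.≤ n) go
  where
  open ℕ.≤-Reasoning
  go : ∀ n → (∀ {m} → m ℕ.< n → 1 ℕ.≤ m → 2 ℕ.^ ⌊log₂ m ⌋ ℕ.≤ m) →
       1 ℕ.≤ n → 2 ℕ.^ ⌊log₂ n ⌋ ℕ.≤ n
  go (suc zero)      _  _ = s≤s z≤n
  go n@(suc (suc l)) ih _ = begin
    2 ℕ.^ ⌊log₂ n ⌋               ≡⟨ cong (2 ℕ.^_) (sym (ℕ.m+[n∸m]≡n {1} (⌊log₂⌋-mono-≤ {2} {n} (s≤s (s≤s z≤n))))) ⟩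
    2 ℕ.* 2 ℕ.^ (⌊log₂ n ⌋ ℕ.∸ 1) ≡⟨ cong (λ e → 2 ℕ.* 2 ℕ.^ e) (sym (⌊log₂⌊n/2⌋⌋≡⌊log₂n⌋∸1 n)) ⟩
    2 ℕ.* 2 ℕ.^ ⌊log₂ ℕ.⌊ n /2⌋ ⌋ ≤⟨ ℕ.*-monoʳ-≤ 2 (ih (ℕ.⌊n/2⌋<n (suc l)) (s≤s z≤n)) ⟩
    2 ℕ.* ℕ.⌊ n /2⌋               ≤⟨ 2⌊n/2⌋≤n n ⟩
    n                             ∎

n<2^[1+⌊log₂n⌋] : ∀ n → n ℕ.< 2 ℕ.^ suc ⌊log₂ n ⌋
n<2^[1+⌊log₂n⌋] n = ℕ.≰⇒> λ h → ℕ.1+n≰n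
  (subst (ℕ._≤ ⌊log₂ n ⌋) (⌊log₂[2^n]⌋≡n (suc ⌊log₂ n ⌋)) (⌊log₂⌋-mono-≤ h))

^-cancel-≤ : ∀ {a b} → 2 ℕ.^ a ℕ.≤ 2 ℕ.^ b → a ℕ.≤ b
^-cancel-≤ {a} {b} h = subst₂ ℕ._≤_ (⌊log₂[2^n]⌋≡n a) (⌊log₂[2^n]⌋≡n b) (⌊log₂⌋-mono-≤ h)

-- log₂ q is the limit of ⌊log₂ (qⁿ)⌋ / n.  In Conclusion the base of the
-- logarithm is immaterial: changing it rescales Λ by a constant factor.
log₂ : ∀ q → 1 ℕ.< q → ℝ⁺
log₂ q 1<q = mkℝ⁺ (cauchy⁺ l c) (1ℚ , 0<1 , 0 , λ n _ → 1≤l n)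
  where
  L : ℕ → ℕ
  L n = ⌊log₂ (q ℕ.^ suc n) ⌋
  l : ℕ → ℚ
  l n = + L n ℚ./ suc n
  1≤q : 1 ℕ.≤ q
  1≤q = ℕ.<⇒≤ 1<q
  key : ∀ m n → L m ℕ.* suc n ℕ.≤ (L n ℕ.+ 1) ℕ.* suc m
  key m n = ^-cancel-≤ (begin
    2 ℕ.^ (L m ℕ.* suc n)            ≡⟨ sym (ℕ.^-*-assoc 2 (L m) (suc n)) ⟩
    (2 ℕ.^ L m) ℕ.^ suc n            ≤⟨ ℕ.^-monoˡ-≤ (suc n) (2^⌊log₂n⌋≤n (q ℕ.^ suc m)
                                          (ℕ.m^n>0 q {{ℕ.>-nonZero 1≤q}} (suc m))) ⟩
    (q ℕ.^ suc m) ℕ.^ suc n          ≡⟨ ℕ.^-*-assoc q (suc m) (suc n) ⟩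
    q ℕ.^ (suc m ℕ.* suc n)          ≡⟨ cong (q ℕ.^_) (ℕ.*-comm (suc m) (suc n)) ⟩
    q ℕ.^ (suc n ℕ.* suc m)          ≡⟨ sym (ℕ.^-*-assoc q (suc n) (suc m)) ⟩
    (q ℕ.^ suc n) ℕ.^ suc m          ≤⟨ ℕ.^-monoˡ-≤ (suc m) (ℕ.<⇒≤ (n<2^[1+⌊log₂n⌋] (q ℕ.^ suc n))) ⟩
    (2 ℕ.^ suc (L n)) ℕ.^ suc m      ≡⟨ ℕ.^-*-assoc 2 (suc (L n)) (suc m) ⟩
    2 ℕ.^ (suc (L n) ℕ.* suc m)      ≡⟨ cong (λ t → 2 ℕ.^ (t ℕ.* suc m)) (ℕ.+-comm 1 (L n)) ⟩
    2 ℕ.^ ((L n ℕ.+ 1) ℕ.* suc m)    ∎)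
    where open ℕ.≤-Reasoning
  c : ∀ ε → 0ℚ ℚ.< ε → ∃[ N ] (∀ m n → N ℕ.≤ m → N ℕ.≤ n → l m ℚ.≤ l n ℚ.+ ε)
  c ε 0<ε with 1/n≤ε ε 0<ε
  ... | N , h = N , λ m n _ N≤n → begin
    l m                         ≤⟨ /-mono (L m) (L n ℕ.+ 1) m n (key m n) ⟩
    + (L n ℕ.+ 1) ℚ./ suc n     ≡⟨ /-+ (L n) 1 n ⟩
    l n ℚ.+ (+ 1 ℚ./ suc n)     ≤⟨ ℚ.+-monoʳ-≤ (l n) (h n N≤n) ⟩
    l n ℚ.+ ε                   ∎
    where open ℚ.≤-Reasoning
  1≤l : ∀ n → 1ℚ ℚ.≤ l n
  1≤l n = /-mono 1 (L n) 0 n (subst₂ ℕ._≤_ (sym (ℕ.*-identityˡ (suc n))) (sym (ℕ.*-identityʳ (L n)))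
    (subst (ℕ._≤ L n) (⌊log₂[2^n]⌋≡n (suc n)) (⌊log₂⌋-mono-≤ (ℕ.^-monoˡ-≤ (suc n) 1<q))))

PrimePower : ℕ → Set
PrimePower q = ∃[ p ] ∃[ e ] (Prime p × 0 ℕ.< e × q ≡ p ℕ.^ e)

primePower⇒>1 : ∀ {q} → PrimePower q → 1 ℕ.< q
primePower⇒>1 (p , suc e , p-prime , _ , refl) =
  ℕ.≤-trans 1<p (ℕ.m≤m*n p (p ℕ.^ e) {{ℕ.m^n≢0 p e {{ℕ.>-nonZero (ℕ.<⇒≤ 1<p)}}}})
  where
  1<p : 1 ℕ.< p
  1<p = ℕ.nonTrivial⇒n>1 p {{prime⇒nonTrivial p-prime}}

-- The value of 0# ⁻¹ is left unspecified.
record FiniteField (q : ℕ) : Set (lsuc 0ℓ) where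
  field
    commutativeRing : CommutativeRing 0ℓ 0ℓ
  open CommutativeRing commutativeRing public
    renaming (_*_ to _·_) using (Carrier; _≈_; _≉_; _+_; _-_; -_; 0#; 1#)
  infix 9 _⁻¹
  field
    1≉0         : 1# ≉ 0#
    _⁻¹         : Carrier → Carrier
    inverseʳ    : ∀ x → x ≉ 0# → x · x ⁻¹ ≈ 1#
    enumeration : Inverse (CommutativeRing.setoid commutativeRing) (setoid (Fin q))

  code : Carrier → Fin q
  code = Inverse.to enumeration

  decode : Fin q → Carrier
  decode = Inverse.from enumeration

-- Subsets of the field are Data.Fin.Subset's subsets of the set of codes.
module Field {q : ℕ} (𝔽 : FiniteField q) where
  open FiniteField 𝔽 public
  private module R = CommutativeRing commutativeRing

  infix 4 _≈?_ _∈_ _∉_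

  _≈?_ : ∀ x y → Dec (x ≈ y)
  x ≈? y = map′
    (λ eq → R.trans (R.sym (Inverse.strictlyInverseʳ enumeration x))
           (R.trans (Inverse.from-cong enumeration eq) (Inverse.strictlyInverseʳ enumeration y)))
    (Inverse.to-cong enumeration)
    (code x Fin.≟ code y)

  _∈_ _∉_ : Carrier → Subset q → Set
  x ∈ S = code x ∈ˢ S
  x ∉ S = ¬ (x ∈ S)

  elements : Subset q → List Carrier
  elements S = map decode (filter (_∈? S) (allFin q))

  image : (Carrier → Carrier) → Subset q → Subset q
  image f S = ⋃ (map (λ x → ⁅ code (f x) ⁆) (elements S))

  _-ˢ_ : Subset q → Carrier → Subset q
  A -ˢ a = image (_- a) A

  _·ˢ_ : Carrier → Subset q → Subset q
  c ·ˢ X = image (c ·_) X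

  -- E A ξ is E(A, ξA).
  E : Subset q → Carrier → ℕ
  E A ξ = length (filter
    (λ { (a₁ , a₂ , a₃ , a₄) → (a₁ - a₂) ≈? (ξ · (a₃ - a₄)) })
    (cartesianProduct as (cartesianProduct as (cartesianProduct as as))))
    where
    as : List Carrier
    as = elements A

  ∑E : Subset q → Subset q → ℕ
  ∑E A X = sum (map (E A) (elements X))

  record IsSubfield (F : Subset q) : Set where
    field
      0∈         : 0# ∈ F
      1∈         : 1# ∈ F
      +-closed   : ∀ {x y} → x ∈ F → y ∈ F → (x + y) ∈ F
      neg-closed : ∀ {x} → x ∈ F → (- x) ∈ F
      ·-closed   : ∀ {x y} → x ∈ F → y ∈ F → (x · y) ∈ F
      ⁻¹-closed  : ∀ {x} → x ≉ 0# → x ∈ F → (x ⁻¹) ∈ F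

  record IsSubspace (F V : Subset q) : Set where
    field
      0∈       : 0# ∈ V
      +-closed : ∀ {x y} → x ∈ V → y ∈ V → (x + y) ∈ V
      ·-closed : ∀ {c x} → c ∈ F → x ∈ V → (c · x) ∈ V

  record IsSubfieldGeneratedBy (S F : Subset q) : Set where
    field
      isSubfield : IsSubfield F
      contains   : S ⊆ F
      least      : ∀ G → IsSubfield G → S ⊆ G → F ⊆ G

  record IsSubspaceGeneratedBy (F S V : Subset q) : Set where
    field
      isSubspace : IsSubspace F V
      contains   : S ⊆ V
      least      : ∀ W → IsSubspace F W → S ⊆ W → V ⊆ W

  -- Λ stands for C (log q)ᵏ; the exponent e in the bound on ∣ X′ ∣ is 5 or 4,
  -- depending on the hypothesis on energies.
  Conclusion : (A X : Subset q) (Λ K : ℝ⁺) (e : ℕ) → Set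
  Conclusion A X Λ K e =
    ∃[ ā ] ∃[ F ] ∃[ V ]
      (ā ∈ A × IsSubfield F × IsSubspace F V
       × value (Λ ⁻¹⁺) * (  value ((K ^⁺ 704) ⁻¹⁺) * fromℕ ∣ V ∣
                          ⊔ value ((K ^⁺ 85) ⁻¹⁺) * fromℕ ∣ A ∣)
           ≤ fromℕ ∣ V ∩ (A -ˢ ā) ∣
       × ∃[ x₀ ] ∃[ A₁ ] ∃[ X′ ]
           (x₀ ∈ X
            × A₁ ⊆ (A -ˢ ā)
            × X′ ⊆ ((x₀ ⁻¹) ·ˢ X)
            × IsSubfieldGeneratedBy X′ F
            × IsSubspaceGeneratedBy F A₁ V
            × value (Λ ⁻¹⁺ *⁺ (K ^⁺ 85) ⁻¹⁺) * fromℕ ∣ A ∣ ≤ fromℕ ∣ A₁ ∣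
            × value (Λ ⁻¹⁺ *⁺ (K ^⁺ e) ⁻¹⁺) * fromℕ ∣ X ∣ ≤ fromℕ ∣ X′ ∣))

{-# OPTIONS --safe #-}
module Submission where

-- Write r(d) for the number of representations of d as a difference of elements
-- of B.  By Balog–Szemerédi–Gowers and Cauchy–Schwarz, the energy hypothesis gives
-- x₀ ∈ X, B ⊆ A and Y ⊆ x₀⁻¹X, all large, with |B − xB| ≤ μ|B| for every x ∈ Y and
-- also |B − B| ≤ μ|B|, where μ is a power of K.
--
-- The heart of the proof is a gap property: if |B − ξB| ≤ T|B| and |Y| exceeds μ³T,
-- then already |B − ξB| ≤ μ¹⁵|B|, whatever T was.  Call g good if xg is a popular
-- difference of B for a proportion 1/μ of all x ∈ Y; any μ + 1 elements of B include
-- two with a good difference.  Pigeonholing the vectors ξxg (x ∈ Y) modulo B, which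
-- is where T is lost, yields x₁ ≠ x₂ in Y with (x₂ − x₁)ξg good, and dividing by
-- x₂ − x₁ shows that (x − x′)ξg is popular for a proportion μ⁻⁵ of the pairs x, x′.
-- So one pair x ≠ x′ serves for many good vectors g of the form b − ā, which puts a
-- dilate of a large part of B inside both ξ(x − x′)B and the popular differences, and
-- Ruzsa's triangle inequality compares B with ξB.
--
-- Sums and products increase T only polynomially, so by the gap property
-- R = {ξ : |B − ξB| ≤ μ¹⁵|B|} is a subfield containing Y.  By the same argument
-- V = {v : |B + Rv| ≤ μ⁹|B|} is an R-subspace containing every good vector, hence a
-- large part of some translate B − ā, and counting collisions in b + ηv over all
-- v ∈ V gives |V| ≤ μ¹⁰|B|.  The subfield and the subspace generated by Y and by
-- V ∩ (A − ā) lie in R and V.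
--
-- No dyadic pigeonholing occurs, so any power of log q ≥ 1 will do, and replacing K by
-- a natural number between K and 8K only affects the constant C.

-- Sizes of difference sets are compared without Plünnecke's inequality; Ruzsa's triangle inequality
-- and counting of representations suffice. The device is that a difference equal to b₃ - b₄ in at
-- least |B|/t ways can be absorbed into other sets at the cost of a factor t. Hence popular
-- differences stand in for B inside longer sums, and one returns to B because a large part of some
-- translate of B consists of popular differences.
--
-- Every exponent is the sum of such costs. Balog-Szemerédi-Gowers and the selection of x₀ lead to μ
-- = κ³⁹, with κ comparable to K. A difference of two elements of R satisfies the bound with T =
-- μ³³, so the gap property asks for |Y| > μ³⁶. Passing from X to Y costs κ⁴, one more κ makes this
-- strict, and restricting X to its energetic elements costs another κ. The total is κ raised to 36
-- · 39 + 6 = 1410.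
--
-- Constants 2 and 4 are carried through the estimates because each use of popularity discards an
-- error term of the same order as its main term; the surplus factor pays for it.

open import Algebra.Bundles using (CommutativeRing; RawRing)
import Algebra.Properties.Ring as RingProperties
import Algebra.Properties.Semiring.Mult as Mult
import Algebra.Solver.Ring as RingSolver
import Algebra.Solver.Ring.AlmostCommutativeRing as ACR
open import Data.Maybe.Base using (Maybe; just; nothing)
open import Data.Nat.Base using (ℕ) renaming (_+_ to _+ℕ_; _*_ to _*ℕ_)
import Data.Nat.Properties as ℕ
open import Data.Product.Base using (_×_; _,_)
open import Level using (0ℓ)
open import Relation.Binary.PropositionalEquality as ≡ using (_≡_)
open import Relation.Nullary using (yes; no)

-- A solver for commutative rings that understands subtraction: its
-- coefficients are integers, represented as differences of naturals.
module IntegerCoefficients (R : CommutativeRing 0ℓ 0ℓ) where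
  open CommutativeRing R
  open RingProperties (CommutativeRing.ring R)
  open Mult semiring using (×-homo-+; ×1-homo-*; ×-congˡ) renaming (_×_ to _∙_)
  open import Relation.Binary.Reasoning.Setoid setoid

  private
    coefficients : RawRing 0ℓ 0ℓ
    coefficients = record
      { Carrier = ℕ × ℕ
      ; _≈_ = _≡_
      ; _+_ = λ { (a , b) (c , d) → a +ℕ c , b +ℕ d }
      ; _*_ = λ { (a , b) (c , d) → a *ℕ c +ℕ b *ℕ d , a *ℕ d +ℕ b *ℕ c }
      ; -_ = λ { (a , b) → b , a }
      ; 0# = 0 , 0
      ; 1# = 1 , 0
      }

    ⟦_⟧ : ℕ × ℕ → Carrier
    ⟦ a , b ⟧ = a ∙ 1# - b ∙ 1#

    interchange : ∀ x y u v → (x + y) + (u + v) ≈ (x + u) + (y + v)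
    interchange x y u v = begin
      (x + y) + (u + v)  ≈⟨ +-assoc x y (u + v) ⟩
      x + (y + (u + v))  ≈⟨ +-congˡ (sym (+-assoc y u v)) ⟩
      x + ((y + u) + v)  ≈⟨ +-congˡ (+-congʳ (+-comm y u)) ⟩
      x + ((u + y) + v)  ≈⟨ +-congˡ (+-assoc u y v) ⟩
      x + (u + (y + v))  ≈⟨ sym (+-assoc x u (y + v)) ⟩
      (x + u) + (y + v) ∎

    neg-+ : ∀ x y → - (x + y) ≈ - x + - y
    neg-+ x y = sym (-‿+-comm x y)

    homo-+ : ∀ p r → ⟦ RawRing._+_ coefficients p r ⟧ ≈ ⟦ p ⟧ + ⟦ r ⟧
    homo-+ (a , b) (c , d) = begin
      (a +ℕ c) ∙ 1# - (b +ℕ d) ∙ 1#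
        ≈⟨ +-cong (×-homo-+ 1# a c) (-‿cong (×-homo-+ 1# b d)) ⟩
      (a ∙ 1# + c ∙ 1#) - (b ∙ 1# + d ∙ 1#)
        ≈⟨ +-congˡ (neg-+ _ _) ⟩
      (a ∙ 1# + c ∙ 1#) + (- (b ∙ 1#) + - (d ∙ 1#))
        ≈⟨ interchange _ _ _ _ ⟩
      ⟦ a , b ⟧ + ⟦ c , d ⟧ ∎

    homo-* : ∀ p r → ⟦ RawRing._*_ coefficients p r ⟧ ≈ ⟦ p ⟧ * ⟦ r ⟧
    homo-* (a , b) (c , d) = begin
      (a *ℕ c +ℕ b *ℕ d) ∙ 1# - (a *ℕ d +ℕ b *ℕ c) ∙ 1#
        ≈⟨ homo-+ (a *ℕ c , a *ℕ d) (b *ℕ d , b *ℕ c) ⟩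
      ((a *ℕ c) ∙ 1# - (a *ℕ d) ∙ 1#) + ((b *ℕ d) ∙ 1# - (b *ℕ c) ∙ 1#)
        ≈⟨ +-cong (+-cong (×1-homo-* a c) (-‿cong (×1-homo-* a d)))
                  (+-cong (×1-homo-* b d) (-‿cong (×1-homo-* b c))) ⟩
      (x * u - x * v) + (y * v - y * u)
        ≈⟨ +-cong (+-congˡ (-‿distribʳ-* x v)) (trans (+-comm _ _) (+-cong (-‿distribˡ-* y u)
             (trans (sym (-‿involutive _)) (trans (-‿cong (-‿distribˡ-* y v)) (-‿distribʳ-* (- y) v))))) ⟩
      (x * u + x * (- v)) + ((- y) * u + (- y) * (- v))
        ≈⟨ +-cong (sym (distribˡ x u (- v))) (sym (distribˡ (- y) u (- v))) ⟩
      x * (u - v) + (- y) * (u - v)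
        ≈⟨ sym (distribʳ (u - v) x (- y)) ⟩
      ⟦ a , b ⟧ * ⟦ c , d ⟧ ∎
      where
      x = a ∙ 1#
      y = b ∙ 1#
      u = c ∙ 1#
      v = d ∙ 1#

    homo-neg : ∀ p → ⟦ RawRing.-_ coefficients p ⟧ ≈ - ⟦ p ⟧
    homo-neg (a , b) = begin
      b ∙ 1# - a ∙ 1#            ≈⟨ +-comm _ _ ⟩
      - (a ∙ 1#) + b ∙ 1#        ≈⟨ +-congˡ (sym (-‿involutive _)) ⟩
      - (a ∙ 1#) + - (- (b ∙ 1#)) ≈⟨ -‿+-comm _ _ ⟩
      - ⟦ a , b ⟧ ∎

    morphism : coefficients ACR.-Raw-AlmostCommutative⟶ ACR.fromCommutativeRing R
    morphism = record
      { ⟦_⟧ = ⟦_⟧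
      ; +-homo = homo-+
      ; *-homo = homo-*
      ; -‿homo = homo-neg
      ; 0-homo = -‿inverseʳ 0#
      ; 1-homo = trans (+-cong (+-identityʳ 1#) -0#≈0#) (+-identityʳ 1#)
      }

    -- The pairs (a , b) and (c , d) stand for the same integer when a + d = c + b; comparing cross
    -- sums avoids normal forms for the pairs.
    weakly-decide : ∀ p r → Maybe (⟦ p ⟧ ≈ ⟦ r ⟧)
    weakly-decide (a , b) (c , d) with a +ℕ d ℕ.≟ c +ℕ b
    ... | no _   = nothing
    ... | yes eq = just (begin
      x - y                  ≈⟨ +-congʳ (sym (trans (+-congˡ (-‿inverseʳ v)) (+-identityʳ x))) ⟩
      (x + (v - v)) - y      ≈⟨ +-congʳ (sym (+-assoc x v (- v))) ⟩
      ((x + v) - v) - y      ≈⟨ +-congʳ (+-congʳ (trans (sym (×-homo-+ 1# a d))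
                                  (trans (×-congˡ eq) (×-homo-+ 1# c b)))) ⟩
      ((u + y) - v) - y      ≈⟨ +-congʳ (trans (+-congʳ (+-comm u y)) (+-assoc y u (- v))) ⟩
      (y + (u - v)) - y      ≈⟨ +-congʳ (+-comm y _) ⟩
      ((u - v) + y) - y      ≈⟨ +-assoc _ y (- y) ⟩
      (u - v) + (y - y)      ≈⟨ trans (+-congˡ (-‿inverseʳ y)) (+-identityʳ _) ⟩
      u - v ∎)
      where
      x = a ∙ 1#
      y = b ∙ 1#
      u = c ∙ 1#
      v = d ∙ 1#

  open RingSolver coefficients (ACR.fromCommutativeRing R) morphism weakly-decide public

module Counting where

  open import Algebra.Structures using (IsCommutativeRing)
  import Algebra.Properties.Semiring.Sum as Sum
  open import Data.Empty using (⊥-elim)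
  open import Data.Fin.Base using (Fin; zero; suc)
  open import Data.Fin.Permutation using (permutation)
  import Data.Fin.Properties as Fin
  open import Data.Nat.Base hiding (_⊔_)
  open import Data.Nat.Properties
  open import Data.Nat.Solver using (module +-*-Solver)
  open import Data.Nat.Tactic.RingSolver using (solve-∀)
  open import Data.Product.Base using (∃-syntax; proj₁; proj₂)
  open import Data.Sum.Base using (inj₁; inj₂)
  open import Function.Base using (_∘_; id)
  open import Relation.Binary.PropositionalEquality
    using (_≢_; refl; sym; trans; cong; cong₂; subst; subst₂)
  open import Relation.Nullary using (¬_; Dec)
  open import Relation.Nullary.Decidable using (_×-dec_; ¬?; decidable-stable)

  open ≤-Reasoning

  private module Σℕ = Sum +-*-semiring

  -- Finite sums and sets

  -- The indicator of a decidable proposition as a number, so that cardinalities, restricted sums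
  -- and energies are all instances of one weighted sum.
  ι : ∀ {p} {P : Set p} → Dec P → ℕ
  ι (yes _) = 1
  ι (no _)  = 0

  module _ {p} {P : Set p} where

    ι≤1 : (d : Dec P) → ι d ≤ 1
    ι≤1 (yes _) = ≤-refl
    ι≤1 (no _)  = z≤n

    ι-yes : (d : Dec P) → P → ι d ≡ 1
    ι-yes (yes _) _ = refl
    ι-yes (no ¬p) p = ⊥-elim (¬p p)

    ι-no : (d : Dec P) → ¬ P → ι d ≡ 0
    ι-no (yes p) ¬p = ⊥-elim (¬p p)
    ι-no (no _)  _  = refl

    ι-mono : ∀ {q} {Q : Set q} (d : Dec P) (e : Dec Q) → (P → Q) → ι d ≤ ι e
    ι-mono (yes p) e f = ≤-reflexive (sym (help e (f p)))
      where
      help : ∀ {q} {Q : Set q} (e : Dec Q) → Q → ι e ≡ 1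
      help (yes _) _ = refl
      help (no ¬q) q = ⊥-elim (¬q q)
    ι-mono (no _)  e f = z≤n

    ι*-mono : (d : Dec P) {a b : ℕ} → (P → a ≤ b) → ι d * a ≤ ι d * b
    ι*-mono (yes p) h = +-monoˡ-≤ 0 (h p)
    ι*-mono (no _)  h = z≤n

    ι*≤ : (d : Dec P) {a b : ℕ} → (P → a ≤ b) → ι d * a ≤ b
    ι*≤ (yes p) h = ≤-trans (≤-reflexive (+-identityʳ _)) (h p)
    ι*≤ (no _)  h = z≤n

    ι-× : ∀ {q} {Q : Set q} (d : Dec P) (e : Dec Q) → ι (d ×-dec e) ≡ ι d * ι e
    ι-× (yes _) (yes _) = refl
    ι-× (yes _) (no _)  = refl
    ι-× (no _)  (yes _) = refl
    ι-× (no _)  (no _)  = refl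

  ι-mono-× : ∀ {p q r} {P : Set p} {Q : Set q} {R : Set r} (d : Dec P) (e : Dec Q) (f : Dec R) →
             (P → Q × R) → ι d ≤ ι e * ι f
  ι-mono-× d e f h = subst (ι d ≤_) (ι-× e f) (ι-mono d (e ×-dec f) h)

  opaque

    sum : ∀ {n} → (Fin n → ℕ) → ℕ
    sum = Σℕ.sum

    sum-cong-≗ : ∀ {n} {f g : Fin n → ℕ} → (∀ x → f x ≡ g x) → sum f ≡ sum g
    sum-cong-≗ = Σℕ.sum-cong-≗

    ∑-distrib-+ : ∀ {n} (f g : Fin n → ℕ) → sum (λ x → f x + g x) ≡ sum f + sum g
    ∑-distrib-+ = Σℕ.∑-distrib-+

    ∑-comm : ∀ {m n} (f : Fin m → Fin n → ℕ) → sum (λ x → sum (f x)) ≡ sum (λ y → sum λ x → f x y)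
    ∑-comm = Σℕ.∑-comm

    *-distribˡ-sum : ∀ {n} c (f : Fin n → ℕ) → c * sum f ≡ sum (λ x → c * f x)
    *-distribˡ-sum = Σℕ.*-distribˡ-sum

    *-distribʳ-sum : ∀ {n} c (f : Fin n → ℕ) → sum f * c ≡ sum (λ x → f x * c)
    *-distribʳ-sum = Σℕ.*-distribʳ-sum

    sum-mono : ∀ {n} {f g : Fin n → ℕ} → (∀ x → f x ≤ g x) → sum f ≤ sum g
    sum-mono {zero}  h = z≤n
    sum-mono {suc n} h = +-mono-≤ (h zero) (sum-mono (h ∘ suc))

    sum-zero : ∀ {n} {f : Fin n → ℕ} → (∀ x → f x ≡ 0) → sum f ≡ 0
    sum-zero {zero}  h = refl
    sum-zero {suc n} h = cong₂ _+_ (h zero) (sum-zero (h ∘ suc))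

    term≤sum : ∀ {n} (f : Fin n → ℕ) x → f x ≤ sum f
    term≤sum f zero    = m≤m+n _ _
    term≤sum f (suc x) = ≤-trans (term≤sum (f ∘ suc) x) (m≤n+m _ _)

    sum-reindex : ∀ {n} (f : Fin n → ℕ) (φ ψ : Fin n → Fin n) →
                  (∀ x → φ (ψ x) ≡ x) → (∀ x → ψ (φ x) ≡ x) → sum (f ∘ φ) ≡ sum f
    sum-reindex f φ ψ p q = sym (Σℕ.sum-permute f (permutation φ ψ p q))

    sum-delta : ∀ {n} (y : Fin n) → sum (λ x → ι (x Fin.≟ y)) ≡ 1
    sum-delta {suc n} zero    = cong suc (sum-zero {n} λ x → ι-no (suc x Fin.≟ zero) λ ())
    sum-delta {suc n} (suc y) = trans
      (cong₂ _+_ (ι-no (zero Fin.≟ suc y) λ ()) (sum-cong-≗ λ x → lem x))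
      (sum-delta y)
      where
      lem : ∀ x → ι (suc x Fin.≟ suc y) ≡ ι (x Fin.≟ y)
      lem x with x Fin.≟ y
      ... | yes _ = refl
      ... | no _  = refl

  sum-<⇒∃ : ∀ {n} (f g : Fin n → ℕ) → sum f < sum g → ∃[ x ] f x < g x
  sum-<⇒∃ f g h with Fin.any? (λ x → f x <? g x)
  ... | yes p = p
  ... | no ¬p = ⊥-elim (<⇒≱ h (sum-mono λ x → ≮⇒≥ (λ lt → ¬p (x , lt))))

  -- Sets as decidable predicates rather than bit vectors: membership in a difference set or a
  -- restriction then unfolds directly to its witnesses.
  record FSet (q : ℕ) : Set₁ where
    constructor mkF
    infix 4 _∋_ _∋?_
    field
      _∋_  : Fin q → Set
      _∋?_ : ∀ x → Dec (_∋_ x)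

  open FSet public

  module _ {q : ℕ} where

    infix 9 #_
    infix 4 _⊑_

    _⊑_ : FSet q → FSet q → Set
    S ⊑ T = ∀ {x} → S ∋ x → T ∋ x

    full : FSet q
    full = mkF (λ _ → Fin q) (λ x → yes x)

    image₂ : (Fin q → Fin q → Fin q) → FSet q → FSet q → FSet q
    image₂ f S T = mkF
      (λ z → ∃[ a ] ∃[ b ] (S ∋ a × T ∋ b × z ≡ f a b))
      (λ z → Fin.any? λ a → Fin.any? λ b → (S ∋? a) ×-dec (T ∋? b) ×-dec (z Fin.≟ f a b))

    restrict : FSet q → {P : Fin q → Set} → (∀ x → Dec (P x)) → FSet q
    restrict S {P} P? = mkF (λ x → S ∋ x × P x) (λ x → (S ∋? x) ×-dec P? x)

    opaque

      ∑∈ : FSet q → (Fin q → ℕ) → ℕ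
      ∑∈ S f = sum λ x → ι (S ∋? x) * f x

      #_ : FSet q → ℕ
      # S = sum λ x → ι (S ∋? x)

    opaque
      unfolding ∑∈ #_

      ∑∈-mono : ∀ S {f g : Fin q → ℕ} → (∀ {x} → S ∋ x → f x ≤ g x) → ∑∈ S f ≤ ∑∈ S g
      ∑∈-mono S h = sum-mono λ x → ι*-mono (S ∋? x) h

      ∑∈-⊑ : ∀ {S T : FSet q} {f : Fin q → ℕ} → S ⊑ T → ∑∈ S f ≤ ∑∈ T f
      ∑∈-⊑ {S} {T} {f} h = sum-mono λ x → *-monoˡ-≤ (f x) (ι-mono (S ∋? x) (T ∋? x) h)

      ∑∈-cong : ∀ S {f g : Fin q → ℕ} → (∀ x → f x ≡ g x) → ∑∈ S f ≡ ∑∈ S g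
      ∑∈-cong S h = sum-cong-≗ λ x → cong (ι (S ∋? x) *_) (h x)

      ∑∈-const : ∀ S c → ∑∈ S (λ _ → c) ≡ # S * c
      ∑∈-const S c = sym (*-distribʳ-sum c (λ x → ι (S ∋? x)))

      #-∑∈ : ∀ S → # S ≡ ∑∈ S (λ _ → 1)
      #-∑∈ S = trans (sym (*-identityʳ (# S))) (sym (∑∈-const S 1))

      ∑∈-scale : ∀ S c (f : Fin q → ℕ) → ∑∈ S (λ x → c * f x) ≡ c * ∑∈ S f
      ∑∈-scale S c f = trans (sum-cong-≗ λ x → lem (ι (S ∋? x)) c (f x))
        (sym (*-distribˡ-sum c (λ x → ι (S ∋? x) * f x)))
        where
        lem : ∀ a b d → a * (b * d) ≡ b * (a * d)
        lem = solve-∀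

      ∑∈-+ : ∀ S (f g : Fin q → ℕ) → ∑∈ S (λ x → f x + g x) ≡ ∑∈ S f + ∑∈ S g
      ∑∈-+ S f g = trans (sum-cong-≗ λ x → *-distribˡ-+ (ι (S ∋? x)) (f x) (g x))
        (∑-distrib-+ (λ x → ι (S ∋? x) * f x) (λ x → ι (S ∋? x) * g x))

      ∑∈-sum : ∀ S (f : Fin q → Fin q → ℕ) →
               ∑∈ S (λ x → sum (f x)) ≡ sum (λ y → ∑∈ S λ x → f x y)
      ∑∈-sum S f = trans (sum-cong-≗ λ x → *-distribˡ-sum (ι (S ∋? x)) (f x))
        (∑-comm (λ x y → ι (S ∋? x) * f x y))

      ∑∈-swap : ∀ S T (f : Fin q → Fin q → ℕ) →
                ∑∈ S (λ x → ∑∈ T (f x)) ≡ ∑∈ T (λ y → ∑∈ S λ x → f x y)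
      ∑∈-swap S T f = trans (∑∈-sum S (λ x y → ι (T ∋? y) * f x y))
        (sum-cong-≗ λ y → ∑∈-scale S (ι (T ∋? y)) (λ x → f x y))

      ∑∈≤sum : ∀ S (f : Fin q → ℕ) → ∑∈ S f ≤ sum f
      ∑∈≤sum S f = sum-mono λ x → ι*≤ (S ∋? x) λ _ → ≤-refl

      ∑∈-<⇒∃ : ∀ S (f g : Fin q → ℕ) → ∑∈ S f < ∑∈ S g → ∃[ x ] (S ∋ x × f x < g x)
      ∑∈-<⇒∃ S f g h with sum-<⇒∃ _ _ h
      ... | x , lt with S ∋? x
      ...   | yes x∈S = x , x∈S , subst₂ _<_ (+-identityʳ _) (+-identityʳ _) lt

      #>0⇒∃ : ∀ S → 0 < # S → ∃[ x ] S ∋ x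
      #>0⇒∃ S h with sum-<⇒∃ (λ (_ : Fin q) → 0) _ (subst (_< # S) (sym (sum-zero {q} λ _ → refl)) h)
      ... | x , lt with S ∋? x
      ...   | yes x∈S = x , x∈S

      -- Reduces to the strict version by raising every value of g by one, which increases its sum
      -- by # S > 0.
      ∑∈-≤⇒∃ : ∀ S (f g : Fin q → ℕ) → 0 < # S → ∑∈ S f ≤ ∑∈ S g → ∃[ x ] (S ∋ x × f x ≤ g x)
      ∑∈-≤⇒∃ S f g S>0 h with ∑∈-<⇒∃ S f (λ x → suc (g x)) lt
        where
        lt : ∑∈ S f < ∑∈ S (λ x → 1 + g x)
        lt = begin-strict
          ∑∈ S f
            ≤⟨ h ⟩
          ∑∈ S g
            <⟨ +-monoˡ-≤ (∑∈ S g) S>0 ⟩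
          # S + ∑∈ S g
            ≡⟨ cong (_+ ∑∈ S g) (#-∑∈ S) ⟩
          ∑∈ S (λ _ → 1) + ∑∈ S g
            ≡⟨ sym (∑∈-+ S (λ _ → 1) g) ⟩
          ∑∈ S (λ x → 1 + g x) ∎
      ... | x , x∈S , s≤s le = x , x∈S , le

      ∑∈-restrict : ∀ S {P : Fin q → Set} (P? : ∀ x → Dec (P x)) →
                    ∑∈ S (λ x → ι (P? x)) ≡ # (restrict S P?)
      ∑∈-restrict S P? = sum-cong-≗ λ x → sym (ι-× (S ∋? x) (P? x))

      ∑∈-restrict′ : ∀ S {P : Fin q → Set} (P? : ∀ x → Dec (P x)) (f : Fin q → ℕ) →
                     ∑∈ S (λ x → ι (P? x) * f x) ≡ ∑∈ (restrict S P?) f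
      ∑∈-restrict′ S P? f = sum-cong-≗ λ x → trans (sym (*-assoc (ι (S ∋? x)) (ι (P? x)) (f x)))
        (cong (_* f x) (sym (ι-× (S ∋? x) (P? x))))

      sum≤∑∈ : ∀ S (f g : Fin q → ℕ) (φ ψ : Fin q → Fin q) → (∀ x → φ (ψ x) ≡ x) → (∀ x → ψ (φ x) ≡ x) →
               (∀ x → f x ≤ ι (S ∋? φ x) * g (φ x)) → sum f ≤ ∑∈ S g
      sum≤∑∈ S f g φ ψ p r h = ≤-trans (sum-mono h)
        (≤-reflexive (sum-reindex (λ x → ι (S ∋? x) * g x) φ ψ p r))

      #≤∑∈ : ∀ {S T} → T ⊑ S → # T ≤ ∑∈ S (λ x → ι (T ∋? x))
      #≤∑∈ {S} {T} h = sum-mono λ x → ι-mono-× (T ∋? x) (S ∋? x) (T ∋? x) λ t → h t , t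

      ∑∈-∩ : ∀ S T U → ∑∈ S (λ x → ι (T ∋? x) * ι (U ∋? x)) ≤ # (restrict T (U ∋?_))
      ∑∈-∩ S T U = ≤-trans (∑∈≤sum S _) (≤-reflexive (sum-cong-≗ λ x → sym (ι-× (T ∋? x) (U ∋? x))))

      sum-ι : ∀ S → sum (λ x → ι (S ∋? x)) ≡ # S
      sum-ι S = refl

      #-mono : ∀ {S T} → S ⊑ T → # S ≤ # T
      #-mono {S} {T} h = sum-mono λ x → ι-mono (S ∋? x) (T ∋? x) h

      ∋⇒#>0 : ∀ S {x} → S ∋ x → 0 < # S
      ∋⇒#>0 S {x} h = ≤-trans (≤-reflexive (sym (ι-yes (S ∋? x) h))) (term≤sum (λ x → ι (S ∋? x)) x)

      #-bij : ∀ {S T} (φ ψ : Fin q → Fin q) → (∀ x → φ (ψ x) ≡ x) → (∀ x → ψ (φ x) ≡ x) →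
              (∀ {x} → S ∋ x → T ∋ φ x) → # S ≤ # T
      #-bij {S} {T} φ ψ p r h = ≤-trans
        (sum-mono λ x → ι-mono (S ∋? x) (T ∋? φ x) h)
        (≤-reflexive (sum-reindex (λ x → ι (T ∋? x)) φ ψ p r))

      ∑∈-delta : ∀ S → ∑∈ S (λ i → ∑∈ S (λ j → ι (i Fin.≟ j))) ≤ # S
      ∑∈-delta S = ≤-trans (∑∈-mono S λ {i} _ → ≤-trans (∑∈≤sum S _)
          (≤-reflexive (trans (sum-cong-≗ λ j → flip i j) (sum-delta i))))
        (≤-reflexive (sym (#-∑∈ S)))
        where
        flip : ∀ (i j : Fin q) → ι (i Fin.≟ j) ≡ ι (j Fin.≟ i)
        flip i j with i Fin.≟ j | j Fin.≟ i
        ... | yes _ | yes _ = refl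
        ... | no _  | no _  = refl
        ... | yes p | no ¬p = ⊥-elim (¬p (sym p))
        ... | no ¬p | yes p = ⊥-elim (¬p (sym p))

      #-delta : ∀ S → (∀ {x y} → S ∋ x → S ∋ y → x ≡ y) → # S ≤ 1
      #-delta S h with Fin.any? (S ∋?_)
      ... | yes (y , y∈S) = ≤-trans (sum-mono λ x → ι-mono (S ∋? x) (x Fin.≟ y) λ x∈S → h x∈S y∈S)
                              (≤-reflexive (sum-delta y))
      ... | no ¬p = ≤-trans (≤-reflexive (sum-zero λ x → ι-no (S ∋? x) λ x∈S → ¬p (x , x∈S))) z≤n

  2mn≤m²+n² : ∀ m n → 2 * (m * n) ≤ m * m + n * n
  2mn≤m²+n² m n with ≤-total m n
  ... | inj₁ m≤n with m≤n⇒∃[o]m+o≡n m≤n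
  ...   | o , refl = ≤-trans (m≤m+n _ (o * o)) (≤-reflexive (lem m o))
    where
    lem : ∀ m o → 2 * (m * (m + o)) + o * o ≡ m * m + (m + o) * (m + o)
    lem = solve-∀
  2mn≤m²+n² m n | inj₂ n≤m with m≤n⇒∃[o]m+o≡n n≤m
  ...   | o , refl = ≤-trans (m≤m+n _ (o * o)) (≤-reflexive (lem n o))
    where
    lem : ∀ m o → 2 * ((m + o) * m) + o * o ≡ (m + o) * (m + o) + m * m
    lem = solve-∀

  module _ {q : ℕ} where

    ∑∈-prod : ∀ (S T : FSet q) (f g : Fin q → ℕ) →
              ∑∈ S f * ∑∈ T g ≡ ∑∈ S (λ x → ∑∈ T λ y → f x * g y)
    ∑∈-prod S T f g = begin-equality
      ∑∈ S f * ∑∈ T g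
        ≡⟨ *-comm (∑∈ S f) (∑∈ T g) ⟩
      ∑∈ T g * ∑∈ S f
        ≡⟨ sym (∑∈-scale S (∑∈ T g) f) ⟩
      ∑∈ S (λ x → ∑∈ T g * f x)
        ≡⟨ ∑∈-cong S (λ x → trans (*-comm (∑∈ T g) (f x))
             (sym (∑∈-scale T (f x) g))) ⟩
      ∑∈ S (λ x → ∑∈ T λ y → f x * g y) ∎

    -- Sum 2 f(x) f(y) ≤ f(x)² + f(y)² over all pairs x, y in S.
    cauchy-schwarz : ∀ (S : FSet q) (f : Fin q → ℕ) → ∑∈ S f * ∑∈ S f ≤ # S * ∑∈ S (λ x → f x * f x)
    cauchy-schwarz S f = *-cancelˡ-≤ 2 (begin
      2 * (∑∈ S f * ∑∈ S f)
        ≡⟨ cong (2 *_) (∑∈-prod S S f f) ⟩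
      2 * ∑∈ S (λ x → ∑∈ S λ y → f x * f y)
        ≡⟨ sym (∑∈-scale S 2 _) ⟩
      ∑∈ S (λ x → 2 * ∑∈ S λ y → f x * f y)
        ≡⟨ ∑∈-cong S (λ x → sym (∑∈-scale S 2 _)) ⟩
      ∑∈ S (λ x → ∑∈ S λ y → 2 * (f x * f y))
        ≤⟨ ∑∈-mono S (λ {x} _ → ∑∈-mono S λ {y} _ → 2mn≤m²+n² (f x) (f y)) ⟩
      ∑∈ S (λ x → ∑∈ S λ y → f x * f x + f y * f y)
        ≡⟨ ∑∈-cong S (λ x → trans (∑∈-+ S _ _) (cong (_+ Q) (∑∈-const S (f x * f x)))) ⟩
      ∑∈ S (λ x → # S * (f x * f x) + Q)
        ≡⟨ trans (∑∈-+ S _ _) (cong₂ _+_ (∑∈-scale S (# S) _) (∑∈-const S Q)) ⟩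
      # S * Q + # S * Q
        ≡⟨ lem (# S * Q) ⟩
      2 * (# S * Q) ∎)
      where
      Q = ∑∈ S (λ x → f x * f x)
      lem : ∀ a → a + a ≡ 2 * a
      lem = solve-∀

    opaque
      unfolding ∑∈ #_

      ∑∈-support : ∀ (Z : FSet q) (f : Fin q → ℕ) → (∀ x → 0 < f x → Z ∋ x) → sum f ≤ ∑∈ Z f
      ∑∈-support Z f h = sum-mono lem
        where
        lem : ∀ x → f x ≤ ι (Z ∋? x) * f x
        lem x with Z ∋? x
        ... | yes _ = ≤-reflexive (sym (+-identityʳ (f x)))
        ... | no ¬z = ≮⇒≥ λ lt → ¬z (h x lt)

    -- If f t < c, the last term pays for t f; otherwise f ≤ c does. Summed over a set, this is the
    -- popularity principle: values below c/t contribute at most c/t each.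
    popular : ∀ {f c} t → f ≤ c → t * f ≤ t * c * ι (c ≤? f * t) + c
    popular {f} {c} t f≤c with c ≤? f * t
    ... | yes _ = ≤-trans (*-monoʳ-≤ t f≤c) (≤-trans (≤-reflexive (sym (*-identityʳ (t * c)))) (m≤m+n _ c))
    ... | no ¬p = ≤-trans (≤-reflexive (*-comm t f)) (≤-trans (<⇒≤ (≰⇒> ¬p)) (m≤n+m c _))

    popular₁ : ∀ (S : FSet q) (f : Fin q → ℕ) c t → (∀ {x} → S ∋ x → f x ≤ c) →
               t * ∑∈ S f ≤ t * c * # (restrict S (λ x → c ≤? f x * t)) + # S * c
    popular₁ S f c t h = begin
      t * ∑∈ S f
        ≡⟨ sym (∑∈-scale S t f) ⟩
      ∑∈ S (λ x → t * f x)
        ≤⟨ ∑∈-mono S (λ x∈S → popular t (h x∈S)) ⟩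
      ∑∈ S (λ x → t * c * ι (c ≤? f x * t) + c)
        ≡⟨ ∑∈-+ S _ _ ⟩
      ∑∈ S (λ x → t * c * ι (c ≤? f x * t)) + ∑∈ S (λ _ → c)
        ≡⟨ cong₂ _+_ (trans (∑∈-scale S (t * c) _) (cong (t * c *_) (∑∈-restrict S _))) (∑∈-const S c) ⟩
      t * c * # (restrict S (λ x → c ≤? f x * t)) + # S * c ∎

    popular₂ : ∀ (S T : FSet q) (f : Fin q → Fin q → ℕ) c t →
               (∀ {x y} → S ∋ x → T ∋ y → f x y ≤ c) →
               t * ∑∈ S (λ x → ∑∈ T (f x)) ≤
               t * c * ∑∈ S (λ x → ∑∈ T (λ y → ι (c ≤? f x y * t))) + # S * (# T * c)
    popular₂ S T f c t h = begin
      t * ∑∈ S (λ x → ∑∈ T (f x))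
        ≡⟨ sym (∑∈-scale S t _) ⟩
      ∑∈ S (λ x → t * ∑∈ T (f x))
        ≤⟨ ∑∈-mono S (λ {x} x∈S → ≤-trans (popular₁ T (f x) c t (h x∈S))
             (≤-reflexive (cong (λ u → t * c * u + # T * c) (sym (∑∈-restrict T _))))) ⟩
      ∑∈ S (λ x → t * c * ∑∈ T (λ y → ι (c ≤? f x y * t)) + # T * c)
        ≡⟨ trans (∑∈-+ S _ _) (cong₂ _+_ (∑∈-scale S (t * c) _) (∑∈-const S (# T * c))) ⟩
      t * c * ∑∈ S (λ x → ∑∈ T (λ y → ι (c ≤? f x y * t))) + # S * (# T * c) ∎

  -- Counting in a finite field

  -- A field on the codes themselves, whose equality is propositional.
  record CodeField (q : ℕ) : Set where
    infixl 6 _⊕_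
    infixl 7 _⊗_
    infix  8 ⊖_
    field
      _⊕_ _⊗_ : Fin q → Fin q → Fin q
      ⊖_ invˢ  : Fin q → Fin q
      𝟘 𝟙      : Fin q
      isCommutativeRing : IsCommutativeRing _≡_ _⊕_ _⊗_ ⊖_ 𝟘 𝟙
      ⊗-inverse : ∀ x → x ≢ 𝟘 → x ⊗ invˢ x ≡ 𝟙

    commutativeRing : CommutativeRing 0ℓ 0ℓ
    commutativeRing = record { isCommutativeRing = isCommutativeRing }

  module Combinatorics {q : ℕ} (C : CodeField q) where
    open CodeField C public
    open IntegerCoefficients commutativeRing public
      using (solve; _:=_; _:+_; _:*_; _:-_; :-_)

    infixl 6 _⊝_
    _⊝_ : Fin q → Fin q → Fin q
    a ⊝ b = a ⊕ ⊖ b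

    infix 7 _⊟_
    infix 8 _⊙_
    _⊟_ : FSet q → FSet q → FSet q
    _⊟_ = image₂ _⊝_

    _⊙_ : Fin q → FSet q → FSet q
    ξ ⊙ S = mkF (λ z → ∃[ a ] (S ∋ a × z ≡ ξ ⊗ a))
                (λ z → Fin.any? λ a → (S ∋? a) ×-dec (z Fin.≟ ξ ⊗ a))

    a⊝b⊕b≡a : ∀ a b → a ⊝ b ⊕ b ≡ a
    a⊝b⊕b≡a = solve 2 (λ a b → a :- b :+ b := a) refl

    a⊕b⊝b≡a : ∀ a b → a ⊕ b ⊝ b ≡ a
    a⊕b⊝b≡a = solve 2 (λ a b → a :+ b :- b := a) refl

    a⊝[a⊝b]≡b : ∀ a b → a ⊝ (a ⊝ b) ≡ b
    a⊝[a⊝b]≡b = solve 2 (λ a b → a :- (a :- b) := b) refl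

    a⊝a≡𝟘 : ∀ a → a ⊝ a ≡ 𝟘
    a⊝a≡𝟘 a = CommutativeRing.-‿inverseʳ commutativeRing a

    a⊝b≡𝟘⇒a≡b : ∀ {a b} → a ⊝ b ≡ 𝟘 → a ≡ b
    a⊝b≡𝟘⇒a≡b {a} {b} eq = trans (sym (a⊝b⊕b≡a a b))
      (trans (cong (_⊕ b) eq) (CommutativeRing.+-identityˡ commutativeRing b))

    inv-cancelˡ : ∀ {c} → c ≢ 𝟘 → ∀ x → invˢ c ⊗ (c ⊗ x) ≡ x
    inv-cancelˡ {c} c≢0 x = trans
      (solve 3 (λ c d x → d :* (c :* x) := c :* d :* x) refl c (invˢ c) x)
      (trans (cong (_⊗ x) (⊗-inverse c c≢0)) (CommutativeRing.*-identityˡ commutativeRing x))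

    inv-cancelʳ : ∀ {c} → c ≢ 𝟘 → ∀ x → c ⊗ (invˢ c ⊗ x) ≡ x
    inv-cancelʳ {c} c≢0 x = trans
      (solve 3 (λ c d x → c :* (d :* x) := c :* d :* x) refl c (invˢ c) x)
      (trans (cong (_⊗ x) (⊗-inverse c c≢0)) (CommutativeRing.*-identityˡ commutativeRing x))

    ⊗-cancelˡ : ∀ {c} → c ≢ 𝟘 → ∀ {x y} → c ⊗ x ≡ c ⊗ y → x ≡ y
    ⊗-cancelˡ {c} c≢0 {x} {y} eq =
      trans (sym (inv-cancelˡ c≢0 x)) (trans (cong (invˢ c ⊗_) eq) (inv-cancelˡ c≢0 y))

    sum-translate : ∀ (f : Fin q → ℕ) c → sum (λ z → f (z ⊕ c)) ≡ sum f
    sum-translate f c = sum-reindex f (_⊕ c) (_⊝ c) (λ x → a⊝b⊕b≡a x c) (λ x → a⊕b⊝b≡a x c)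

    sum-translate⁻ : ∀ (f : Fin q → ℕ) c → sum (λ z → f (z ⊝ c)) ≡ sum f
    sum-translate⁻ f c = sum-reindex f (_⊝ c) (_⊕ c) (λ x → a⊕b⊝b≡a x c) (λ x → a⊝b⊕b≡a x c)

    sum-reflect : ∀ (f : Fin q → ℕ) c → sum (λ z → f (c ⊝ z)) ≡ sum f
    sum-reflect f c = sum-reindex f (c ⊝_) (c ⊝_) (a⊝[a⊝b]≡b c) (a⊝[a⊝b]≡b c)

    sum-dilate : ∀ (f : Fin q → ℕ) {c} → c ≢ 𝟘 → sum (λ z → f (c ⊗ z)) ≡ sum f
    sum-dilate f {c} c≢0 = sum-reindex f (c ⊗_) (invˢ c ⊗_) (inv-cancelʳ c≢0) (inv-cancelˡ c≢0)

    #-dilate : ∀ {S T c} → c ≢ 𝟘 → (∀ {x} → S ∋ x → T ∋ (c ⊗ x)) → # S ≤ # T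
    #-dilate {S} {T} {c} c≢0 = #-bij {S = S} {T} (c ⊗_) (invˢ c ⊗_) (inv-cancelʳ c≢0) (inv-cancelˡ c≢0)

    #⊙≤ : ∀ ξ S → # (ξ ⊙ S) ≤ # S
    #⊙≤ ξ S with ξ Fin.≟ 𝟘
    ... | no ξ≢0 = #-bij {S = ξ ⊙ S} {S} (invˢ ξ ⊗_) (ξ ⊗_) (inv-cancelˡ ξ≢0) (inv-cancelʳ ξ≢0)
                     λ { (a , a∈S , refl) → subst (S ∋_) (sym (inv-cancelˡ ξ≢0 a)) a∈S }
    -- Dilation by 𝟘 is not injective, but 𝟘 ⊙ S has at most one point, and if it has one then S is
    -- nonempty.
    ... | yes refl with # (𝟘 ⊙ S) in eq
    ...   | zero = z≤n
    ...   | suc k with #>0⇒∃ (𝟘 ⊙ S) (subst (0 <_) (sym eq) (s≤s z≤n))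
    ...     | _ , a , a∈S , _ = ≤-trans
              (subst (_≤ 1) eq (#-delta (𝟘 ⊙ S) λ { (a , _ , refl) (b , _ , refl) →
                solve-0 a b }))
              (∋⇒#>0 S a∈S)
      where
      solve-0 : ∀ a b → 𝟘 ⊗ a ≡ 𝟘 ⊗ b
      solve-0 a b = trans (CommutativeRing.zeroˡ commutativeRing a)
                          (sym (CommutativeRing.zeroˡ commutativeRing b))

    rep : FSet q → Fin q → ℕ
    rep B d = ∑∈ B λ b → ι (B ∋? (b ⊝ d))

    rep≤# : ∀ B d → rep B d ≤ # B
    rep≤# B d = ≤-trans (∑∈-mono B (λ {b} _ → ι≤1 (B ∋? (b ⊝ d)))) (≤-reflexive (sym (#-∑∈ B)))

    opaque
      unfolding ∑∈ #_

      sum-rep : ∀ B → sum (rep B) ≡ # B * # B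
      sum-rep B = begin-equality
        sum (λ d → ∑∈ B λ b → ι (B ∋? (b ⊝ d)))
          ≡⟨ sym (∑∈-sum B λ b d → ι (B ∋? (b ⊝ d))) ⟩
        ∑∈ B (λ b → sum λ d → ι (B ∋? (b ⊝ d)))
          ≡⟨ ∑∈-cong B (λ b → sum-reflect (λ x → ι (B ∋? x)) b) ⟩
        ∑∈ B (λ _ → # B)
          ≡⟨ ∑∈-const B (# B) ⟩
        # B * # B ∎

      -- Double counting: the index i together with the point α i - z of Q determines z.
      count-pairs : ∀ (Z I Q : FSet q) (α : Fin q → Fin q) n t →
                    (∀ {z} → Z ∋ z → n ≤ t * ∑∈ I (λ i → ι (Q ∋? (α i ⊝ z)))) →
                    # Z * n ≤ t * (# I * # Q)
      count-pairs Z I Q α n t h = begin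
        # Z * n
          ≡⟨ sym (∑∈-const Z n) ⟩
        ∑∈ Z (λ _ → n)
          ≤⟨ ∑∈-mono Z h ⟩
        ∑∈ Z (λ z → t * ∑∈ I (λ i → ι (Q ∋? (α i ⊝ z))))
          ≡⟨ ∑∈-scale Z t _ ⟩
        t * ∑∈ Z (λ z → ∑∈ I (λ i → ι (Q ∋? (α i ⊝ z))))
          ≤⟨ *-monoʳ-≤ t (∑∈≤sum Z _) ⟩
        t * sum (λ z → ∑∈ I (λ i → ι (Q ∋? (α i ⊝ z))))
          ≡⟨ cong (t *_) (sym (∑∈-sum I λ i z → ι (Q ∋? (α i ⊝ z)))) ⟩
        t * ∑∈ I (λ i → sum λ z → ι (Q ∋? (α i ⊝ z)))
          ≡⟨ cong (t *_) (∑∈-cong I λ i → sum-reflect (λ x → ι (Q ∋? x)) (α i)) ⟩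
        t * ∑∈ I (λ _ → # Q)
          ≡⟨ cong (t *_) (∑∈-const I (# Q)) ⟩
        t * (# I * # Q) ∎

    opaque
      unfolding ∑∈ #_

      -- Fix a representation z = u - w. Each c ∈ C gives u - c and w - c with difference z, and
      -- distinct c give distinct pairs.
      ruzsa-triangle : ∀ (U W C : FSet q) → # (U ⊟ W) * # C ≤ # (U ⊟ C) * # (W ⊟ C)
      ruzsa-triangle U W C = ≤-trans
        (count-pairs (U ⊟ W) (U ⊟ C) (W ⊟ C) id (# C) 1 h)
        (≤-reflexive (+-identityʳ _))
        where
        h : ∀ {z} → (U ⊟ W) ∋ z → # C ≤ 1 * ∑∈ (U ⊟ C) (λ p → ι ((W ⊟ C) ∋? (p ⊝ z)))
        h {z} (u , w , u∈U , w∈W , refl) = begin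
          # C
            ≤⟨ sum-mono pointwise ⟩
          sum (λ c → f (u ⊝ c))
            ≡⟨ sum-reflect f u ⟩
          sum f
            ≡⟨ sym (+-identityʳ _) ⟩
          1 * sum f ∎
          where
          f : Fin q → ℕ
          f p = ι ((U ⊟ C) ∋? p) * ι ((W ⊟ C) ∋? (p ⊝ z))
          pointwise : ∀ c → ι (C ∋? c) ≤ f (u ⊝ c)
          pointwise c = ι-mono-× (C ∋? c) ((U ⊟ C) ∋? (u ⊝ c)) ((W ⊟ C) ∋? (u ⊝ c ⊝ z)) λ c∈C →
            (u , c , u∈U , c∈C , refl) , (w , c , w∈W , c∈C ,
              solve 3 (λ u c w → u :- c :- (u :- w) := w :- c) refl u c w)

      -- Each of the n/t representations d = b - (b - d) yields a point p = b - e of S with p - z ∈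
      -- T. These points are distinct, so every z is the difference of many pairs from S × T. Both d
      -- and e may depend on z.
      popular-shift : ∀ (B Z S T : FSet q) n t →
        (∀ {z} → Z ∋ z → ∃[ d ] ∃[ e ] (n ≤ rep B d * t ×
          (∀ {b} → B ∋ b → B ∋ (b ⊝ d) → S ∋ (b ⊝ e) × T ∋ (b ⊝ e ⊝ z)))) →
        # Z * n ≤ t * (# S * # T)
      popular-shift B Z S T n t h = count-pairs Z S T id n t λ {z} z∈Z →
        let (d , e , n≤ , imp) = h z∈Z
            f = λ p → ι (S ∋? p) * ι (T ∋? (p ⊝ z))
        in begin
        n                          ≤⟨ n≤ ⟩
        rep B d * t
          ≡⟨ *-comm (rep B d) t ⟩
        t * rep B d
          ≤⟨ *-monoʳ-≤ t (begin
          rep B d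
            ≤⟨ sum-mono (λ b → subst (_≤ f (b ⊝ e)) (ι-× (B ∋? b) (B ∋? (b ⊝ d)))
                 (ι-mono-× ((B ∋? b) ×-dec (B ∋? (b ⊝ d)))
                   (S ∋? (b ⊝ e)) (T ∋? (b ⊝ e ⊝ z))
                   λ { (x , y) → imp x y })) ⟩
          sum (λ b → f (b ⊝ e))
            ≡⟨ sum-translate⁻ f e ⟩
          sum f ∎) ⟩
        t * sum f ∎

    -- Here the index b is recorded instead of a point computed from it. This gives the factor # B
    -- and allows an α that is not injective, such as a dilation by a possibly zero ξ.
    popular-map : ∀ (B Z T : FSet q) (α : Fin q → Fin q) n t →
      (∀ {z} → Z ∋ z → ∃[ d ] (n ≤ rep B d * t ×
        (∀ {b} → B ∋ b → B ∋ (b ⊝ d) → T ∋ (α b ⊝ z)))) →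
      # Z * n ≤ t * (# B * # T)
    popular-map B Z T α n t h = count-pairs Z B T α n t λ {z} z∈Z →
      let (d , n≤ , imp) = h z∈Z in begin
      n                                     ≤⟨ n≤ ⟩
      rep B d * t
        ≡⟨ *-comm (rep B d) t ⟩
      t * rep B d
        ≤⟨ *-monoʳ-≤ t (∑∈-mono B λ {b} b∈B →
             ι-mono (B ∋? (b ⊝ d)) (T ∋? (α b ⊝ z)) (imp b∈B)) ⟩
      t * ∑∈ B (λ b → ι (T ∋? (α b ⊝ z))) ∎

    -- The translates B - φ i all lie in Z, and `w z` is the number of them that contain z. If Z is
    -- small, the translates must overlap; `collisions` and `pigeon` are the second and first moment
    -- forms of this.
    module Shifts (I B Z : FSet q) (φ : Fin q → Fin q)
                  (φ∈Z : ∀ {i b} → I ∋ i → B ∋ b → Z ∋ (b ⊝ φ i)) where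

      private
        w : Fin q → ℕ
        w z = ∑∈ I λ i → ι (B ∋? (z ⊕ φ i))

      opaque
        unfolding ∑∈ #_

        sum-w : sum w ≡ # I * # B
        sum-w = begin-equality
          sum w
            ≡⟨ sym (∑∈-sum I λ i z → ι (B ∋? (z ⊕ φ i))) ⟩
          ∑∈ I (λ i → sum λ z → ι (B ∋? (z ⊕ φ i)))
            ≡⟨ ∑∈-cong I (λ i → sum-translate (λ x → ι (B ∋? x)) (φ i)) ⟩
          ∑∈ I (λ _ → # B)
            ≡⟨ ∑∈-const I (# B) ⟩
          # I * # B ∎

        support : ∀ z → 0 < w z → Z ∋ z
        support z h with sum-<⇒∃ (λ _ → 0) _ (subst (_< w z) (sym (sum-zero {q} λ _ → refl)) h)
        ... | i , lt with I ∋? i | B ∋? (z ⊕ φ i)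
        ...   | yes i∈I | yes b∈B = subst (Z ∋_) (a⊕b⊝b≡a z (φ i)) (φ∈Z i∈I b∈B)

        #I#B≤ : # I * # B ≤ ∑∈ Z w
        #I#B≤ = subst (_≤ ∑∈ Z w) sum-w (∑∈-support Z w support)

        -- Cauchy-Schwarz for `w` on Z. The second moment of `w` counts the common points of pairs
        -- of translates, and B - φ i and B - φ j have r(φ i - φ j) points in common.
        collisions : (# I * # B) * (# I * # B) ≤ # Z * ∑∈ I (λ i → ∑∈ I λ j → rep B (φ i ⊝ φ j))
        collisions = begin
          (# I * # B) * (# I * # B)
            ≤⟨ *-mono-≤ #I#B≤ #I#B≤ ⟩
          ∑∈ Z w * ∑∈ Z w
            ≤⟨ cauchy-schwarz Z w ⟩
          # Z * ∑∈ Z (λ z → w z * w z)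
            ≤⟨ *-monoʳ-≤ (# Z) (∑∈≤sum Z _) ⟩
          # Z * sum (λ z → w z * w z)
            ≡⟨ cong (# Z *_) second-moment ⟩
          # Z * ∑∈ I (λ i → ∑∈ I λ j → rep B (φ i ⊝ φ j)) ∎
          where
          inner : ∀ i j → sum (λ z → ι (B ∋? (z ⊕ φ i)) * ι (B ∋? (z ⊕ φ j))) ≡ rep B (φ i ⊝ φ j)
          inner i j = trans
            (sum-cong-≗ λ z → cong (λ x → ι (B ∋? (z ⊕ φ i)) * ι (B ∋? x))
              (solve 3 (λ z a b → z :+ b := z :+ a :- (a :- b)) refl z (φ i) (φ j)))
            (sum-translate (λ b → ι (B ∋? b) * ι (B ∋? (b ⊝ (φ i ⊝ φ j)))) (φ i))
          second-moment : sum (λ z → w z * w z) ≡ ∑∈ I (λ i → ∑∈ I λ j → rep B (φ i ⊝ φ j))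
          second-moment = begin-equality
            sum (λ z → w z * w z)
              ≡⟨ sum-cong-≗ {q} (λ z → ∑∈-prod I I (λ i → ι (B ∋? (z ⊕ φ i))) (λ j → ι (B ∋? (z ⊕ φ j)))) ⟩
            sum (λ z → ∑∈ I λ i → ∑∈ I λ j → ι (B ∋? (z ⊕ φ i)) * ι (B ∋? (z ⊕ φ j)))
              ≡⟨ sym (∑∈-sum I _) ⟩
            ∑∈ I (λ i → sum λ z → ∑∈ I λ j → ι (B ∋? (z ⊕ φ i)) * ι (B ∋? (z ⊕ φ j)))
              ≡⟨ ∑∈-cong I (λ i → sym (∑∈-sum I _)) ⟩
            ∑∈ I (λ i → ∑∈ I λ j → sum λ z → ι (B ∋? (z ⊕ φ i)) * ι (B ∋? (z ⊕ φ j)))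
              ≡⟨ ∑∈-cong I (λ i → ∑∈-cong I (inner i)) ⟩
            ∑∈ I (λ i → ∑∈ I λ j → rep B (φ i ⊝ φ j)) ∎

      -- Some z ∈ Z lies in at least the average number of translates.
      pigeon : 0 < # I → 0 < # B →
               ∃[ z ] (# I * # B ≤ # Z * # (restrict I λ i → B ∋? (z ⊕ φ i)))
      pigeon I>0 B>0 with ∑∈-≤⇒∃ Z (λ _ → # I * # B) (λ z → # Z * w z) Z>0 (begin
          ∑∈ Z (λ _ → # I * # B)
            ≡⟨ ∑∈-const Z _ ⟩
          # Z * (# I * # B)
            ≤⟨ *-monoʳ-≤ (# Z) #I#B≤ ⟩
          # Z * ∑∈ Z w
            ≡⟨ sym (∑∈-scale Z (# Z) w) ⟩
          ∑∈ Z (λ z → # Z * w z) ∎)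
        where
        Z>0 : 0 < # Z
        Z>0 = let (i , i∈I) = #>0⇒∃ I I>0 ; (b , b∈B) = #>0⇒∃ B B>0 in ∋⇒#>0 Z (φ∈Z i∈I b∈B)
      ... | z , _ , le = z , subst (λ u → # I * # B ≤ # Z * u) (∑∈-restrict I (λ i → B ∋? (z ⊕ φ i))) le

  cancel-≤ : ∀ {c m n} → 0 < c → c * m ≤ c * n → m ≤ n
  cancel-≤ {c} c>0 = *-cancelˡ-≤ c {{>-nonZero c>0}}

  -- Absorbs the error term of the popularity principle; this is where the factors 2 carried through
  -- the estimates are spent.
  double-cancel : ∀ {a b} → 2 * a ≤ b + a → a ≤ b
  double-cancel {a} {b} h = +-cancelʳ-≤ a a b (≤-trans (≤-reflexive (lem a)) h)
    where
    lem : ∀ a → a + a ≡ 2 * a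
    lem = solve-∀

  -- The representation total satisfies S ≥ (I n)² / Z ≥ 4 I² n / k, and unpopular pairs account for
  -- at most I² n of k S. Of the remaining 3 I² only 2 I² is kept, still enough for one later
  -- `double-cancel`.
  popular-arithmetic : ∀ {I n Z S c} k → 0 < n → (I * n) * (I * n) ≤ Z * S → 4 * Z ≤ k * n →
                       k * S ≤ k * n * c + I * (I * n) → 2 * (I * I) ≤ k * c
  popular-arithmetic {I} {n} {Z} {S} {c} k n>0 h1 h2 h3 =
    ≤-trans (*-monoˡ-≤ (I * I) (s≤s (s≤s (z≤n {1})))) (cancel-≤ n>0 (begin
      n * (3 * (I * I))
        ≤⟨ +-cancelʳ-≤ (I * (I * n)) _ _ (begin
        n * (3 * (I * I)) + I * (I * n)
          ≡⟨ l1 n I ⟩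
        4 * (I * I) * n
          ≤⟨ cancel-≤ n>0 (begin
          n * (4 * (I * I) * n)
            ≡⟨ l2 n I ⟩
          4 * ((I * n) * (I * n))
            ≤⟨ *-monoʳ-≤ 4 h1 ⟩
          4 * (Z * S)
            ≡⟨ sym (*-assoc 4 Z S) ⟩
          4 * Z * S
            ≤⟨ *-monoˡ-≤ S h2 ⟩
          k * n * S
            ≡⟨ l3 k n S ⟩
          n * (k * S) ∎) ⟩
        k * S
          ≤⟨ h3 ⟩
        k * n * c + I * (I * n)
          ≡⟨ cong (_+ I * (I * n)) (l4 k n c) ⟩
        n * (k * c) + I * (I * n) ∎) ⟩
      n * (k * c) ∎))
    where
    l1 : ∀ n I → n * (3 * (I * I)) + I * (I * n) ≡ 4 * (I * I) * n
    l1 = solve-∀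
    l2 : ∀ n I → n * (4 * (I * I) * n) ≡ 4 * ((I * n) * (I * n))
    l2 = solve-∀
    l3 : ∀ k n S → k * n * S ≡ n * (k * S)
    l3 = solve-∀
    l4 : ∀ k n c → k * n * c ≡ n * (k * c)
    l4 = solve-∀

  -- Popular differences and good vectors

  module Popularity {q : ℕ} (C : CodeField q) (B : FSet q) (B>0 : 0 < # B) where
    open Combinatorics C

    n : ℕ
    n = # B

    Popular : ℕ → FSet q
    Popular t = mkF (λ d → n ≤ rep B d * t) (λ d → n ≤? rep B d * t)

    -- Crowding: # I translates of B inside a set of at most t n / 4 points collide so often that a
    -- proportion 2/t of the pairs i, j have a popular difference φ i - φ j.
    popular-differences : ∀ (I Z : FSet q) (φ : Fin q → Fin q) →
      (∀ {i b} → I ∋ i → B ∋ b → Z ∋ (b ⊝ φ i)) → ∀ t → 4 * # Z ≤ t * n →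
      2 * (# I * # I) ≤ t * ∑∈ I (λ i → ∑∈ I λ j → ι (Popular t ∋? (φ i ⊝ φ j)))
    popular-differences I Z φ h t Z≤ =
      popular-arithmetic {# I} {n} {# Z} t B>0 (Shifts.collisions I B Z φ h) Z≤
        (popular₂ I I (λ i j → rep B (φ i ⊝ φ j)) n t λ _ _ → rep≤# B _)

    -- With d = b₃ - b₄ one has b₃ - (b + d) = b₄ - b ∈ B - B.
    popular+ : ∀ t (Z : FSet q) → (∀ {z} → Z ∋ z → ∃[ b ] ∃[ d ] (B ∋ b × Popular t ∋ d × z ≡ b ⊕ d)) →
               # Z * n ≤ t * (n * # (B ⊟ B))
    popular+ t Z h = popular-map B Z (B ⊟ B) id n t λ z∈Z → case (h z∈Z)
      where
      case : ∀ {z} → ∃[ b ] ∃[ d ] (B ∋ b × Popular t ∋ d × z ≡ b ⊕ d) → _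
      case (b , d , b∈B , pop , refl) = d , pop , λ {b₃} _ b₄∈B →
        b₃ ⊝ d , b , b₄∈B , b∈B , solve 3 (λ x d b → x :- (b :+ d) := x :- d :- b) refl b₃ d b

    -- With d = b₃ - b₄ one has d - b = (b₃ - b) - b₄.
    popular- : ∀ t (Z : FSet q) → (∀ {z} → Z ∋ z → ∃[ b ] ∃[ d ] (B ∋ b × Popular t ∋ d × z ≡ d ⊝ b)) →
               # Z * n ≤ t * (# (B ⊟ B) * n)
    popular- t Z h = popular-shift B Z (B ⊟ B) B n t λ z∈Z → case (h z∈Z)
      where
      case : ∀ {z} → ∃[ b ] ∃[ d ] (B ∋ b × Popular t ∋ d × z ≡ d ⊝ b) → _
      case (b , d , b∈B , pop , refl) = d , b , pop , λ {b₃} b₃∈B b₄∈B →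
        (b₃ , b , b₃∈B , b∈B , refl) ,
        subst (B ∋_) (solve 3 (λ x d b → x :- d := x :- b :- (d :- b)) refl b₃ d b) b₄∈B

    -- A popular difference d = b₃ − b₄ turns d + ξb − ηc into (b₃ − ηc) − (b₄ − ξb).
    popular-dilates : ∀ t (Z S T : FSet q) (a c : Fin q → Fin q) →
      (∀ {z} → Z ∋ z → ∃[ d ] ∃[ u ] ∃[ v ] (Popular t ∋ d × z ≡ d ⊕ a u ⊝ c v ×
         (∀ {b} → B ∋ b → S ∋ (b ⊝ c v) × T ∋ (b ⊝ a u)))) →
      # Z * n ≤ t * (# S * # T)
    popular-dilates t Z S T a c h = popular-shift B Z S T n t λ z∈Z → case (h z∈Z)
      where
      case : ∀ {z} → ∃[ d ] ∃[ u ] ∃[ v ] (Popular t ∋ d × z ≡ d ⊕ a u ⊝ c v ×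
               (∀ {b} → B ∋ b → S ∋ (b ⊝ c v) × T ∋ (b ⊝ a u))) → _
      case (d , u , v , pop , refl , imp) = d , c v , pop , λ {b₃} b₃∈B b₄∈B → proj₁ (imp b₃∈B) ,
        subst (T ∋_) (solve 4 (λ x d a c → x :- d :- a := x :- c :- (d :+ a :- c)) refl b₃ d (a u) (c v))
          (proj₂ (imp b₄∈B))

    -- The factors 4 in the two smallness hypotheses are those consumed by `popular-differences`.
    module Good (Y : FSet q) (Y>0 : 0 < # Y) (μ : ℕ)
                (B-B-small : 4 * # (B ⊟ B) ≤ μ * n)
                (B-xB-small : ∀ {x} → Y ∋ x → 4 * # (B ⊟ x ⊙ B) ≤ μ * n) where

      y : ℕ
      y = # Y

      P : FSet q
      P = Popular μ

      degree : Fin q → ℕ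
      degree g = ∑∈ Y λ x → ι (P ∋? (x ⊗ g))

      degree≤y : ∀ g → degree g ≤ y
      degree≤y g = ≤-trans (∑∈-mono Y λ {x} _ → ι≤1 (P ∋? (x ⊗ g))) (≤-reflexive (sym (#-∑∈ Y)))

      IsGood : Fin q → Set
      IsGood g = y ≤ degree g * μ

      isGood? : ∀ g → Dec (IsGood g)
      isGood? g = y ≤? degree g * μ

      dilated-differences : ∀ (I : FSet q) (β : Fin q → Fin q) → (∀ {i} → I ∋ i → B ∋ β i) →
        ∀ {x} → Y ∋ x → 2 * (# I * # I) ≤ μ * ∑∈ I (λ i → ∑∈ I λ j → ι (P ∋? (x ⊗ (β i ⊝ β j))))
      dilated-differences I β β∈B {x} x∈Y = subst (λ s → 2 * (# I * # I) ≤ μ * s)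
        (∑∈-cong I λ i → ∑∈-cong I λ j → cong (λ d → ι (P ∋? d))
          (solve 3 (λ x a b → x :* a :- x :* b := x :* (a :- b)) refl x (β i) (β j)))
        (popular-differences I (B ⊟ x ⊙ B) (λ i → x ⊗ β i)
          (λ {i} {b} i∈I b∈B → b , x ⊗ β i , b∈B , (β i , β∈B i∈I , refl) , refl) μ (B-xB-small x∈Y))

      total-degree : ∀ (I : FSet q) (β : Fin q → Fin q) → (∀ {i} → I ∋ i → B ∋ β i) →
        2 * (# I * # I) * y ≤ μ * ∑∈ I (λ i → ∑∈ I λ j → degree (β i ⊝ β j))
      total-degree I β β∈B = begin
        2 * (# I * # I) * y
          ≡⟨ trans (*-comm _ y) (sym (∑∈-const Y _)) ⟩
        ∑∈ Y (λ _ → 2 * (# I * # I))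
          ≤⟨ ∑∈-mono Y (dilated-differences I β β∈B) ⟩
        ∑∈ Y (λ x → μ * ∑∈ I (λ i → ∑∈ I λ j → ι (P ∋? (x ⊗ (β i ⊝ β j)))))
          ≡⟨ ∑∈-scale Y μ _ ⟩
        μ * ∑∈ Y (λ x → ∑∈ I (λ i → ∑∈ I λ j → ι (P ∋? (x ⊗ (β i ⊝ β j)))))
          ≡⟨ cong (μ *_) (trans (∑∈-swap Y I _) (∑∈-cong I λ i → ∑∈-swap Y I _)) ⟩
        μ * ∑∈ I (λ i → ∑∈ I λ j → degree (β i ⊝ β j)) ∎

      DistinctGood : FSet q → (Fin q → Fin q) → Set
      DistinctGood I β = ∃[ i ] ∃[ j ] (I ∋ i × I ∋ j × i ≢ j × IsGood (β i ⊝ β j))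

      distinctGood? : ∀ I β → Dec (DistinctGood I β)
      distinctGood? I β = Fin.any? λ i → Fin.any? λ j →
        (I ∋? i) ×-dec (I ∋? j) ×-dec ¬? (i Fin.≟ j) ×-dec isGood? (β i ⊝ β j)

      -- Were no two of the vectors β i at a good difference, only the diagonal would
      -- contribute to total-degree.
      good-difference : ∀ (I : FSet q) (β : Fin q → Fin q) → (∀ {i} → I ∋ i → B ∋ β i) → μ < # I →
        DistinctGood I β
      good-difference I β β∈B μ<I = decidable-stable (distinctGood? I β) λ ¬p →
        <⇒≱ μ<I (cancel-≤ Y>0 (cancel-≤ I>0 (begin
          # I * (y * # I)
            ≤⟨ double-cancel (begin
            2 * (# I * (y * # I))
              ≡⟨ l1 (# I) y ⟩
            2 * (# I * # I) * y
              ≤⟨ total-degree I β β∈B ⟩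
            μ * ∑∈ I (λ i → ∑∈ I λ j → degree (β i ⊝ β j))
              ≤⟨ popular₂ I I _ y μ (λ _ _ → degree≤y _) ⟩
            μ * y * ∑∈ I (λ i → ∑∈ I λ j → ι (isGood? (β i ⊝ β j))) + # I * (# I * y)
              ≤⟨ +-monoˡ-≤ (# I * (# I * y)) (*-monoʳ-≤ (μ * y)
                 (≤-trans (∑∈-mono I λ i∈I → ∑∈-mono I λ j∈I →
                    ι-mono (isGood? _) (_ Fin.≟ _) (only-diagonal ¬p i∈I j∈I))
                   (∑∈-delta I))) ⟩
            μ * y * # I + # I * (# I * y)
              ≡⟨ l2 μ y (# I) ⟩
            # I * (y * μ) + # I * (y * # I) ∎) ⟩
          # I * (y * μ) ∎)))
        where
        I>0 : 0 < # I
        I>0 = ≤-trans (s≤s z≤n) μ<I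
        only-diagonal : ¬ DistinctGood I β → ∀ {i j} → I ∋ i → I ∋ j → IsGood (β i ⊝ β j) → i ≡ j
        only-diagonal ¬p {i} {j} i∈I j∈I good with i Fin.≟ j
        ... | yes i≡j = i≡j
        ... | no i≢j = ⊥-elim (¬p (i , j , i∈I , j∈I , i≢j , good))
        l1 : ∀ I y → 2 * (I * (y * I)) ≡ 2 * (I * I) * y
        l1 = solve-∀
        l2 : ∀ μ y I → μ * y * I + I * (I * y) ≡ I * (y * μ) + I * (y * I)
        l2 = solve-∀

      many-degrees : ∃[ b̄ ] (B ∋ b̄ × 2 * (n * y) ≤ μ * ∑∈ B λ b → degree (b ⊝ b̄))
      many-degrees = ∑∈-≤⇒∃ B (λ _ → 2 * (n * y)) (λ b̄ → μ * ∑∈ B λ b → degree (b ⊝ b̄)) B>0 (begin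
          ∑∈ B (λ _ → 2 * (n * y))
            ≡⟨ ∑∈-const B _ ⟩
          n * (2 * (n * y))
            ≡⟨ l1 n y ⟩
          2 * (n * n) * y
            ≤⟨ total-degree B id id ⟩
          μ * ∑∈ B (λ b → ∑∈ B λ b̄ → degree (b ⊝ b̄))
            ≡⟨ cong (μ *_) (∑∈-swap B B _) ⟩
          μ * ∑∈ B (λ b̄ → ∑∈ B λ b → degree (b ⊝ b̄))
            ≡⟨ sym (∑∈-scale B μ _) ⟩
          ∑∈ B (λ b̄ → μ * ∑∈ B λ b → degree (b ⊝ b̄)) ∎)
        where
        l1 : ∀ n y → n * (2 * (n * y)) ≡ 2 * (n * n) * y
        l1 = solve-∀
      -- Averaging `total-degree` over the second point fixes b̄, and the popularity principle for
      -- degrees uses up the factor 2. This base point becomes the element ā of the theorem.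
      good-base : ∃[ b̄ ] (B ∋ b̄ × n ≤ # (restrict B λ b → isGood? (b ⊝ b̄)) * μ)
      good-base = let (b̄ , b̄∈B , le) = many-degrees in b̄ , b̄∈B , cancel-≤ Y>0 (double-cancel (begin
          2 * (y * n)
            ≡⟨ cong (2 *_) (*-comm y n) ⟩
          2 * (n * y)
            ≤⟨ le ⟩
          μ * ∑∈ B (λ b → degree (b ⊝ b̄))
            ≤⟨ popular₁ B _ y μ (λ _ → degree≤y _) ⟩
          μ * y * # (restrict B λ b → isGood? (b ⊝ b̄)) + n * y
            ≡⟨ l2 μ y _ n ⟩
          y * (# (restrict B λ b → isGood? (b ⊝ b̄)) * μ) + y * n ∎))
        where
        l2 : ∀ μ y c n → μ * y * c + n * y ≡ y * (c * μ) + y * n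
        l2 = solve-∀

      many-popular : ∃[ b̄ ] (B ∋ b̄ × n ≤ μ * ∑∈ B λ b → ι (P ∋? (b ⊝ b̄)))
      many-popular = ∑∈-≤⇒∃ B (λ _ → n) (λ b̄ → μ * ∑∈ B λ b → ι (P ∋? (b ⊝ b̄))) B>0 (begin
          ∑∈ B (λ _ → n)
            ≡⟨ ∑∈-const B n ⟩
          n * n
            ≤⟨ m≤n*m (n * n) 2 ⟩
          2 * (n * n)
            ≤⟨ popular-differences B (B ⊟ B) id
                 (λ {i} {b} i∈B b∈B → b , i , b∈B , i∈B , refl) μ B-B-small ⟩
          μ * ∑∈ B (λ b → ∑∈ B λ b̄ → ι (P ∋? (b ⊝ b̄)))
            ≡⟨ cong (μ *_) (∑∈-swap B B _) ⟩
          μ * ∑∈ B (λ b̄ → ∑∈ B λ b → ι (P ∋? (b ⊝ b̄)))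
            ≡⟨ sym (∑∈-scale B μ _) ⟩
          ∑∈ B (λ b̄ → μ * ∑∈ B λ b → ι (P ∋? (b ⊝ b̄))) ∎)

      -- Lets a large part of B be replaced, after a translation, by popular differences, the form
      -- in which it can enter longer sums.
      popular-base : ∃[ b̄ ] (B ∋ b̄ × n ≤ # (restrict B λ b → P ∋? (b ⊝ b̄)) * μ)
      popular-base = let (b̄ , b̄∈B , le) = many-popular in b̄ , b̄∈B , ≤-trans le (≤-reflexive (trans (*-comm μ _)
          (cong (_* μ) (∑∈-restrict B (λ b → P ∋? (b ⊝ b̄))))))

  -- The gap property

  module PowerIdentities where
    open +-*-Solver

    cube : ∀ μ n → μ * ((μ * n) * (μ * n)) ≡ n * (μ ^ 3 * n)
    cube = solve 2 (λ μ n → μ :* ((μ :* n) :* (μ :* n)) := n :* (μ :^ 3 :* n)) refl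

    square-out : ∀ a μ → 2 * ((a * μ) * (a * μ)) ≡ μ ^ 2 * (2 * (a * a))
    square-out = solve 2 (λ a μ → con 2 :* ((a :* μ) :* (a :* μ)) := μ :^ 2 :* (con 2 :* (a :* a))) refl

    cube-out : ∀ μ T → μ * (T * μ) * μ ≡ μ ^ 3 * T
    cube-out = solve 2 (λ μ T → μ :* (T :* μ) :* μ := μ :^ 3 :* T) refl

  open PowerIdentities

  ^-split : ∀ m a b c → m ^ a * (m ^ b * c) ≡ m ^ (a + b) * c
  ^-split m a b c = trans (sym (*-assoc (m ^ a) (m ^ b) c)) (cong (_* c) (sym (^-distribˡ-+-* m a b)))

  module Dilations {q : ℕ} (C : CodeField q) where
    open Combinatorics C

    ⊟-swap : ∀ U W → # (U ⊟ W) ≤ # (W ⊟ U)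
    ⊟-swap U W = #-bij {S = U ⊟ W} {W ⊟ U} ⊖_ ⊖_ ⊖-involutive ⊖-involutive
      λ { (u , w , u∈U , w∈W , refl) → w , u , w∈W , u∈U , solve 2 (λ u w → :- (u :- w) := w :- u) refl u w }
      where
      ⊖-involutive : ∀ x → ⊖ ⊖ x ≡ x
      ⊖-involutive = solve 1 (λ x → :- :- x := x) refl

    ⊟-mono : ∀ {U U′ W W′} → U ⊑ U′ → W ⊑ W′ → # (U ⊟ W) ≤ # (U′ ⊟ W′)
    ⊟-mono {U} {U′} {W} {W′} h k = #-mono {S = U ⊟ W} {U′ ⊟ W′}
      λ { (u , w , u∈U , w∈W , eq) → u , w , h u∈U , k w∈W , eq }

    ⊙-⊟ : ∀ ξ U W → # ((ξ ⊙ U) ⊟ (ξ ⊙ W)) ≤ # (U ⊟ W)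
    ⊙-⊟ ξ U W = ≤-trans
      (#-mono {S = (ξ ⊙ U) ⊟ (ξ ⊙ W)} {ξ ⊙ (U ⊟ W)}
        λ { (_ , _ , (u , u∈U , refl) , (w , w∈W , refl) , refl) →
            u ⊝ w , (u , w , u∈U , w∈W , refl) ,
            solve 3 (λ ξ u w → ξ :* u :- ξ :* w := ξ :* (u :- w)) refl ξ u w })
      (#⊙≤ ξ (U ⊟ W))

    ⊗-nonzero : ∀ {a b} → a ≢ 𝟘 → b ≢ 𝟘 → a ⊗ b ≢ 𝟘
    ⊗-nonzero a≢0 b≢0 eq = b≢0 (⊗-cancelˡ a≢0
      (trans eq (sym (CommutativeRing.zeroʳ commutativeRing _))))

    ⊝-nonzero : ∀ {a b} → a ≢ b → a ⊝ b ≢ 𝟘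
    ⊝-nonzero a≢b eq = a≢b (a⊝b≡𝟘⇒a≡b eq)

  module GapIdentities where
    open +-*-Solver

    gap-identity : ∀ μ b n → μ ^ 4 * n * (μ ^ 3 * n) * (μ ^ 6 * b) ≡ b * (n * n * μ ^ 13)
    gap-identity = solve 3 (λ μ b n → μ :^ 4 :* n :* (μ :^ 3 :* n) :* (μ :^ 6 :* b) := b :* (n :* n :* μ :^ 13)) refl

    gap-identity₂ : ∀ μ n b → μ ^ 13 * n * (μ * n) * (b * μ) ≡ b * n * (n * μ ^ 15)
    gap-identity₂ = solve 3 (λ μ n b → μ :^ 13 :* n :* (μ :* n) :* (b :* μ) := b :* n :* (n :* μ :^ 15)) refl

  open GapIdentities

  4*-≤ : ∀ {m n} → 4 * m ≤ n → m ≤ n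
  4*-≤ {m} = ≤-trans (m≤n*m m 4)

  module SubfieldIdentities where
    open +-*-Solver

    subtraction-identity : ∀ μ n b → μ * n * (μ ^ 31 * n) * (b * μ) ≡ b * (n * (μ ^ 33 * n))
    subtraction-identity = solve 3 (λ μ n b → μ :* n :* (μ :^ 31 :* n) :* (b :* μ) := b :* (n :* (μ :^ 33 :* n))) refl

    product-identity : ∀ μ n → μ ^ 15 * n * (μ ^ 15 * n) ≡ n * (μ ^ 30 * n)
    product-identity = solve 2 (λ μ n → μ :^ 15 :* n :* (μ :^ 15 :* n) := n :* (μ :^ 30 :* n)) refl

    popular-identity : ∀ μ n → μ * (μ ^ 15 * n * (μ ^ 15 * n)) ≡ n * (μ ^ 31 * n)
    popular-identity = solve 2 (λ μ n → μ :* (μ :^ 15 :* n :* (μ :^ 15 :* n)) := n :* (μ :^ 31 :* n)) refl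

    line-identity : ∀ μ n ρ c → ρ * (μ ^ 4 * n) * (μ ^ 5 * c) ≡ c * (ρ * (μ ^ 9 * n))
    line-identity = solve 4 (λ μ n ρ c → ρ :* (μ :^ 4 :* n) :* (μ :^ 5 :* c) := c :* (ρ :* (μ :^ 9 :* n))) refl

    plane-identity : ∀ μ n → μ * (μ ^ 9 * n * (μ ^ 9 * n)) ≡ n * (μ ^ 19 * n)
    plane-identity = solve 2 (λ μ n → μ :* (μ :^ 9 :* n :* (μ :^ 9 :* n)) := n :* (μ :^ 19 :* n)) refl

  open SubfieldIdentities

  -- The exponent is 36 = 3 + 33: `structured-dilate` asks for |Y| > μ³T, and the largest T passed
  -- to it is μ³³, in `gap`.
  module InvariantSubspace {q : ℕ} (C : CodeField q) (B : FSet q) (B>0 : 0 < # B) (Y : FSet q) (μ : ℕ)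
                           (B-B-small : 4 * # (Combinatorics._⊟_ C B B) ≤ μ * # B)
                   (B-xB-small : ∀ {x} → Y ∋ x →
                      4 * # (Combinatorics._⊟_ C B (Combinatorics._⊙_ C x B)) ≤ μ * # B)
                   (Y-large : μ ^ 36 < # Y) (μ>1 : 1 < μ) where
    open Combinatorics C
    open Dilations C
    open Popularity C B B>0
    open Good Y (≤-trans (s≤s z≤n) Y-large) μ B-B-small B-xB-small

    Y>0 : 0 < # Y
    Y>0 = ≤-trans (s≤s z≤n) Y-large

    μ>0 : 0 < μ
    μ>0 = <⇒≤ μ>1

    μ^>0 : ∀ k → 0 < μ ^ k
    μ^>0 k = m^n>0 μ {{>-nonZero μ>0}} k

    P₃ : FSet q
    P₃ = Popular (μ ^ 3)

    -- What remains of goodness after division by some x₂ - x₁: pairs from Y replace single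
    -- elements, and the popularity level drops from μ to μ³.
    Structured : Fin q → Set
    Structured v = 2 * (y * y) ≤ μ ^ 5 * ∑∈ Y (λ i → ∑∈ Y λ j → ι (P₃ ∋? ((j ⊝ i) ⊗ v)))

    P+δB : Fin q → FSet q
    P+δB δ = image₂ (λ d b → d ⊕ δ ⊗ b) P B

    -- For d = b₃ - b₄ the element d + (x₂ - x₁)b is (b₃ - x₁b) - (b₄ - x₂b). Each of the two
    -- difference sets brings a factor 4; one is used up here, the other is kept for the next
    -- `popular-differences`.
    P+δB-small : ∀ {x₁ x₂} → Y ∋ x₁ → Y ∋ x₂ → 4 * # (P+δB (x₂ ⊝ x₁)) ≤ μ ^ 3 * n
    P+δB-small {x₁} {x₂} x₁∈Y x₂∈Y = cancel-≤ B>0 (begin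
      n * (4 * Z)
        ≡⟨ l1 n Z ⟩
      4 * (Z * n)
        ≤⟨ *-monoʳ-≤ 4 (popular-dilates μ (P+δB (x₂ ⊝ x₁)) (B ⊟ x₁ ⊙ B) (B ⊟ x₂ ⊙ B)
             (x₂ ⊗_) (x₁ ⊗_) λ { (d , b , d∈P , b∈B , refl) → d , b , b , d∈P ,
               solve 4 (λ d b x₁ x₂ → d :+ (x₂ :- x₁) :* b := d :+ x₂ :* b :- x₁ :* b) refl d b x₁ x₂ ,
               λ {b₃} b₃∈B → (b₃ , x₁ ⊗ b , b₃∈B , (b , b∈B , refl) , refl) ,
                             (b₃ , x₂ ⊗ b , b₃∈B , (b , b∈B , refl) , refl) }) ⟩
      4 * (μ * (S * T))
        ≤⟨ *-monoʳ-≤ 4 (*-monoʳ-≤ μ (*-monoˡ-≤ T (m≤n*m S 4))) ⟩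
      4 * (μ * ((4 * S) * T))
        ≡⟨ l2 μ S T ⟩
      μ * ((4 * S) * (4 * T))
        ≤⟨ *-monoʳ-≤ μ (*-mono-≤ (B-xB-small x₁∈Y) (B-xB-small x₂∈Y)) ⟩
      μ * ((μ * n) * (μ * n))
        ≡⟨ cube μ n ⟩
      n * (μ ^ 3 * n) ∎)
      where
      Z = # (P+δB (x₂ ⊝ x₁))
      S = # (B ⊟ x₁ ⊙ B)
      T = # (B ⊟ x₂ ⊙ B)
      l1 : ∀ n Z → n * (4 * Z) ≡ 4 * (Z * n)
      l1 = solve-∀
      l2 : ∀ μ S T → 4 * (μ * ((4 * S) * T)) ≡ μ * ((4 * S) * (4 * T))
      l2 = solve-∀

    degree≡ : ∀ g → degree g ≡ # (restrict Y λ x → P ∋? (x ⊗ g))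
    degree≡ g = ∑∈-restrict Y (λ x → P ∋? (x ⊗ g))

    -- Multiplication by δ = x₂ - x₁ carries Y*v + B into P + δB, so the translates of B by the
    -- vectors xv with x ∈ Y* are crowded. Popular pairs have proportion 2/μ³ among those of Y*, and
    -- |Y*| ≥ |Y|/μ turns this into 2/μ⁵ in Y.
    structured-divide : ∀ {x₁ x₂ v} → Y ∋ x₁ → Y ∋ x₂ → x₁ ≢ x₂ → IsGood ((x₂ ⊝ x₁) ⊗ v) → Structured v
    structured-divide {x₁} {x₂} {v} x₁∈Y x₂∈Y x₁≢x₂ good = begin
      2 * (y * y)
        ≤⟨ *-monoʳ-≤ 2 (*-mono-≤ y≤ y≤) ⟩
      2 * ((# Y* * μ) * (# Y* * μ))
        ≡⟨ square-out (# Y*) μ ⟩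
      μ ^ 2 * (2 * (# Y* * # Y*))
        ≤⟨ *-monoʳ-≤ (μ ^ 2) (popular-differences Y* Z φ φ∈Z (μ ^ 3) Z-small) ⟩
      μ ^ 2 * (μ ^ 3 * ∑∈ Y* (λ i → ∑∈ Y* λ j → ι (P₃ ∋? (φ i ⊝ φ j))))
        ≡⟨ ^-split μ 2 3 _ ⟩
      μ ^ 5 * ∑∈ Y* (λ i → ∑∈ Y* λ j → ι (P₃ ∋? (φ i ⊝ φ j)))
        ≡⟨ cong (μ ^ 5 *_) (∑∈-cong Y* λ i → ∑∈-cong Y* λ j → cong (λ d → ι (P₃ ∋? d))
             (solve 3 (λ i j v → :- (i :* v) :- :- (j :* v) := (j :- i) :* v) refl i j v)) ⟩
      μ ^ 5 * ∑∈ Y* (λ i → ∑∈ Y* λ j → ι (P₃ ∋? ((j ⊝ i) ⊗ v)))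
        ≤⟨ *-monoʳ-≤ (μ ^ 5) (≤-trans (∑∈-mono Y* λ _ → ∑∈-⊑ Y*⊑Y) (∑∈-⊑ Y*⊑Y)) ⟩
      μ ^ 5 * ∑∈ Y (λ i → ∑∈ Y λ j → ι (P₃ ∋? ((j ⊝ i) ⊗ v))) ∎
      where
      δ = x₂ ⊝ x₁
      Y* : FSet q
      Y* = restrict Y (λ x → P ∋? (x ⊗ (δ ⊗ v)))
      Y*⊑Y : Y* ⊑ Y
      Y*⊑Y = proj₁
      y≤ : y ≤ # Y* * μ
      y≤ = subst (λ s → y ≤ s * μ) (degree≡ (δ ⊗ v)) good
      φ : Fin q → Fin q
      φ x = ⊖ (x ⊗ v)
      Z : FSet q
      Z = image₂ (λ x b → x ⊗ v ⊕ b) Y* B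
      φ∈Z : ∀ {i b} → Y* ∋ i → B ∋ b → Z ∋ (b ⊝ φ i)
      φ∈Z {i} {b} i∈Y* b∈B = i , b , i∈Y* , b∈B ,
        solve 3 (λ i b v → b :- :- (i :* v) := i :* v :+ b) refl i b v
      Z-small : 4 * # Z ≤ μ ^ 3 * n
      Z-small = ≤-trans (*-monoʳ-≤ 4 (#-dilate {Z} {P+δB δ} (⊝-nonzero (x₁≢x₂ ∘ sym))
        λ { (x , b , x∈Y* , b∈B , refl) → x ⊗ (δ ⊗ v) , b , proj₂ x∈Y* , b∈B ,
            solve 4 (λ δ x v b → δ :* (x :* v :+ b) := x :* (δ :* v) :+ δ :* b) refl δ x v b }))
        (P+δB-small x₁∈Y x₂∈Y)

    -- The bound T affects how large Y has to be, but not the conclusion.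
    structured-dilate : ∀ ξ T g → # (B ⊟ ξ ⊙ B) ≤ T * n → μ ^ 3 * T < y → IsGood g → Structured (ξ ⊗ g)
    structured-dilate ξ T g ξ-small T< good =
      let (z , Yg≤) = Shifts.pigeon Yg B Z φ φ∈Z Yg>0 B>0
          I = restrict Yg (λ x → B ∋? (z ⊕ φ x))
          (x₁ , x₂ , x₁∈I , x₂∈I , x₁≢x₂ , good′) = good-difference I (λ x → z ⊕ φ x) proj₂ (I-large I Yg≤)
      in structured-divide (proj₁ (proj₁ x₁∈I)) (proj₁ (proj₁ x₂∈I)) x₁≢x₂
           (subst IsGood (solve 5 (λ z x₁ x₂ ξ g → z :+ :- (ξ :* (x₁ :* g)) :- (z :+ :- (ξ :* (x₂ :* g)))
                                     := (x₂ :- x₁) :* (ξ :* g)) refl z x₁ x₂ ξ g) good′)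
      where
      Yg : FSet q
      Yg = restrict Y (λ x → P ∋? (x ⊗ g))
      y≤ : y ≤ # Yg * μ
      y≤ = subst (λ s → y ≤ s * μ) (degree≡ g) good
      Yg>0 : 0 < # Yg
      Yg>0 = n≢0⇒n>0 λ eq → <⇒≱ Y>0 (subst (λ s → y ≤ s * μ) eq y≤)
      φ : Fin q → Fin q
      φ x = ⊖ (ξ ⊗ (x ⊗ g))
      Z : FSet q
      Z = image₂ (λ d b → ξ ⊗ d ⊕ b) P B
      φ∈Z : ∀ {x b} → Yg ∋ x → B ∋ b → Z ∋ (b ⊝ φ x)
      φ∈Z {x} {b} x∈Yg b∈B = x ⊗ g , b , proj₂ x∈Yg , b∈B ,
        solve 4 (λ ξ x g b → b :- :- (ξ :* (x :* g)) := ξ :* (x :* g) :+ b) refl ξ x g b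
      -- With d = b₃ - b₄ one has ξb₃ - (ξd + b) = ξb₄ - b, so ξP + B exceeds the bound for ξB - B
      -- by a factor μ only.
      Z-small : # Z ≤ μ * (T * n)
      Z-small = cancel-≤ B>0 (begin
        n * # Z
          ≡⟨ *-comm n _ ⟩
        # Z * n
          ≤⟨ popular-map B Z ((ξ ⊙ B) ⊟ B) (ξ ⊗_) n μ (λ { (d , b , d∈P , b∈B , refl) → d , d∈P ,
               λ {b₃} _ b₄∈B → ξ ⊗ (b₃ ⊝ d) , b , (b₃ ⊝ d , b₄∈B , refl) , b∈B ,
                 solve 4 (λ ξ x d b → ξ :* x :- (ξ :* d :+ b) := ξ :* (x :- d) :- b) refl ξ b₃ d b }) ⟩
        μ * (n * # ((ξ ⊙ B) ⊟ B))
          ≤⟨ *-monoʳ-≤ μ (*-monoʳ-≤ n (≤-trans (⊟-swap (ξ ⊙ B) B) ξ-small)) ⟩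
        μ * (n * (T * n))
          ≡⟨ l1 μ n T ⟩
        n * (μ * (T * n)) ∎)
        where
        l1 : ∀ μ n T → μ * (n * (T * n)) ≡ n * (μ * (T * n))
        l1 = solve-∀
      I-large : ∀ I → # Yg * n ≤ # Z * # I → μ < # I
      I-large I Yg≤ = ≰⇒> λ I≤μ → <⇒≱ T< (begin
        y                   ≤⟨ y≤ ⟩
        # Yg * μ
          ≤⟨ *-monoˡ-≤ μ (cancel-≤ B>0 (begin
          n * # Yg
            ≡⟨ *-comm n _ ⟩
          # Yg * n
            ≤⟨ Yg≤ ⟩
          # Z * # I
            ≤⟨ *-mono-≤ Z-small I≤μ ⟩
          μ * (T * n) * μ
            ≡⟨ l2 μ T n ⟩
          n * (μ * (T * μ)) ∎)) ⟩
        μ * (T * μ) * μ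
          ≡⟨ cube-out μ T ⟩
        μ ^ 3 * T ∎)
        where
        l2 : ∀ μ T n → μ * (T * n) * μ ≡ n * (μ * (T * μ))
        l2 = solve-∀

    μ^≤ : ∀ {a b} → a ≤ b → μ ^ a ≤ μ ^ b
    μ^≤ = ^-monoʳ-≤ μ {{>-nonZero μ>0}}

    μ^<y : ∀ {a} → a ≤ 36 → μ ^ a < y
    μ^<y a≤ = ≤-trans (s≤s (μ^≤ a≤)) Y-large

    Hits : FSet q → (Fin q → Fin q) → Fin q → Fin q → FSet q
    Hits S v i j = restrict S λ s → P₃ ∋? ((j ⊝ i) ⊗ v s)

    -- By averaging over pairs, of which few are diagonal since Y is large.
    common-pair : ∀ S (v : Fin q → Fin q) → 0 < # S → (∀ {s} → S ∋ s → Structured (v s)) →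
      ∃[ i ] ∃[ j ] (Y ∋ i × Y ∋ j × i ≢ j × # S ≤ μ ^ 5 * # (Hits S v i j))
    common-pair S v S>0 str = decidable-stable
      (Fin.any? λ i → Fin.any? λ j → (Y ∋? i) ×-dec (Y ∋? j) ×-dec ¬? (i Fin.≟ j) ×-dec
        (# S ≤? μ ^ 5 * # (Hits S v i j)))
      λ ¬p → <⇒≱ (upper ¬p) lower
      where
      lower : # S * (2 * (y * y)) ≤ ∑∈ Y (λ i → ∑∈ Y λ j → μ ^ 5 * # (Hits S v i j))
      lower = begin
        # S * (2 * (y * y))
          ≡⟨ sym (∑∈-const S _) ⟩
        ∑∈ S (λ _ → 2 * (y * y))
          ≤⟨ ∑∈-mono S str ⟩
        ∑∈ S (λ s → μ ^ 5 * ∑∈ Y (λ i → ∑∈ Y λ j → ι (P₃ ∋? ((j ⊝ i) ⊗ v s))))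
          ≡⟨ ∑∈-scale S (μ ^ 5) _ ⟩
        μ ^ 5 * ∑∈ S (λ s → ∑∈ Y (λ i → ∑∈ Y λ j → ι (P₃ ∋? ((j ⊝ i) ⊗ v s))))
          ≡⟨ cong (μ ^ 5 *_) (trans (∑∈-swap S Y _) (∑∈-cong Y λ i → trans (∑∈-swap S Y _)
               (∑∈-cong Y λ j → ∑∈-restrict S λ s → P₃ ∋? ((j ⊝ i) ⊗ v s)))) ⟩
        μ ^ 5 * ∑∈ Y (λ i → ∑∈ Y λ j → # (Hits S v i j))
          ≡⟨ sym (trans (∑∈-cong Y λ i → ∑∈-scale Y (μ ^ 5) _) (∑∈-scale Y (μ ^ 5) _)) ⟩
        ∑∈ Y (λ i → ∑∈ Y λ j → μ ^ 5 * # (Hits S v i j)) ∎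
      Pair : Set
      Pair = ∃[ i ] ∃[ j ] (Y ∋ i × Y ∋ j × i ≢ j × # S ≤ μ ^ 5 * # (Hits S v i j))
      bound : ¬ Pair → ∀ {i j} → Y ∋ i → Y ∋ j →
              μ ^ 5 * # (Hits S v i j) ≤ # S + μ ^ 5 * # S * ι (i Fin.≟ j)
      bound ¬p {i} {j} i∈Y j∈Y with i Fin.≟ j
      ... | yes _ = ≤-trans (≤-trans (*-monoʳ-≤ (μ ^ 5) (#-mono {S = Hits S v i j} {S} proj₁))
                      (≤-reflexive (sym (*-identityʳ _)))) (m≤n+m _ (# S))
      ... | no i≢j = ≤-trans (<⇒≤ (≰⇒> λ le → ¬p (i , j , i∈Y , j∈Y , i≢j , le))) (m≤m+n _ _)
      -- Off the diagonal each pair contributes at most # S, and y > μ⁵ keeps the diagonal below a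
      -- second y² # S. The factor 2 in `Structured` makes this contradictory.
      upper : ¬ Pair → ∑∈ Y (λ i → ∑∈ Y λ j → μ ^ 5 * # (Hits S v i j)) < # S * (2 * (y * y))
      upper ¬p = begin-strict
        ∑∈ Y (λ i → ∑∈ Y λ j → μ ^ 5 * # (Hits S v i j))
          ≤⟨ ∑∈-mono Y (λ i∈Y → ∑∈-mono Y (bound ¬p i∈Y)) ⟩
        ∑∈ Y (λ i → ∑∈ Y λ j → # S + μ ^ 5 * # S * ι (i Fin.≟ j))
          ≡⟨ ∑∈-cong Y (λ i → trans (∑∈-+ Y _ _) (cong₂ _+_ (∑∈-const Y (# S)) (∑∈-scale Y (μ ^ 5 * # S) _))) ⟩
        ∑∈ Y (λ i → y * # S + μ ^ 5 * # S * ∑∈ Y (λ j → ι (i Fin.≟ j)))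
          ≡⟨ trans (∑∈-+ Y _ _) (cong₂ _+_ (∑∈-const Y _) (∑∈-scale Y (μ ^ 5 * # S) _)) ⟩
        y * (y * # S) + μ ^ 5 * # S * ∑∈ Y (λ i → ∑∈ Y λ j → ι (i Fin.≟ j))
          ≤⟨ +-monoʳ-≤ (y * (y * # S)) (*-monoʳ-≤ (μ ^ 5 * # S) (∑∈-delta Y)) ⟩
        y * (y * # S) + μ ^ 5 * # S * y
          <⟨ +-monoʳ-< (y * (y * # S)) (*-monoˡ-< y {{>-nonZero Y>0}}
               (*-monoˡ-< (# S) {{>-nonZero S>0}} (μ^<y {5} (m≤m+n 5 31)))) ⟩
        y * (y * # S) + y * # S * y
          ≡⟨ l1 y (# S) ⟩
        # S * (2 * (y * y)) ∎
        where
        l1 : ∀ y s → y * (y * s) + y * s * y ≡ s * (2 * (y * y))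
        l1 = solve-∀

    -- U is, up to sign, a dilate by (j - i)ξ of a large part of B - b̄. It is close to B because it
    -- consists of popular differences of level μ³, up to sign, and close to ξB₂ because division by
    -- ξ leads into a translate of P + (j - i)B. The triangle inequality through U gives the
    -- exponent 4 + 3 + 6 = 13, and the return from B₂ to B costs two more factors μ.
    dilate-small : ∀ ξ → ξ ≢ 𝟘 → (∀ {g} → IsGood g → Structured (ξ ⊗ g)) → # (B ⊟ ξ ⊙ B) ≤ μ ^ 15 * n
    dilate-small ξ ξ≢0 str =
      let (b̄ , b̄∈B , n≤B₁) = good-base
          (b̄′ , b̄′∈B , n≤B₂) = popular-base
          B₁ = restrict B λ b → isGood? (b ⊝ b̄)
          B₁>0 = positive B₁ n≤B₁
          (i , j , i∈Y , j∈Y , i≢j , B₁≤) = common-pair B₁ (λ b → ξ ⊗ (b ⊝ b̄)) B₁>0 (λ p → str (proj₂ p))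
      in Ruzsa.conclusion b̄ b̄′ i j i∈Y j∈Y i≢j n≤B₁ n≤B₂ B₁≤
      where
      positive : ∀ S → n ≤ # S * μ → 0 < # S
      positive S le = n≢0⇒n>0 λ eq → <⇒≱ B>0 (subst (λ s → n ≤ s * μ) eq le)
      module Ruzsa (b̄ b̄′ i j : Fin q) (i∈Y : Y ∋ i) (j∈Y : Y ∋ j) (i≢j : i ≢ j)
        (n≤B₁ : n ≤ # (restrict B λ b → isGood? (b ⊝ b̄)) * μ)
        (n≤B₂ : n ≤ # (restrict B λ b → P ∋? (b ⊝ b̄′)) * μ)
        (B₁≤ : # (restrict B λ b → isGood? (b ⊝ b̄)) ≤
               μ ^ 5 * # (Hits (restrict B λ b → isGood? (b ⊝ b̄)) (λ b → ξ ⊗ (b ⊝ b̄)) i j)) where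
        δ = j ⊝ i
        c = δ ⊗ ξ
        c≢0 : c ≢ 𝟘
        c≢0 = ⊗-nonzero (⊝-nonzero (i≢j ∘ sym)) ξ≢0
        B₂ B₃ U : FSet q
        B₂ = restrict B λ b → P ∋? (b ⊝ b̄′)
        B₃ = Hits (restrict B λ b → isGood? (b ⊝ b̄)) (λ b → ξ ⊗ (b ⊝ b̄)) i j
        -- The sign turns B ⊟ U and ξ ⊙ B₂ ⊟ U into sums, as required by `popular+` and
        -- `P+δB-small`.
        U = mkF (λ z → ∃[ b ] (B₃ ∋ b × z ≡ ⊖ (c ⊗ (b ⊝ b̄))))
                (λ z → Fin.any? λ b → (B₃ ∋? b) ×-dec (z Fin.≟ ⊖ (c ⊗ (b ⊝ b̄))))
        B₃≤U : # B₃ ≤ # U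
        B₃≤U = #-bij {S = B₃} {U} (λ b → ⊖ (c ⊗ (b ⊝ b̄))) (λ z → invˢ c ⊗ (⊖ z) ⊕ b̄)
          (λ z → trans (solve 4 (λ c d z b → :- (c :* (d :* (:- z) :+ b :- b)) := c :* (d :* z)) refl c (invˢ c) z b̄)
                       (inv-cancelʳ c≢0 z))
          (λ b → trans (solve 4 (λ c d b b̄ → d :* (:- :- (c :* (b :- b̄))) :+ b̄ := d :* (c :* (b :- b̄)) :+ b̄) refl c (invˢ c) b b̄)
                       (trans (cong (_⊕ b̄) (inv-cancelˡ c≢0 (b ⊝ b̄))) (a⊝b⊕b≡a b b̄)))
          (λ {b} b∈B₃ → b , b∈B₃ , refl)
        B-U : # (B ⊟ U) ≤ μ ^ 4 * n
        B-U = 4*-≤ (cancel-≤ B>0 (begin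
          n * (4 * # (B ⊟ U))
            ≡⟨ l1 n (# (B ⊟ U)) ⟩
          4 * (# (B ⊟ U) * n)
            ≤⟨ *-monoʳ-≤ 4 (popular+ (μ ^ 3) (B ⊟ U)
                 λ { (b , _ , b∈B , (b₃ , b₃∈ , refl) , refl) →
                   b , δ ⊗ (ξ ⊗ (b₃ ⊝ b̄)) , b∈B , proj₂ b₃∈ ,
                   solve 4 (λ b δ ξ d → b :- :- (δ :* ξ :* d) := b :+ δ :* (ξ :* d)) refl b δ ξ (b₃ ⊝ b̄) }) ⟩
          4 * (μ ^ 3 * (n * # (B ⊟ B)))
            ≡⟨ l2 (μ ^ 3) n _ ⟩
          n * (μ ^ 3 * (4 * # (B ⊟ B)))
            ≤⟨ *-monoʳ-≤ n (*-monoʳ-≤ (μ ^ 3) B-B-small) ⟩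
          n * (μ ^ 3 * (μ * n))
            ≡⟨ cong (n *_) (trans (sym (*-assoc (μ ^ 3) μ n)) (cong (_* n) (*-comm (μ ^ 3) μ))) ⟩
          n * (μ ^ 4 * n) ∎))
          where
          l1 : ∀ n z → n * (4 * z) ≡ 4 * (z * n)
          l1 = solve-∀
          l2 : ∀ m n z → 4 * (m * (n * z)) ≡ n * (m * (4 * z))
          l2 = solve-∀
        ξB₂-U : # (ξ ⊙ B₂ ⊟ U) ≤ μ ^ 3 * n
        ξB₂-U = ≤-trans (#-bij {S = ξ ⊙ B₂ ⊟ U} {P+δB δ}
            (λ z → invˢ ξ ⊗ z ⊝ e) (λ w → ξ ⊗ (w ⊕ e))
            (λ w → trans (cong (_⊝ e) (inv-cancelˡ ξ≢0 (w ⊕ e))) (a⊕b⊝b≡a w e))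
            (λ z → trans (cong (ξ ⊗_) (a⊝b⊕b≡a (invˢ ξ ⊗ z) e)) (inv-cancelʳ ξ≢0 z))
            λ { (_ , _ , (b₂ , b₂∈ , refl) , (b₃ , b₃∈ , refl) , refl) →
                b₂ ⊝ b̄′ , b₃ , proj₂ b₂∈ , proj₁ (proj₁ b₃∈) ,
                trans (cong (λ w → invˢ ξ ⊗ w ⊝ e)
                  (solve 5 (λ ξ δ b₂ b₃ b̄ → ξ :* b₂ :- :- (δ :* ξ :* (b₃ :- b̄)) := ξ :* (b₂ :+ δ :* (b₃ :- b̄)))
                    refl ξ δ b₂ b₃ b̄))
                (trans (cong (_⊝ e) (inv-cancelˡ ξ≢0 _))
                  (solve 5 (λ δ b₂ b₃ b̄ b̄′ → b₂ :+ δ :* (b₃ :- b̄) :- (b̄′ :- δ :* b̄) := b₂ :- b̄′ :+ δ :* b₃)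
                    refl δ b₂ b₃ b̄ b̄′)) })
          (4*-≤ (P+δB-small i∈Y j∈Y))
          -- This translation removes both base points: b₂ + δ(b₃ - b̄) - e = (b₂ - b̄′) + δb₃.
          where e = b̄′ ⊝ δ ⊗ b̄
        n≤B₃ : n ≤ μ ^ 6 * # B₃
        n≤B₃ = begin
          n                                ≤⟨ n≤B₁ ⟩
          # (restrict B λ b → isGood? (b ⊝ b̄)) * μ ≤⟨ *-monoˡ-≤ μ B₁≤ ⟩
          μ ^ 5 * # B₃ * μ
            ≡⟨ trans (*-comm _ μ) (sym (*-assoc μ (μ ^ 5) _)) ⟩
          μ ^ 6 * # B₃ ∎
        B-ξB₂ : # (B ⊟ ξ ⊙ B₂) ≤ μ ^ 13 * n
        B-ξB₂ = cancel-≤ B>0 (cancel-≤ {# B₃} B₃>0 (begin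
          # B₃ * (n * X)
            ≤⟨ *-mono-≤ B₃≤U (*-monoˡ-≤ X n≤B₃) ⟩
          # U * (μ ^ 6 * # B₃ * X)
            ≡⟨ l1 (# U) (μ ^ 6) (# B₃) X ⟩
          (X * # U) * (μ ^ 6 * # B₃)
            ≤⟨ *-monoˡ-≤ (μ ^ 6 * # B₃) (ruzsa-triangle B (ξ ⊙ B₂) U) ⟩
          (# (B ⊟ U) * # (ξ ⊙ B₂ ⊟ U)) * (μ ^ 6 * # B₃) ≤⟨ *-monoˡ-≤ (μ ^ 6 * # B₃) (*-mono-≤ B-U ξB₂-U) ⟩
          μ ^ 4 * n * (μ ^ 3 * n) * (μ ^ 6 * # B₃)
            ≡⟨ gap-identity μ (# B₃) n ⟩
          # B₃ * (n * n * μ ^ 13)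
            ≡⟨ cong (# B₃ *_) (trans (*-assoc n n _) (cong (n *_) (*-comm n _))) ⟩
          # B₃ * (n * (μ ^ 13 * n)) ∎))
          where
          X = # (B ⊟ ξ ⊙ B₂)
          B₃>0 : 0 < # B₃
          B₃>0 = n≢0⇒n>0 λ eq → <⇒≱ B>0 (≤-trans n≤B₃ (≤-reflexive (trans (cong (μ ^ 6 *_) eq) (*-zeroʳ (μ ^ 6)))))
          l1 : ∀ u m b x → u * (m * b * x) ≡ (x * u) * (m * b)
          l1 = solve-∀
        conclusion : # (B ⊟ ξ ⊙ B) ≤ μ ^ 15 * n
        conclusion = cancel-≤ B>0 (cancel-≤ {# B₂} (positive B₂ n≤B₂) (begin
          # B₂ * (n * X)
            ≤⟨ *-mono-≤ B₂≤ξB₂ (*-monoˡ-≤ X n≤B₂) ⟩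
          # (ξ ⊙ B₂) * (# B₂ * μ * X)
            ≡⟨ l1 (# (ξ ⊙ B₂)) (# B₂) μ X ⟩
          X * # (ξ ⊙ B₂) * (# B₂ * μ)
            ≤⟨ *-monoˡ-≤ (# B₂ * μ) (ruzsa-triangle B (ξ ⊙ B) (ξ ⊙ B₂)) ⟩
          # (B ⊟ ξ ⊙ B₂) * # (ξ ⊙ B ⊟ ξ ⊙ B₂) * (# B₂ * μ)
            ≤⟨ *-monoˡ-≤ (# B₂ * μ) (*-mono-≤ B-ξB₂
                 (≤-trans (⊙-⊟ ξ B B₂) (≤-trans (⊟-mono {B} {B} {B₂} {B} id proj₁) (4*-≤ B-B-small)))) ⟩
          μ ^ 13 * n * (μ * n) * (# B₂ * μ)
            ≡⟨ gap-identity₂ μ n (# B₂) ⟩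
          # B₂ * n * (n * μ ^ 15)
            ≡⟨ trans (*-assoc (# B₂) n _) (cong (λ s → # B₂ * (n * s)) (*-comm n _)) ⟩
          # B₂ * (n * (μ ^ 15 * n)) ∎))
          where
          X = # (B ⊟ ξ ⊙ B)
          B₂≤ξB₂ : # B₂ ≤ # (ξ ⊙ B₂)
          B₂≤ξB₂ = #-dilate {B₂} {ξ ⊙ B₂} ξ≢0 λ {b} b∈ → b , b∈ , refl
          l1 : ∀ u b m x → u * (b * m * x) ≡ x * u * (b * m)
          l1 = solve-∀

    private module F = CommutativeRing commutativeRing

    -- The subfield and the subspace

    R : FSet q
    R = mkF (λ ξ → # (B ⊟ ξ ⊙ B) ≤ μ ^ 15 * n) (λ ξ → # (B ⊟ ξ ⊙ B) ≤? μ ^ 15 * n)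

    n≤μ^*n : ∀ k → n ≤ μ ^ k * n
    n≤μ^*n k = m≤n*m n (μ ^ k) {{>-nonZero (μ^>0 k)}}

    μ*n≤μ^*n : ∀ k → μ * n ≤ μ ^ suc k * n
    μ*n≤μ^*n k = *-monoˡ-≤ n (≤-trans (≤-reflexive (sym (*-identityʳ μ))) (*-monoʳ-≤ μ (μ^>0 k)))

    R∋0 : R ∋ 𝟘
    R∋0 = ≤-trans (#-mono {S = B ⊟ 𝟘 ⊙ B} {B} λ { (b , _ , b∈B , (c , _ , refl) , refl) →
        subst (B ∋_) (sym (trans (cong (b ⊝_) (trans (F.zeroˡ c) (sym (a⊝a≡𝟘 c))))
          (solve 2 (λ b c → b :- (c :- c) := b) refl b c))) b∈B })
      (n≤μ^*n 15)

    R∋1 : R ∋ 𝟙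
    R∋1 = ≤-trans (⊟-mono {B} {B} {𝟙 ⊙ B} {B} id λ { (b , b∈B , refl) → subst (B ∋_) (sym (F.*-identityˡ b)) b∈B })
      (≤-trans (4*-≤ B-B-small) (μ*n≤μ^*n 14))

    Y⊑R : Y ⊑ R
    Y⊑R x∈Y = ≤-trans (4*-≤ (B-xB-small x∈Y)) (μ*n≤μ^*n 14)

    ρ : ℕ
    ρ = # R

    y≤ρ : y ≤ ρ
    y≤ρ = #-mono {S = Y} {R} Y⊑R

    ρ>0 : 0 < ρ
    ρ>0 = ≤-trans Y>0 y≤ρ

    nonzero-case : ∀ {P : Fin q → Set} ξ → P 𝟘 → (ξ ≢ 𝟘 → P ξ) → P ξ
    nonzero-case {P} ξ p h = case (ξ Fin.≟ 𝟘)
      where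
      case : Dec (ξ ≡ 𝟘) → P ξ
      case (yes ξ≡0) = subst P (sym ξ≡0) p
      case (no ξ≢0)  = h ξ≢0

    -- The exponent 33 leaves room for the operations of R: a difference reaches 15 + 15 + 1 for P -
    -- ζB and two more in passing from P to B, a product reaches 30. The element 𝟘 is treated apart
    -- because `dilate-small` divides by ξ.
    gap : ∀ {ξ} → # (B ⊟ ξ ⊙ B) ≤ μ ^ 33 * n → R ∋ ξ
    gap {ξ} small = nonzero-case {λ ξ → R ∋ ξ} ξ R∋0 λ ξ≢0 →
      dilate-small ξ ξ≢0 λ {g} good → structured-dilate ξ (μ ^ 33) g small
        (≤-trans (s≤s (≤-reflexive (sym (^-distribˡ-+-* μ 3 33)))) Y-large) good

    R-structured : ∀ {ξ g} → R ∋ ξ → IsGood g → Structured (ξ ⊗ g)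
    R-structured {ξ} {g} ξ∈R good = structured-dilate ξ (μ ^ 15) g ξ∈R
      (≤-trans (s≤s (≤-reflexive (sym (^-distribˡ-+-* μ 3 15)))) (μ^<y {18} (m≤m+n 18 18))) good

    n≤*⇒>0 : ∀ (S : FSet q) → n ≤ # S * μ → 0 < # S
    n≤*⇒>0 S le = n≢0⇒n>0 λ eq → <⇒≱ B>0 (subst (λ s → n ≤ s * μ) eq le)

    b̄′ : Fin q
    b̄′ = proj₁ popular-base

    B₂ : FSet q
    B₂ = restrict B λ b → P ∋? (b ⊝ b̄′)

    n≤B₂ : n ≤ # B₂ * μ
    n≤B₂ = proj₂ (proj₂ popular-base)

    B₂>0 : 0 < # B₂
    B₂>0 = n≤*⇒>0 B₂ n≤B₂

    #-translate : ∀ {S T : FSet q} c → (∀ {x} → S ∋ x → T ∋ (x ⊝ c)) → # S ≤ # T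
    #-translate {S} {T} c = #-bij {S = S} {T} (_⊝ c) (_⊕ c) (λ x → a⊕b⊝b≡a x c) (λ x → a⊝b⊕b≡a x c)

    -- For ζ = ξ - η and d = b₃ - b₄ the element d - ζb is (b₃ - ξb) - (b₄ - ηb), so P - ζB is
    -- small. A translate of B₂ lies in P, and the triangle inequality through B₂ leads back to B.
    R-⊝ : ∀ {ξ η} → R ∋ ξ → R ∋ η → R ∋ (ξ ⊝ η)
    R-⊝ {ξ} {η} ξ∈R η∈R = gap (cancel-≤ B>0 (cancel-≤ B₂>0 (begin
      # B₂ * (n * X)
        ≤⟨ *-monoʳ-≤ (# B₂) (*-monoˡ-≤ X n≤B₂) ⟩
      # B₂ * (# B₂ * μ * X)
        ≡⟨ l1 (# B₂) μ X ⟩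
      X * # B₂ * (# B₂ * μ)
        ≤⟨ *-monoˡ-≤ (# B₂ * μ) (ruzsa-triangle B (ζ ⊙ B) B₂) ⟩
      # (B ⊟ B₂) * # (ζ ⊙ B ⊟ B₂) * (# B₂ * μ)
        ≤⟨ *-monoˡ-≤ (# B₂ * μ) (*-mono-≤
             (≤-trans (⊟-mono {B} {B} {B₂} {B} id proj₁) (4*-≤ B-B-small))
             (≤-trans (⊟-swap (ζ ⊙ B) B₂) (≤-trans B₂-Z Z-small))) ⟩
      μ * n * (μ ^ 31 * n) * (# B₂ * μ)
        ≡⟨ subtraction-identity μ n (# B₂) ⟩
      # B₂ * (n * (μ ^ 33 * n)) ∎)))
      where
      ζ = ξ ⊝ η
      X = # (B ⊟ ζ ⊙ B)
      Z : FSet q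
      Z = image₂ (λ d b → d ⊝ ζ ⊗ b) P B
      B₂-Z : # (B₂ ⊟ ζ ⊙ B) ≤ # Z
      B₂-Z = #-translate {B₂ ⊟ ζ ⊙ B} {Z} b̄′ λ { (b₂ , _ , b₂∈ , (b , b∈B , refl) , refl) →
        b₂ ⊝ b̄′ , b , proj₂ b₂∈ , b∈B , solve 3 (λ b₂ c z → b₂ :- z :- c := b₂ :- c :- z) refl b₂ b̄′ (ζ ⊗ b) }
      Z-small : # Z ≤ μ ^ 31 * n
      Z-small = cancel-≤ B>0 (begin
        n * # Z
          ≡⟨ *-comm n _ ⟩
        # Z * n
          ≤⟨ popular-dilates μ Z (B ⊟ ξ ⊙ B) (B ⊟ η ⊙ B) (η ⊗_) (ξ ⊗_)
               (λ { (d , b , d∈P , b∈B , refl) → d , b , b , d∈P ,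
                 solve 4 (λ d ξ η b → d :- (ξ :- η) :* b := d :+ η :* b :- ξ :* b) refl d ξ η b ,
                 λ {b₃} b₃∈B → (b₃ , ξ ⊗ b , b₃∈B , (b , b∈B , refl) , refl) ,
                               (b₃ , η ⊗ b , b₃∈B , (b , b∈B , refl) , refl) }) ⟩
        μ * (# (B ⊟ ξ ⊙ B) * # (B ⊟ η ⊙ B))
          ≤⟨ *-monoʳ-≤ μ (*-mono-≤ ξ∈R η∈R) ⟩
        μ * (μ ^ 15 * n * (μ ^ 15 * n))
          ≡⟨ popular-identity μ n ⟩
        n * (μ ^ 31 * n) ∎)
      l1 : ∀ b m x → b * (b * m * x) ≡ x * b * (b * m)
      l1 = solve-∀

    R-⊖ : ∀ {ξ} → R ∋ ξ → R ∋ (⊖ ξ)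
    R-⊖ {ξ} ξ∈R = subst (R ∋_) (F.+-identityˡ (⊖ ξ)) (R-⊝ R∋0 ξ∈R)

    R-⊕ : ∀ {ξ η} → R ∋ ξ → R ∋ η → R ∋ (ξ ⊕ η)
    R-⊕ {ξ} {η} ξ∈R η∈R = subst (R ∋_) (solve 2 (λ ξ η → ξ :- :- η := ξ :+ η) refl ξ η) (R-⊝ ξ∈R (R-⊖ η∈R))

    -- Triangle inequality through ξB, where ξηB - ξB is a dilate of ηB - B. It uses |ξB| = |B|,
    -- hence the separate case of 𝟘.
    R-⊗ : ∀ {ξ η} → R ∋ ξ → R ∋ η → R ∋ (ξ ⊗ η)
    R-⊗ {ξ} {η} ξ∈R η∈R = nonzero-case {λ ξ → R ∋ (ξ ⊗ η)} ξ (subst (R ∋_) (sym (F.zeroˡ η)) R∋0) λ ξ≢0 → gap (≤-trans (cancel-≤ B>0 (begin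
      n * X
        ≤⟨ *-monoˡ-≤ X (#-dilate {B} {ξ ⊙ B} ξ≢0 λ {b} b∈B → b , b∈B , refl) ⟩
      # (ξ ⊙ B) * X
        ≡⟨ *-comm (# (ξ ⊙ B)) X ⟩
      X * # (ξ ⊙ B)
        ≤⟨ ruzsa-triangle B ((ξ ⊗ η) ⊙ B) (ξ ⊙ B) ⟩
      # (B ⊟ ξ ⊙ B) * # ((ξ ⊗ η) ⊙ B ⊟ ξ ⊙ B)
        ≤⟨ *-mono-≤ ξ∈R (≤-trans
             (⊟-mono {(ξ ⊗ η) ⊙ B} {ξ ⊙ (η ⊙ B)} {ξ ⊙ B} {ξ ⊙ B}
               (λ { (b , b∈B , refl) → η ⊗ b , (b , b∈B , refl) , F.*-assoc ξ η b }) id)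
             (≤-trans (⊙-⊟ ξ (η ⊙ B) B) (≤-trans (⊟-swap (η ⊙ B) B) η∈R))) ⟩
      μ ^ 15 * n * (μ ^ 15 * n)
        ≡⟨ product-identity μ n ⟩
      n * (μ ^ 30 * n) ∎)) (*-monoˡ-≤ n (μ^≤ {30} {33} (m≤m+n 30 3))))
      where
      X = # (B ⊟ (ξ ⊗ η) ⊙ B)

    R-inv : ∀ {ξ} → ξ ≢ 𝟘 → R ∋ ξ → R ∋ invˢ ξ
    R-inv {ξ} ξ≢0 ξ∈R = ≤-trans
      (#-dilate {B ⊟ invˢ ξ ⊙ B} {ξ ⊙ B ⊟ B} ξ≢0 λ { (b , _ , b∈B , (c , c∈B , refl) , refl) →
        ξ ⊗ b , c , (b , b∈B , refl) , c∈B ,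
        trans (solve 4 (λ ξ i b c → ξ :* (b :- i :* c) := ξ :* b :- ξ :* (i :* c)) refl ξ (invˢ ξ) b c)
              (cong (λ z → ξ ⊗ b ⊝ z) (inv-cancelʳ ξ≢0 c)) })
      (≤-trans (⊟-swap (ξ ⊙ B) B) ξ∈R)

    B+R : Fin q → FSet q
    B+R v = image₂ (λ b η → b ⊕ η ⊗ v) B R

    -- The whole line Rv enters the condition, which makes V closed under scaling by R at once. The
    -- exponent 9 is the one that `good⇒V` delivers.
    V : FSet q
    V = mkF (λ v → # (B+R v) ≤ μ ^ 9 * n) (λ v → # (B+R v) ≤? μ ^ 9 * n)

    V∋0 : V ∋ 𝟘
    V∋0 = ≤-trans (#-mono {S = B+R 𝟘} {B} λ { (b , η , b∈B , _ , refl) →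
        subst (B ∋_) (sym (trans (cong (b ⊕_) (F.zeroʳ η)) (F.+-identityʳ b))) b∈B })
      (n≤μ^*n 9)

    V-scale : ∀ {c v} → R ∋ c → V ∋ v → V ∋ (c ⊗ v)
    V-scale {c} {v} c∈R v∈V = ≤-trans (#-mono {S = B+R (c ⊗ v)} {B+R v} λ { (b , η , b∈B , η∈R , refl) →
        b , η ⊗ c , b∈B , R-⊗ η∈R c∈R , cong (b ⊕_) (sym (F.*-assoc η c v)) }) v∈V

    -- All ξg with ξ ∈ R are structured, so a single pair i ≠ j makes (j - i)ξg popular for a
    -- proportion μ⁻⁵ of them. As j - i is a nonzero element of R, dilating gives a set Q ⊆ R of
    -- that proportion with Qg popular. Since (c + η)g - (b + ηg) = cg - b, each element of B + Rg
    -- is hit |Q| times from R and Qg - B; the exponents add up to 5 + 4.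
    good⇒V : ∀ {g} → IsGood g → V ∋ g
    good⇒V {g} good =
      let (i , j , i∈Y , j∈Y , i≢j , ρ≤) = common-pair R (_⊗ g) ρ>0 (λ ξ∈R → R-structured ξ∈R good)
      in bound (≤-trans ρ≤ (*-monoʳ-≤ (μ ^ 5) (#-dilate {Hits R (_⊗ g) i j} {Q} (⊝-nonzero (i≢j ∘ sym))
           λ {ξ} p → R-⊗ (R-⊝ (Y⊑R j∈Y) (Y⊑R i∈Y)) (proj₁ p) ,
                     subst (P₃ ∋_) (sym (F.*-assoc (j ⊝ i) ξ g)) (proj₂ p))))
      where
      Q Z : FSet q
      Q = restrict R λ ξ → P₃ ∋? (ξ ⊗ g)
      Z = image₂ (λ ξ b → ξ ⊗ g ⊝ b) Q B
      Z-small : # Z ≤ μ ^ 4 * n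
      Z-small = 4*-≤ (cancel-≤ B>0 (begin
        n * (4 * # Z)
          ≡⟨ l1 n (# Z) ⟩
        4 * (# Z * n)
          ≤⟨ *-monoʳ-≤ 4 (popular- (μ ^ 3) Z λ { (ξ , b , ξ∈Q , b∈B , refl) →
               b , ξ ⊗ g , b∈B , proj₂ ξ∈Q , refl }) ⟩
        4 * (μ ^ 3 * (# (B ⊟ B) * n))
          ≡⟨ l2 (μ ^ 3) n (# (B ⊟ B)) ⟩
        n * (μ ^ 3 * (4 * # (B ⊟ B)))
          ≤⟨ *-monoʳ-≤ n (*-monoʳ-≤ (μ ^ 3) B-B-small) ⟩
        n * (μ ^ 3 * (μ * n))
          ≡⟨ cong (n *_) (trans (sym (*-assoc (μ ^ 3) μ n)) (cong (_* n) (*-comm (μ ^ 3) μ))) ⟩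
        n * (μ ^ 4 * n) ∎))
        where
        l1 : ∀ n z → n * (4 * z) ≡ 4 * (z * n)
        l1 = solve-∀
        l2 : ∀ m n z → 4 * (m * (z * n)) ≡ n * (m * (4 * z))
        l2 = solve-∀
      cosets : # (B+R g) * # Q ≤ 1 * (ρ * # Z)
      cosets = count-pairs (B+R g) R Z (_⊗ g) (# Q) 1
        λ { {z} (b , η , b∈B , η∈R , refl) → ≤-trans
            (#-translated Q R η (λ η′ → Z ∋? (η′ ⊗ g ⊝ z)) λ {c} c∈Q → R-⊕ (proj₁ c∈Q) η∈R ,
              (c , b , c∈Q , b∈B , solve 4 (λ c η g b → (c :+ η) :* g :- (b :+ η :* g) := c :* g :- b) refl c η g b))
            (≤-reflexive (sym (+-identityʳ _))) }
        where
        #-translated : ∀ (S T : FSet q) η {Q : Fin q → Set} (Q? : ∀ x → Dec (Q x)) →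
                       (∀ {c} → S ∋ c → T ∋ (c ⊕ η) × Q (c ⊕ η)) → # S ≤ ∑∈ T (λ x → ι (Q? x))
        #-translated S T η Q? h = ≤-trans
          (#-bij {S = S} {restrict T Q?} (_⊕ η) (_⊝ η) (λ x → a⊝b⊕b≡a x η) (λ x → a⊕b⊝b≡a x η) h)
          (≤-reflexive (sym (∑∈-restrict T Q?)))
      bound : ρ ≤ μ ^ 5 * # Q → V ∋ g
      bound ρ≤ = cancel-≤ ρ>0 (cancel-≤ {# Q} Q>0 (begin
        # Q * (ρ * # (B+R g))
          ≡⟨ l1 (# Q) ρ (# (B+R g)) ⟩
        # (B+R g) * # Q * ρ
          ≤⟨ *-mono-≤ (≤-trans cosets (≤-reflexive (+-identityʳ _))) ρ≤ ⟩
        ρ * # Z * (μ ^ 5 * # Q)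
          ≤⟨ *-monoˡ-≤ (μ ^ 5 * # Q) (*-monoʳ-≤ ρ Z-small) ⟩
        ρ * (μ ^ 4 * n) * (μ ^ 5 * # Q)
          ≡⟨ line-identity μ n ρ (# Q) ⟩
        # Q * (ρ * (μ ^ 9 * n)) ∎))
        where
        Q>0 : 0 < # Q
        Q>0 = n≢0⇒n>0 λ eq → <⇒≱ ρ>0 (≤-trans ρ≤ (≤-reflexive (trans (cong (μ ^ 5 *_) eq) (*-zeroʳ (μ ^ 5)))))
        l1 : ∀ a b c → a * (b * c) ≡ c * a * b
        l1 = solve-∀

    -- A direct estimate of P + R(v + w) gives only μ¹⁹, too weak for membership. But |R| > μ²¹, so
    -- the translates of B₂ by the vectors ηu with u = v + w are crowded enough for some (η₂ - η₁)u
    -- to be good, hence in V; then divide by η₂ - η₁ ∈ R.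
    V-⊕ : ∀ {v w} → V ∋ v → V ∋ w → V ∋ (v ⊕ w)
    V-⊕ {v} {w} v∈V w∈V =
      let (z , ρB₂≤) = Shifts.pigeon R B₂ Z φ φ∈Z ρ>0 B₂>0 in finish z (I-large (I z) ρB₂≤)
      where
      u = v ⊕ w
      φ : Fin q → Fin q
      φ η = ⊖ (η ⊗ u)
      Z Z′ : FSet q
      Z = image₂ (λ b η → b ⊕ η ⊗ u) B₂ R
      Z′ = image₂ (λ d η → d ⊕ η ⊗ u) P R
      φ∈Z : ∀ {η b} → R ∋ η → B₂ ∋ b → Z ∋ (b ⊝ φ η)
      φ∈Z {η} {b} η∈R b∈B₂ = b , η , b∈B₂ , η∈R , solve 2 (λ b x → b :- :- x := b :+ x) refl b (η ⊗ u)
      Z-small : # Z ≤ μ ^ 19 * n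
      Z-small = ≤-trans (#-translate {Z} {Z′} b̄′ λ { (b , η , b∈B₂ , η∈R , refl) →
          b ⊝ b̄′ , η , proj₂ b∈B₂ , η∈R , solve 3 (λ b x c → b :+ x :- c := b :- c :+ x) refl b (η ⊗ u) b̄′ })
        (cancel-≤ B>0 (begin
          n * # Z′
            ≡⟨ *-comm n _ ⟩
          # Z′ * n
            ≤⟨ popular-dilates μ Z′ (B+R v) (B+R w) (_⊗ w) (λ η → (⊖ η) ⊗ v)
                 (λ { (d , η , d∈P , η∈R , refl) → d , η , η , d∈P ,
                   solve 4 (λ d η v w → d :+ η :* (v :+ w) := d :+ η :* w :- (:- η) :* v) refl d η v w ,
                   λ {b} b∈B → (b , η , b∈B , η∈R ,
                       solve 3 (λ b η v → b :- (:- η) :* v := b :+ η :* v) refl b η v) ,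
                     (b , ⊖ η , b∈B , R-⊖ η∈R ,
                       solve 3 (λ b η w → b :- η :* w := b :+ (:- η) :* w) refl b η w) }) ⟩
          μ * (# (B+R v) * # (B+R w))
            ≤⟨ *-monoʳ-≤ μ (*-mono-≤ v∈V w∈V) ⟩
          μ * (μ ^ 9 * n * (μ ^ 9 * n))
            ≡⟨ plane-identity μ n ⟩
          n * (μ ^ 19 * n) ∎))
      I-large : ∀ (I : FSet q) → ρ * # B₂ ≤ # Z * # I → μ < # I
      I-large I ρB₂≤ = ≰⇒> λ I≤μ → <⇒≱ (μ^<y {21} (m≤m+n 21 15)) (≤-trans y≤ρ
        (cancel-≤ B>0 (cancel-≤ B₂>0 (begin
          # B₂ * (n * ρ)
            ≤⟨ *-monoʳ-≤ (# B₂) (*-monoˡ-≤ ρ n≤B₂) ⟩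
          # B₂ * (# B₂ * μ * ρ)
            ≡⟨ l1 (# B₂) μ ρ ⟩
          ρ * # B₂ * (# B₂ * μ)
            ≤⟨ *-monoˡ-≤ (# B₂ * μ) (≤-trans ρB₂≤ (*-mono-≤ Z-small I≤μ)) ⟩
          μ ^ 19 * n * μ * (# B₂ * μ)
            ≡⟨ l2 (μ ^ 19) n μ (# B₂) ⟩
          # B₂ * (n * (μ ^ 21)) ∎))))
        where
        l1 : ∀ b m r → b * (b * m * r) ≡ r * b * (b * m)
        l1 = solve-∀
        l2 : ∀ a n m b → a * n * m * (b * m) ≡ b * (n * (m * (m * a)))
        l2 = solve-∀
      I : Fin q → FSet q
      I z = restrict R (λ η → B₂ ∋? (z ⊕ φ η))
      finish : ∀ z → μ < # (I z) → V ∋ u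
      finish z μ<I = conclude (good-difference (I z) (λ η → z ⊕ φ η) (λ p → proj₁ (proj₂ p)) μ<I)
        where
        conclude : DistinctGood (I z) (λ η → z ⊕ φ η) → V ∋ u
        conclude (η₁ , η₂ , η₁∈I , η₂∈I , η₁≢η₂ , good) =
          subst (V ∋_) (inv-cancelˡ δ≢0 u) (V-scale (R-inv δ≢0 (R-⊝ (proj₁ η₂∈I) (proj₁ η₁∈I))) δu∈V)
          where
          δ≢0 : η₂ ⊝ η₁ ≢ 𝟘
          δ≢0 = ⊝-nonzero (η₁≢η₂ ∘ sym)
          δu∈V : V ∋ ((η₂ ⊝ η₁) ⊗ u)
          δu∈V = good⇒V (subst IsGood (solve 4 (λ z η₁ η₂ u → z :+ :- (η₁ :* u) :- (z :+ :- (η₂ :* u))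
                                               := (η₂ :- η₁) :* u) refl z η₁ η₂ u) good)

    -- For i ≠ j in R the vectors (j - i)v are distinct as v runs through V, so their representation
    -- counts total at most n². The diagonal pairs contribute a multiple of |V| that is absorbed
    -- because |R| ≥ μ¹⁰ ≥ 2μ⁹.
    V-size : # V ≤ μ ^ 10 * n
    V-size = ≤-trans (cancel-≤ ρ>0 (double-cancel (begin
        2 * (ρ * # V)
          ≤⟨ *-monoʳ-≤ 2 moments ⟩
        2 * (μ ^ 9 * (ρ * n + # V))
          ≡⟨ l1 (μ ^ 9) ρ n (# V) ⟩
        ρ * (2 * μ ^ 9 * n) + 2 * μ ^ 9 * # V
          ≤⟨ +-monoʳ-≤ _ (*-monoˡ-≤ (# V)
               (≤-trans (*-monoˡ-≤ (μ ^ 9) μ>1) (≤-trans (<⇒≤ (μ^<y {10} (m≤m+n 10 26))) y≤ρ))) ⟩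
        ρ * (2 * μ ^ 9 * n) + ρ * # V ∎)))
      (*-monoˡ-≤ n (*-monoˡ-≤ (μ ^ 9) μ>1))
      where
      l1 : ∀ m r n v → 2 * (m * (r * n + v)) ≡ r * (2 * m * n) + 2 * m * v
      l1 = solve-∀
      l2 : ∀ r n v → n * n * r * (r * v) ≡ v * (r * n * (r * n))
      l2 = solve-∀
      l3 : ∀ m n r v → m * n * (r * (r * (n * n)) + r * (v * n)) ≡ n * n * r * (m * (r * n + v))
      l3 = solve-∀
      pairs : Fin q → ℕ
      pairs v = ∑∈ R λ i → ∑∈ R λ j → rep B ((j ⊝ i) ⊗ v)
      per-vector : ∀ {v} → V ∋ v → ρ * n * (ρ * n) ≤ μ ^ 9 * n * pairs v
      per-vector {v} v∈V = ≤-trans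
        (subst (λ s → ρ * n * (ρ * n) ≤ # (B+R v) * s)
          (∑∈-cong R λ i → ∑∈-cong R λ j → cong (rep B)
            (solve 3 (λ i j v → :- (i :* v) :- :- (j :* v) := (j :- i) :* v) refl i j v))
          (Shifts.collisions R B (B+R v) (λ η → ⊖ (η ⊗ v)) λ {η} {b} η∈R b∈B →
            b , η , b∈B , η∈R , solve 2 (λ b x → b :- :- x := b :+ x) refl b (η ⊗ v)))
        (*-monoˡ-≤ (pairs v) v∈V)
      per-pair : ∀ i j → ∑∈ V (λ v → rep B ((j ⊝ i) ⊗ v)) ≤ n * n + # V * n * ι (i Fin.≟ j)
      per-pair i j with i Fin.≟ j
      ... | yes _ = ≤-trans (≤-trans (∑∈-mono V λ _ → rep≤# B _)
                      (≤-reflexive (trans (∑∈-const V n) (sym (*-identityʳ _))))) (m≤n+m _ (n * n))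
      ... | no i≢j = ≤-trans (≤-trans (∑∈≤sum V _) (≤-reflexive
                       (trans (sum-dilate (rep B) (⊝-nonzero (i≢j ∘ sym))) (sum-rep B)))) (m≤m+n (n * n) _)
      moments : ρ * # V ≤ μ ^ 9 * (ρ * n + # V)
      moments = cancel-≤ {n * n * ρ} (*-mono-≤ (*-mono-≤ B>0 B>0) ρ>0) (begin
        n * n * ρ * (ρ * # V)
          ≡⟨ l2 ρ n (# V) ⟩
        # V * (ρ * n * (ρ * n))
          ≡⟨ sym (∑∈-const V _) ⟩
        ∑∈ V (λ _ → ρ * n * (ρ * n))
          ≤⟨ ∑∈-mono V per-vector ⟩
        ∑∈ V (λ v → μ ^ 9 * n * pairs v)
          ≡⟨ ∑∈-scale V (μ ^ 9 * n) _ ⟩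
        μ ^ 9 * n * ∑∈ V pairs
          ≡⟨ cong (μ ^ 9 * n *_) (trans (∑∈-swap V R _) (∑∈-cong R λ i → ∑∈-swap V R _)) ⟩
        μ ^ 9 * n * ∑∈ R (λ i → ∑∈ R λ j → ∑∈ V λ v → rep B ((j ⊝ i) ⊗ v))
          ≤⟨ *-monoʳ-≤ (μ ^ 9 * n) (∑∈-mono R λ {i} _ → ∑∈-mono R λ {j} _ → per-pair i j) ⟩
        μ ^ 9 * n * ∑∈ R (λ i → ∑∈ R λ j → n * n + # V * n * ι (i Fin.≟ j))
          ≡⟨ cong (μ ^ 9 * n *_) (trans (∑∈-cong R λ i → trans (∑∈-+ R _ _) (cong₂ _+_ (∑∈-const R (n * n)) (∑∈-scale R (# V * n) _)))
               (trans (∑∈-+ R _ _) (cong₂ _+_ (∑∈-const R _) (∑∈-scale R (# V * n) _)))) ⟩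
        μ ^ 9 * n * (ρ * (ρ * (n * n)) + # V * n * ∑∈ R (λ i → ∑∈ R λ j → ι (i Fin.≟ j)))
          ≤⟨ *-monoʳ-≤ (μ ^ 9 * n) (+-monoʳ-≤ (ρ * (ρ * (n * n))) (≤-trans (*-monoʳ-≤ (# V * n) (∑∈-delta R))
               (≤-reflexive (*-comm (# V * n) ρ)))) ⟩
        μ ^ 9 * n * (ρ * (ρ * (n * n)) + ρ * (# V * n))
          ≡⟨ l3 (μ ^ 9) n ρ (# V) ⟩
        n * n * ρ * (μ ^ 9 * (ρ * n + # V)) ∎)

    base-in-V : ∃[ b̄ ] (B ∋ b̄ × n ≤ # (restrict B λ b → V ∋? (b ⊝ b̄)) * μ)
    base-in-V = let (b̄ , b̄∈B , n≤) = good-base in b̄ , b̄∈B ,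
      ≤-trans n≤ (*-monoˡ-≤ μ (#-mono {S = restrict B λ b → isGood? (b ⊝ b̄)} {restrict B λ b → V ∋? (b ⊝ b̄)}
        λ { (b∈B , good) → b∈B , good⇒V good }))

  -- The theorem of Balog, Szemerédi and Gowers

  ²-cancel-≤ : ∀ {m n} → m * m ≤ n * n → m ≤ n
  ²-cancel-≤ {m} {n} h = ≮⇒≥ λ n<m → <⇒≱ (*-mono-< n<m n<m) h

  module PathIdentities where
    open +-*-Solver

    path-identity : ∀ k p → p * (16 * k ^ 3) * (4 * k) * (2 * k) ≡ 128 * k ^ 5 * p
    path-identity = solve 2 (λ k p → p :* (con 16 :* k :^ 3) :* (con 4 :* k) :* (con 2 :* k) := con 128 :* k :^ 5 :* p) refl

    triple-identity : ∀ k n → 128 * k ^ 5 * (k * n * (k * n * (k * n))) ≡ n * n * (128 * k ^ 8 * n)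
    triple-identity = solve 2 (λ k n → con 128 :* k :^ 5 :* (k :* n :* (k :* n :* (k :* n))) := n :* n :* (con 128 :* k :^ 8 :* n)) refl

    threshold-identity : ∀ k b → k * k * (16 * k) * b ≡ 16 * k ^ 3 * b
    threshold-identity = solve 2 (λ k b → k :* k :* (con 16 :* k) :* b := con 16 :* k :^ 3 :* b) refl

  open PathIdentities

  -- Dependent random choice: inside the neighbourhood of a well chosen b almost
  -- all pairs have many common neighbours, so A′ and B′ are joined by many paths
  -- of length three.
  module PathsOfLengthThree {q : ℕ} (A : FSet q) (A>0 : 0 < # A) (k : ℕ) (k>0 : 0 < k)
                            {G : Fin q → Fin q → Set} (G? : ∀ a b → Dec (G a b)) where

    N : ℕ
    N = # A

    degree : Fin q → ℕ
    degree a = ∑∈ A λ b → ι (G? a b)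

    codegree : Fin q → Fin q → ℕ
    codegree a a′ = ∑∈ A λ b → ι (G? a b) * ι (G? a′ b)

    -- Read 16k³ as k² · 16k: the k² allows for a neighbourhood of only N/k vertices, and 16k is the
    -- desired rarity of bad pairs inside it.
    t : ℕ
    t = 16 * k ^ 3

    Bad : Fin q → Fin q → Set
    Bad a a′ = codegree a a′ * t < N

    bad? : ∀ a a′ → Dec (Bad a a′)
    bad? a a′ = codegree a a′ * t <? N

    -- Dropping vertices of degree below N/k loses at most N²/k edges and leaves every vertex of A′
    -- with the edges that `N≤B′` counts.
    H : FSet q
    H = restrict A λ a → N ≤? degree a * k

    neighbours : Fin q → FSet q
    neighbours b = restrict H λ a → G? a b

    bad-pairs : Fin q → ℕ
    bad-pairs b = ∑∈ (neighbours b) λ a → ∑∈ (neighbours b) λ a′ → ι (bad? a a′)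

    edges : ℕ
    edges = ∑∈ A degree

    edges-H : k * edges ≤ k * ∑∈ H degree + N * N
    edges-H = begin
      k * edges
        ≡⟨ sym (∑∈-scale A k degree) ⟩
      ∑∈ A (λ a → k * degree a)
        ≤⟨ ∑∈-mono A (λ {a} _ → case a (N ≤? degree a * k)) ⟩
      ∑∈ A (λ a → k * (ι (N ≤? degree a * k) * degree a) + N)
        ≡⟨ trans (∑∈-+ A _ _) (cong₂ _+_ (trans (∑∈-scale A k _) (cong (k *_) (∑∈-restrict′ A _ degree))) (∑∈-const A N)) ⟩
      k * ∑∈ H degree + N * N ∎
      where
      case : ∀ a (d : Dec (N ≤ degree a * k)) → k * degree a ≤ k * (ι d * degree a) + N
      case a (yes _) = ≤-trans (≤-reflexive (cong (k *_) (sym (+-identityʳ (degree a))))) (m≤m+n _ N)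
      case a (no ¬h) = ≤-trans (≤-reflexive (*-comm k (degree a))) (≤-trans (<⇒≤ (≰⇒> ¬h)) (m≤n+m N _))

    ∑-neighbours : ∑∈ A (λ b → # (neighbours b)) ≡ ∑∈ H degree
    ∑-neighbours = trans (∑∈-cong A λ b → sym (∑∈-restrict H λ a → G? a b)) (∑∈-swap A H _)

    -- A bad pair has fewer than N/t common neighbours, so it lies in fewer than N/t of the
    -- neighbourhoods.
    ∑-bad-pairs : k * k * (16 * k) * ∑∈ A bad-pairs ≤ N * N * N
    ∑-bad-pairs = begin
      k * k * (16 * k) * ∑∈ A bad-pairs
        ≡⟨ threshold-identity k _ ⟩
      t * ∑∈ A bad-pairs
        ≡⟨ cong (t *_) (trans (∑∈-cong A λ b → trans (sym (∑∈-restrict′ H (λ a → G? a b) _))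
             (∑∈-cong H λ a → cong (ι (G? a b) *_) (sym (∑∈-restrict′ H (λ a′ → G? a′ b) _))))
           (trans (∑∈-swap A H _) (∑∈-cong H λ a → trans (∑∈-cong A λ b → sym (∑∈-scale H (ι (G? a b)) _)) (∑∈-swap A H _)))) ⟩
      t * ∑∈ H (λ a → ∑∈ H λ a′ → ∑∈ A λ b → ι (G? a b) * (ι (G? a′ b) * ι (bad? a a′)))
        ≡⟨ sym (trans (∑∈-cong H λ a → ∑∈-scale H t _) (∑∈-scale H t _)) ⟩
      ∑∈ H (λ a → ∑∈ H λ a′ → t * ∑∈ A λ b → ι (G? a b) * (ι (G? a′ b) * ι (bad? a a′)))
        ≤⟨ ∑∈-mono H (λ {a} _ → ∑∈-mono H λ {a′} _ → few a a′) ⟩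
      ∑∈ H (λ a → ∑∈ H λ a′ → N)
        ≡⟨ trans (∑∈-cong H λ _ → ∑∈-const H N) (∑∈-const H _) ⟩
      # H * (# H * N)
        ≤⟨ *-mono-≤ H≤N (*-monoˡ-≤ N H≤N) ⟩
      N * (N * N)
        ≡⟨ sym (*-assoc N N N) ⟩
      N * N * N ∎
      where
      H≤N : # H ≤ N
      H≤N = #-mono {S = H} {A} proj₁
      few : ∀ a a′ → t * ∑∈ A (λ b → ι (G? a b) * (ι (G? a′ b) * ι (bad? a a′))) ≤ N
      few a a′ = ≤-trans (≤-reflexive (cong (t *_) (trans
          (∑∈-cong A λ b → l1 (ι (G? a b)) (ι (G? a′ b)) (ι (bad? a a′)))
          (∑∈-scale A (ι (bad? a a′)) _))))
        (bounded (bad? a a′))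
        where
        l1 : ∀ x y z → x * (y * z) ≡ z * (x * y)
        l1 = solve-∀
        bounded : (d : Dec (Bad a a′)) → t * (ι d * codegree a a′) ≤ N
        bounded (yes bad) = ≤-trans (≤-reflexive (trans (cong (t *_) (+-identityʳ _)) (*-comm t _))) (<⇒≤ bad)
        bounded (no _)    = ≤-trans (≤-reflexive (*-zeroʳ t)) z≤n

    module _ (dense : 4 * (N * N) ≤ k * edges) where

      H-dense : 2 * (N * N) ≤ k * ∑∈ H degree
      H-dense = ≤-trans (*-monoˡ-≤ (N * N) (s≤s (s≤s (z≤n {1})))) (+-cancelʳ-≤ (N * N) (3 * (N * N)) _ (begin
        3 * (N * N) + N * N
          ≡⟨ +-comm (3 * (N * N)) (N * N) ⟩
        4 * (N * N)
          ≤⟨ dense ⟩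
        k * edges
          ≤⟨ edges-H ⟩
        k * ∑∈ H degree + N * N ∎))

      second-moment : 2 * (N * N * N) ≤ k * k * ∑∈ A (λ b → # (neighbours b) * # (neighbours b))
      second-moment = cancel-≤ A>0 (begin
        N * (2 * (N * N * N))
          ≤⟨ m≤n*m _ 2 ⟩
        2 * (N * (2 * (N * N * N)))
          ≡⟨ l1 N ⟩
        2 * (N * N) * (2 * (N * N))
          ≤⟨ *-mono-≤ H-dense H-dense ⟩
        k * ∑∈ H degree * (k * ∑∈ H degree)
          ≡⟨ l2 k (∑∈ H degree) ⟩
        k * k * (∑∈ H degree * ∑∈ H degree)
          ≡⟨ cong (λ s → k * k * (s * s)) (sym ∑-neighbours) ⟩
        k * k * (∑∈ A d * ∑∈ A d)
          ≤⟨ *-monoʳ-≤ (k * k) (cauchy-schwarz A d) ⟩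
        k * k * (N * ∑∈ A (λ b → d b * d b))
          ≡⟨ l3 (k * k) N _ ⟩
        N * (k * k * ∑∈ A (λ b → d b * d b)) ∎)
        where
        d : Fin q → ℕ
        d b = # (neighbours b)
        l1 : ∀ N → 2 * (N * (2 * (N * N * N))) ≡ 2 * (N * N) * (2 * (N * N))
        l1 = solve-∀
        l2 : ∀ k s → k * s * (k * s) ≡ k * k * (s * s)
        l2 = solve-∀
        l3 : ∀ k n s → k * (n * s) ≡ n * (k * s)
        l3 = solve-∀

      -- Both requirements on the vertex are added before averaging, so one vertex meets both:
      -- dropping one term on the left gives `N≤k*A*`, dropping the other gives `few-bad-pairs`.
      centre : ∃[ b ] (A ∋ b × k * k * (16 * k) * bad-pairs b + N * N ≤ k * k * (# (neighbours b) * # (neighbours b)))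
      centre = ∑∈-≤⇒∃ A _ _ A>0 (begin
        ∑∈ A (λ b → k * k * (16 * k) * bad-pairs b + N * N)
          ≡⟨ trans (∑∈-+ A _ _) (cong₂ _+_ (∑∈-scale A (k * k * (16 * k)) bad-pairs) (∑∈-const A (N * N))) ⟩
        k * k * (16 * k) * ∑∈ A bad-pairs + N * (N * N)
          ≤⟨ +-monoˡ-≤ (N * (N * N)) ∑-bad-pairs ⟩
        N * N * N + N * (N * N)
          ≡⟨ l1 N ⟩
        2 * (N * N * N)
          ≤⟨ second-moment ⟩
        k * k * ∑∈ A (λ b → # (neighbours b) * # (neighbours b))
          ≡⟨ sym (∑∈-scale A (k * k) _) ⟩
        ∑∈ A (λ b → k * k * (# (neighbours b) * # (neighbours b))) ∎)
        where
        l1 : ∀ N → N * N * N + N * (N * N) ≡ 2 * (N * N * N)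
        l1 = solve-∀

      b* : Fin q
      b* = proj₁ centre

      A* : FSet q
      A* = neighbours b*

      bad-count : Fin q → ℕ
      bad-count a = ∑∈ A* λ a′ → ι (bad? a a′)

      A′ B′ : FSet q
      A′ = restrict A* λ a → bad-count a * (16 * k) ≤? 2 * # A*
      B′ = restrict A λ b → # A′ ≤? ∑∈ A′ (λ a → ι (G? a b)) * (2 * k)

      A′⊑A : A′ ⊑ A
      A′⊑A p = proj₁ (proj₁ (proj₁ p))

      B′⊑A : B′ ⊑ A
      B′⊑A = proj₁

      N≤k*A* : N ≤ k * # A*
      N≤k*A* = ²-cancel-≤ (begin
        N * N
          ≤⟨ ≤-trans (m≤n+m (N * N) _) (proj₂ (proj₂ centre)) ⟩
        k * k * (# A* * # A*)
          ≡⟨ l1 k (# A*) ⟩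
        k * # A* * (k * # A*) ∎)
        where
        l1 : ∀ k a → k * k * (a * a) ≡ k * a * (k * a)
        l1 = solve-∀

      A*>0 : 0 < # A*
      A*>0 = n≢0⇒n>0 λ eq → <⇒≱ A>0 (≤-trans N≤k*A* (≤-reflexive (trans (cong (k *_) eq) (*-zeroʳ k))))

      few-bad-pairs : 16 * k * bad-pairs b* ≤ # A* * # A*
      few-bad-pairs = cancel-≤ (*-mono-≤ k>0 k>0) (begin
        k * k * (16 * k * bad-pairs b*)
          ≡⟨ sym (*-assoc (k * k) (16 * k) _) ⟩
        k * k * (16 * k) * bad-pairs b*
          ≤⟨ ≤-trans (m≤m+n _ (N * N)) (proj₂ (proj₂ centre)) ⟩
        k * k * (# A* * # A*) ∎)

      -- Markov's inequality: `bad-count` averages at most # A* / (16k) over A*, and A′ keeps the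
      -- vertices with at most twice that.
      A*≤2A′ : # A* ≤ 2 * # A′
      A*≤2A′ = cancel-≤ A*>0 (double-cancel (begin
        2 * (# A* * # A*)
          ≡⟨ l1 (# A*) ⟩
        # A* * (2 * # A*)
          ≡⟨ sym (∑∈-const A* _) ⟩
        ∑∈ A* (λ _ → 2 * # A*)
          ≤⟨ ∑∈-mono A* (λ {a} _ → case a (bad-count a * (16 * k) ≤? 2 * # A*)) ⟩
        ∑∈ A* (λ a → 2 * # A* * ι (bad-count a * (16 * k) ≤? 2 * # A*) + 16 * k * bad-count a)
          ≡⟨ trans (∑∈-+ A* _ _) (cong₂ _+_ (trans (∑∈-scale A* (2 * # A*) _) (cong (2 * # A* *_) (∑∈-restrict A* _))) (∑∈-scale A* (16 * k) bad-count)) ⟩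
        2 * # A* * # A′ + 16 * k * bad-pairs b*
          ≤⟨ +-mono-≤ (≤-reflexive (l2 (# A*) (# A′))) few-bad-pairs ⟩
        # A* * (2 * # A′) + # A* * # A* ∎))
        where
        l1 : ∀ a → 2 * (a * a) ≡ a * (2 * a)
        l1 = solve-∀
        l2 : ∀ a b → 2 * a * b ≡ a * (2 * b)
        l2 = solve-∀
        case : ∀ a (d : Dec (bad-count a * (16 * k) ≤ 2 * # A*)) → 2 * # A* ≤ 2 * # A* * ι d + 16 * k * bad-count a
        case a (yes _) = ≤-trans (≤-reflexive (sym (*-identityʳ _))) (m≤m+n _ _)
        case a (no ¬h) = ≤-trans (<⇒≤ (≰⇒> ¬h)) (≤-trans (≤-reflexive (*-comm (bad-count a) _)) (m≤n+m _ _))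

      N≤A′ : N ≤ 2 * k * # A′
      N≤A′ = ≤-trans N≤k*A* (≤-trans (*-monoʳ-≤ k A*≤2A′) (≤-reflexive (l1 k (# A′))))
        where
        l1 : ∀ k a → k * (2 * a) ≡ 2 * k * a
        l1 = solve-∀

      A′>0 : 0 < # A′
      A′>0 = n≢0⇒n>0 λ eq → <⇒≱ A>0 (≤-trans N≤A′ (≤-reflexive (trans (cong (2 * k *_) eq) (*-zeroʳ (2 * k)))))

      N≤B′ : N ≤ 2 * k * # B′
      N≤B′ = cancel-≤ A′>0 (double-cancel (begin
        2 * (# A′ * N)
          ≡⟨ cong (2 *_) (sym (∑∈-const A′ N)) ⟩
        2 * ∑∈ A′ (λ _ → N)
          ≤⟨ *-monoʳ-≤ 2 (∑∈-mono A′ λ p → proj₂ (proj₁ (proj₁ p))) ⟩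
        2 * ∑∈ A′ (λ a → degree a * k)
          ≡⟨ cong (2 *_) (trans (∑∈-cong A′ λ a → *-comm (degree a) k) (∑∈-scale A′ k degree)) ⟩
        2 * (k * ∑∈ A′ degree)
          ≡⟨ trans (sym (*-assoc 2 k _)) (cong (2 * k *_) (∑∈-swap A′ A _)) ⟩
        2 * k * ∑∈ A (λ b → ∑∈ A′ λ a → ι (G? a b))
          ≤⟨ popular₁ A _ (# A′) (2 * k) (λ {b} _ → ≤-trans (∑∈-mono A′ λ {a} _ → ι≤1 (G? a b)) (≤-reflexive (sym (#-∑∈ A′)))) ⟩
        2 * k * # A′ * # B′ + N * # A′
          ≡⟨ l1 k (# A′) (# B′) N ⟩
        # A′ * (2 * k * # B′) + # A′ * N ∎))
        where
        l1 : ∀ k a b n → 2 * k * a * b + n * a ≡ a * (2 * k * b) + a * n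
        l1 = solve-∀

      paths : Fin q → Fin q → ℕ
      paths a b = ∑∈ A′ λ a′ → ι (G? a′ b) * codegree a a′

      -- The vertex b has at least |A′|/(2k) neighbours in A′, and at most |A′|/(4k) vertices of A′
      -- form a bad pair with a. Each remaining neighbour a′ gives at least N/(16k³) paths, and |A′|
      -- ≥ N/(2k); thus 128 = 2 · 4 · 16.
      paths-large : ∀ {a b} → A′ ∋ a → B′ ∋ b → N * N ≤ 128 * k ^ 5 * paths a b
      paths-large {a} {b} a∈A′ b∈B′ = begin
        N * N
          ≤⟨ *-monoˡ-≤ N N≤A′ ⟩
        2 * k * # A′ * N
          ≤⟨ *-monoˡ-≤ N (*-monoʳ-≤ (2 * k) A′≤) ⟩
        2 * k * (4 * k * good) * N
          ≡⟨ l1 k good N ⟩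
        good * N * (4 * k) * (2 * k)
          ≤⟨ *-monoˡ-≤ (2 * k) (*-monoˡ-≤ (4 * k) good-paths) ⟩
        paths a b * (16 * k ^ 3) * (4 * k) * (2 * k) ≡⟨ path-identity k (paths a b) ⟩
        128 * k ^ 5 * paths a b ∎
        where
        common = ∑∈ A′ λ a′ → ι (G? a′ b)
        good = ∑∈ A′ λ a′ → ι (G? a′ b) * ι (¬? (bad? a a′))
        bads = ∑∈ A′ λ a′ → ι (bad? a a′)
        l1 : ∀ k g n → 2 * k * (4 * k * g) * n ≡ g * n * (4 * k) * (2 * k)
        l1 = solve-∀
        l2 : ∀ k c → c * (2 * k) + c * (2 * k) ≡ 4 * k * c
        l2 = solve-∀
        l3 : ∀ k b → 4 * (4 * k * b) ≡ b * (16 * k)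
        l3 = solve-∀
        l4 : ∀ a → 2 * (2 * a) ≡ 4 * a
        l4 = solve-∀
        split : common ≤ good + bads
        split = ≤-trans (∑∈-mono A′ λ {a′} _ → case a′ (bad? a a′)) (≤-reflexive (∑∈-+ A′ _ _))
          where
          case : ∀ a′ (d : Dec (Bad a a′)) → ι (G? a′ b) ≤ ι (G? a′ b) * ι (¬? d) + ι d
          case a′ (yes _) = ≤-trans (ι≤1 (G? a′ b)) (m≤n+m 1 _)
          case a′ (no _)  = ≤-trans (≤-reflexive (sym (*-identityʳ _))) (m≤m+n _ 0)
        few-bads : 4 * k * bads ≤ # A′
        few-bads = *-cancelˡ-≤ 4 (begin
          4 * (4 * k * bads)
            ≡⟨ l3 k bads ⟩
          bads * (16 * k)
            ≤⟨ *-monoˡ-≤ (16 * k) (∑∈-⊑ {S = A′} {A*} proj₁) ⟩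
          bad-count a * (16 * k)
            ≤⟨ proj₂ a∈A′ ⟩
          2 * # A*
            ≤⟨ *-monoʳ-≤ 2 A*≤2A′ ⟩
          2 * (2 * # A′)
            ≡⟨ l4 (# A′) ⟩
          4 * # A′ ∎)
        A′≤ : # A′ ≤ 4 * k * good
        A′≤ = +-cancelʳ-≤ (# A′) _ _ (begin
          # A′ + # A′
            ≤⟨ +-mono-≤ (proj₂ b∈B′) (proj₂ b∈B′) ⟩
          common * (2 * k) + common * (2 * k)
            ≡⟨ l2 k common ⟩
          4 * k * common
            ≤⟨ *-monoʳ-≤ (4 * k) split ⟩
          4 * k * (good + bads)
            ≡⟨ *-distribˡ-+ (4 * k) good bads ⟩
          4 * k * good + 4 * k * bads
            ≤⟨ +-monoʳ-≤ (4 * k * good) few-bads ⟩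
          4 * k * good + # A′ ∎)
        good-paths : good * N ≤ paths a b * t
        good-paths = begin
          good * N
            ≡⟨ trans (*-comm good N) (sym (∑∈-scale A′ N _)) ⟩
          ∑∈ A′ (λ a′ → N * (ι (G? a′ b) * ι (¬? (bad? a a′))))
            ≤⟨ ∑∈-mono A′ (λ {a′} _ → case a′ (bad? a a′)) ⟩
          ∑∈ A′ (λ a′ → t * (ι (G? a′ b) * codegree a a′))
            ≡⟨ trans (∑∈-scale A′ t _) (*-comm t _) ⟩
          paths a b * t ∎
          where
          l5 : ∀ n x → n * (x * 1) ≡ x * n
          l5 = solve-∀
          l6 : ∀ x c t → x * (c * t) ≡ t * (x * c)
          l6 = solve-∀
          case : ∀ a′ (d : Dec (Bad a a′)) → N * (ι (G? a′ b) * ι (¬? d)) ≤ t * (ι (G? a′ b) * codegree a a′)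
          case a′ (yes _) = ≤-trans (≤-reflexive (trans (cong (N *_) (*-zeroʳ (ι (G? a′ b)))) (*-zeroʳ N))) z≤n
          case a′ (no ¬bad) = ≤-trans (≤-reflexive (l5 N (ι (G? a′ b))))
              (≤-trans (*-monoʳ-≤ (ι (G? a′ b)) (≮⇒≥ ¬bad)) (≤-reflexive (l6 (ι (G? a′ b)) (codegree a a′) t)))

  module BSGIdentities where
    open +-*-Solver

    double-power : ∀ k n → (2 * k) ^ 8 * n ≡ 128 * k ^ 8 * n + 128 * k ^ 8 * n
    double-power = solve 2 (λ k n → (con 2 :* k) :^ 8 :* n := con 128 :* k :^ 8 :* n :+ con 128 :* k :^ 8 :* n) refl

  double-power-≤ : ∀ k n {m} → m ≤ 128 * k ^ 8 * n → m ≤ (2 * k) ^ 8 * n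
  double-power-≤ k n h = ≤-trans h (≤-trans (m≤m+n (128 * k ^ 8 * n) (128 * k ^ 8 * n)) (≤-reflexive (sym (BSGIdentities.double-power k n))))

  module BalogSzemerédiGowers {q : ℕ} (C : CodeField q) (A : FSet q) (A>0 : 0 < # A) (k : ℕ) (k>0 : 0 < k)
                              (ξ : Fin q) where
    open Combinatorics C
    open Dilations C

    private
      N : ℕ
      N = # A

    -- Solutions of a′ - ξb′ = z in A, counted by b′, which determines a′. Accordingly `energy` is
    -- E(A, ξA) with its equation rearranged as a - ξb = a′ - ξb′.
    reps : Fin q → ℕ
    reps z = ∑∈ A λ b → ι (A ∋? (z ⊕ ξ ⊗ b))

    energy : ℕ
    energy = ∑∈ A λ a → ∑∈ A λ b → reps (a ⊝ ξ ⊗ b)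

    S : FSet q
    S = mkF (λ z → N ≤ reps z * k) (λ z → N ≤? reps z * k)

    open PathsOfLengthThree A A>0 k k>0 (λ a b → S ∋? (a ⊝ ξ ⊗ b)) hiding (N) public

    reps≤N : ∀ z → reps z ≤ N
    reps≤N z = ≤-trans (∑∈-mono A λ {b} _ → ι≤1 (A ∋? (z ⊕ ξ ⊗ b))) (≤-reflexive (sym (#-∑∈ A)))

    S-small : # S ≤ k * N
    S-small = cancel-≤ A>0 (begin
      N * # S
        ≡⟨ trans (*-comm N _) (sym (∑∈-const S N)) ⟩
      ∑∈ S (λ _ → N)
        ≤⟨ ∑∈-mono S id ⟩
      ∑∈ S (λ z → reps z * k)
        ≤⟨ ∑∈≤sum S _ ⟩
      sum (λ z → reps z * k)
        ≡⟨ sym (*-distribʳ-sum k reps) ⟩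
      sum reps * k
        ≡⟨ cong (_* k) (Shifts.sum-w A A full (ξ ⊗_) λ {i} _ _ → i) ⟩
      N * N * k
        ≡⟨ l1 N k ⟩
      N * (k * N) ∎)
      where
      l1 : ∀ n k → n * n * k ≡ n * (k * n)
      l1 = solve-∀

    dense-edges : 5 * (N * N * N) ≤ k * energy → 4 * (N * N) ≤ k * edges
    dense-edges h = cancel-≤ A>0 (+-cancelʳ-≤ (N * (N * N)) _ _ (begin
      N * (4 * (N * N)) + N * (N * N)
        ≡⟨ l1 N ⟩
      5 * (N * N * N)
        ≤⟨ h ⟩
      k * energy
        ≤⟨ popular₂ A A (λ a b → reps (a ⊝ ξ ⊗ b)) N k (λ _ _ → reps≤N _) ⟩
      k * N * edges + N * (N * N)
        ≡⟨ cong (_+ N * (N * N)) (l2 k N edges) ⟩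
      N * (k * edges) + N * (N * N) ∎))
      where
      l1 : ∀ n → n * (4 * (n * n)) + n * (n * n) ≡ 5 * (n * n * n)
      l1 = solve-∀
      l2 : ∀ k n e → k * n * e ≡ n * (k * e)
      l2 = solve-∀

    -- Representations z = s₁ - s₂ + s₃ with all three terms in S, where s₂ is determined by the
    -- rest.
    triples : Fin q → ℕ
    triples z = ∑∈ S λ s₃ → ∑∈ S λ s₁ → ι (S ∋? (s₁ ⊕ s₃ ⊝ z))

    ∑-triples : sum triples ≡ # S * (# S * # S)
    ∑-triples = trans (sym (∑∈-sum S λ s₃ z → ∑∈ S λ s₁ → ι (S ∋? (s₁ ⊕ s₃ ⊝ z))))
      (trans (∑∈-cong S λ s₃ → trans (sym (∑∈-sum S λ s₁ z → ι (S ∋? (s₁ ⊕ s₃ ⊝ z))))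
        (trans (∑∈-cong S λ s₁ → trans (sum-reflect (λ x → ι (S ∋? x)) (s₁ ⊕ s₃)) (sum-ι S)) (∑∈-const S (# S))))
      (∑∈-const S (# S * # S)))

    module _ (ξ≢0 : ξ ≢ 𝟘) (dense : 4 * (N * N) ≤ k * edges) where

      dilate-reflect : Fin q → Fin q → Fin q
      dilate-reflect a b = a ⊝ ξ ⊗ b

      undo : Fin q → Fin q → Fin q
      undo a s = invˢ ξ ⊗ (a ⊝ s)

      -- A path a, b′, a′, b gives a - ξb = (a - ξb′) - (a′ - ξb′) + (a′ - ξb) with terms in S. The
      -- last term determines a′, and the first determines b′ because ξ ≠ 0.
      paths≤triples : ∀ a b → paths dense a b ≤ triples (a ⊝ ξ ⊗ b)
      paths≤triples a b = ≤-trans (∑∈≤sum (A′ dense) _)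
        (sum≤∑∈ S _ _ (_⊝ ξ ⊗ b) (_⊕ ξ ⊗ b) (λ x → a⊕b⊝b≡a x (ξ ⊗ b)) (λ x → a⊝b⊕b≡a x (ξ ⊗ b)) λ a′ →
          *-monoʳ-≤ (ι (S ∋? (a′ ⊝ ξ ⊗ b))) (≤-trans (∑∈≤sum A _)
            (sum≤∑∈ S _ _ (dilate-reflect a) (undo a)
              (λ s → trans (cong (a ⊝_) (inv-cancelʳ ξ≢0 (a ⊝ s))) (a⊝[a⊝b]≡b a s))
              (λ b′ → trans (cong (invˢ ξ ⊗_) (a⊝[a⊝b]≡b a (ξ ⊗ b′))) (inv-cancelˡ ξ≢0 b′))
              λ b′ → *-monoʳ-≤ (ι (S ∋? (a ⊝ ξ ⊗ b′))) (≤-reflexive (cong (λ x → ι (S ∋? x))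
                (solve 4 (λ a a′ x y → a′ :- y := a :- y :+ (a′ :- x) :- (a :- x)) refl a a′ (ξ ⊗ b) (ξ ⊗ b′)))))))

      D : FSet q
      D = A′ dense ⊟ ξ ⊙ B′ dense

      count-triples : ∀ c → (∀ {a b} → A′ dense ∋ a → B′ dense ∋ b → N * N ≤ c * paths dense a b) →
                      N * N * # D ≤ c * (k * N * (k * N * (k * N)))
      count-triples c h = begin
        N * N * # D
          ≡⟨ trans (*-comm (N * N) _) (sym (∑∈-const D (N * N))) ⟩
        ∑∈ D (λ _ → N * N)
          ≤⟨ ∑∈-mono D (λ { (a , _ , a∈A′ , (b , b∈B′ , refl) , refl) →
               ≤-trans (h a∈A′ b∈B′) (*-monoʳ-≤ c (paths≤triples a b)) }) ⟩
        ∑∈ D (λ z → c * triples z)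
          ≤⟨ ∑∈≤sum D _ ⟩
        sum (λ z → c * triples z)
          ≡⟨ sym (*-distribˡ-sum c triples) ⟩
        c * sum triples
          ≡⟨ cong (c *_) ∑-triples ⟩
        c * (# S * (# S * # S))
          ≤⟨ *-monoʳ-≤ c (*-mono-≤ S-small (*-mono-≤ S-small S-small)) ⟩
        c * (k * N * (k * N * (k * N))) ∎

      difference-small : # D ≤ (2 * k) ^ 8 * N
      difference-small = double-power-≤ k N (cancel-≤ {N * N} {# D} {128 * k ^ 8 * N} (*-mono-≤ A>0 A>0)
        (≤-trans (count-triples (128 * k ^ 5) (paths-large dense)) (≤-reflexive (triple-identity k N))))

  cauchy-schwarz₂ : ∀ {q} (S : FSet q) (f : Fin q → Fin q → ℕ) →
    ∑∈ S (λ a → ∑∈ S (f a)) * ∑∈ S (λ a → ∑∈ S (f a)) ≤ # S * # S * ∑∈ S (λ a → ∑∈ S λ b → f a b * f a b)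
  cauchy-schwarz₂ S f = begin
    ∑∈ S g * ∑∈ S g
      ≤⟨ cauchy-schwarz S g ⟩
    # S * ∑∈ S (λ a → g a * g a)
      ≤⟨ *-monoʳ-≤ (# S) (∑∈-mono S λ {a} _ → cauchy-schwarz S (f a)) ⟩
    # S * ∑∈ S (λ a → # S * ∑∈ S (λ b → f a b * f a b))
      ≡⟨ cong (# S *_) (∑∈-scale S (# S) _) ⟩
    # S * (# S * ∑∈ S (λ a → ∑∈ S λ b → f a b * f a b))
      ≡⟨ sym (*-assoc (# S) (# S) _) ⟩
    # S * # S * ∑∈ S (λ a → ∑∈ S λ b → f a b * f a b) ∎
    where
    g : Fin _ → ℕ
    g a = ∑∈ S (f a)

  -- Dilates sharing their dense pieces

  module Selection {q : ℕ} (C : CodeField q) (A : FSet q) (A>0 : 0 < # A) (k : ℕ) (k>0 : 0 < k)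
                   (X : FSet q) (X>0 : 0 < # X)
                   (energetic : ∀ {ξ} → X ∋ ξ → ξ ≢ CodeField.𝟘 C ×
                      5 * (# A * # A * # A) ≤ k * BalogSzemerédiGowers.energy C A A>0 k k>0 ξ) where
    open Combinatorics C
    open Dilations C

    N κ₀ : ℕ
    N = # A
    κ₀ = 2 * k

    -- Available for every ξ, with estimates conditional on ξ ∈ X, so that the pieces are plain
    -- functions of ξ under summation.
    record Pieces (ξ : Fin q) : Set₁ where
      field
        A′ B′ : FSet q
        A′⊑A  : A′ ⊑ A
        B′⊑A  : B′ ⊑ A
        N≤A′  : X ∋ ξ → N ≤ κ₀ * # A′
        N≤B′  : X ∋ ξ → N ≤ κ₀ * # B′
        small : X ∋ ξ → # (A′ ⊟ ξ ⊙ B′) ≤ κ₀ ^ 8 * N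

    pieces : ∀ ξ → Pieces ξ
    pieces ξ = choose (X ∋? ξ)
      where
      open BalogSzemerédiGowers C A A>0 k k>0 ξ
      choose : Dec (X ∋ ξ) → Pieces ξ
      choose (yes ξ∈X) = record
        { A′ = A′ dense ; B′ = B′ dense ; A′⊑A = A′⊑A dense ; B′⊑A = B′⊑A dense
        ; N≤A′ = λ _ → N≤A′ dense ; N≤B′ = λ _ → N≤B′ dense
        ; small = λ _ → difference-small (proj₁ (energetic ξ∈X)) dense }
        where
        dense : 4 * (N * N) ≤ k * edges
        dense = dense-edges (proj₂ (energetic ξ∈X))
      -- A default outside X, where the estimates are vacuous.
      choose (no ξ∉X) = record
        { A′ = A ; B′ = A ; A′⊑A = id ; B′⊑A = id
        ; N≤A′ = λ ξ∈X → ⊥-elim (ξ∉X ξ∈X) ; N≤B′ = λ ξ∈X → ⊥-elim (ξ∉X ξ∈X)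
        ; small = λ ξ∈X → ⊥-elim (ξ∉X ξ∈X) }

    module _ (ξ : Fin q) where
      open Pieces (pieces ξ) public using () renaming
        (A′ to Aₓ; B′ to Bₓ; A′⊑A to Aₓ⊑A; B′⊑A to Bₓ⊑A; N≤A′ to N≤Aₓ; N≤B′ to N≤Bₓ; small to Aₓ-ξBₓ)

    infixr 7 _∩ᶠ_
    _∩ᶠ_ : FSet q → FSet q → FSet q
    S ∩ᶠ T = restrict S (T ∋?_)

    -- The size of the intersection of the rectangles Aₓ ξ × Bₓ ξ and Aₓ ξ′ × Bₓ ξ′.
    shared : Fin q → Fin q → ℕ
    shared ξ ξ′ = # (Aₓ ξ ∩ᶠ Aₓ ξ′) * # (Bₓ ξ ∩ᶠ Bₓ ξ′)

    c₀ : ℕ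
    c₀ = κ₀ * κ₀ * (κ₀ * κ₀)

    private
      incidence : Fin q → Fin q → ℕ
      incidence a b = ∑∈ X λ ξ → ι (Aₓ ξ ∋? a) * ι (Bₓ ξ ∋? b)

      first-moment : # X * (N * N) ≤ κ₀ * κ₀ * ∑∈ A (λ a → ∑∈ A (incidence a))
      first-moment = begin
        # X * (N * N)
          ≡⟨ sym (∑∈-const X (N * N)) ⟩
        ∑∈ X (λ _ → N * N)
          ≤⟨ ∑∈-mono X (λ {ξ} ξ∈X → ≤-trans (*-mono-≤ (N≤Aₓ ξ ξ∈X) (N≤Bₓ ξ ξ∈X)) (≤-reflexive (l1 κ₀ (# (Aₓ ξ)) (# (Bₓ ξ))))) ⟩
        ∑∈ X (λ ξ → κ₀ * κ₀ * (# (Aₓ ξ) * # (Bₓ ξ)))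
          ≡⟨ ∑∈-scale X (κ₀ * κ₀) _ ⟩
        κ₀ * κ₀ * ∑∈ X (λ ξ → # (Aₓ ξ) * # (Bₓ ξ))
          ≤⟨ *-monoʳ-≤ (κ₀ * κ₀) (∑∈-mono X λ {ξ} _ → ≤-trans
               (*-mono-≤ (#≤∑∈ {S = A} {Aₓ ξ} (Aₓ⊑A ξ)) (#≤∑∈ {S = A} {Bₓ ξ} (Bₓ⊑A ξ)))
               (≤-reflexive (∑∈-prod A A (λ a → ι (Aₓ ξ ∋? a)) (λ b → ι (Bₓ ξ ∋? b))))) ⟩
        κ₀ * κ₀ * ∑∈ X (λ ξ → ∑∈ A λ a → ∑∈ A λ b → ι (Aₓ ξ ∋? a) * ι (Bₓ ξ ∋? b))
          ≡⟨ cong (κ₀ * κ₀ *_) (trans (∑∈-swap X A _) (∑∈-cong A λ a → ∑∈-swap X A _)) ⟩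
        κ₀ * κ₀ * ∑∈ A (λ a → ∑∈ A (incidence a)) ∎
        where
        l1 : ∀ k a b → k * a * (k * b) ≡ k * k * (a * b)
        l1 = solve-∀

      second-moment : ∑∈ A (λ a → ∑∈ A λ b → incidence a b * incidence a b) ≤
                      ∑∈ X (λ ξ → ∑∈ X λ ξ′ → shared ξ ξ′)
      second-moment = begin
        ∑∈ A (λ a → ∑∈ A λ b → incidence a b * incidence a b)
          ≡⟨ ∑∈-cong A (λ a → ∑∈-cong A λ b → trans
               (∑∈-prod X X (λ ξ → ι (Aₓ ξ ∋? a) * ι (Bₓ ξ ∋? b)) (λ ξ → ι (Aₓ ξ ∋? a) * ι (Bₓ ξ ∋? b)))
               (∑∈-cong X λ ξ → ∑∈-cong X λ ξ′ → l1 (ι (Aₓ ξ ∋? a)) (ι (Bₓ ξ ∋? b)) (ι (Aₓ ξ′ ∋? a)) (ι (Bₓ ξ′ ∋? b)))) ⟩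
        ∑∈ A (λ a → ∑∈ A λ b → ∑∈ X λ ξ → ∑∈ X λ ξ′ → g ξ ξ′ a * h ξ ξ′ b)
          ≡⟨ ∑∈-cong A (λ a → trans (∑∈-swap A X _) (∑∈-cong X λ ξ → ∑∈-swap A X _)) ⟩
        ∑∈ A (λ a → ∑∈ X λ ξ → ∑∈ X λ ξ′ → ∑∈ A λ b → g ξ ξ′ a * h ξ ξ′ b)
          ≡⟨ trans (∑∈-swap A X _) (∑∈-cong X λ ξ → ∑∈-swap A X _) ⟩
        ∑∈ X (λ ξ → ∑∈ X λ ξ′ → ∑∈ A λ a → ∑∈ A λ b → g ξ ξ′ a * h ξ ξ′ b)
          ≡⟨ ∑∈-cong X (λ ξ → ∑∈-cong X λ ξ′ → sym (∑∈-prod A A (g ξ ξ′) (h ξ ξ′))) ⟩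
        ∑∈ X (λ ξ → ∑∈ X λ ξ′ → ∑∈ A (g ξ ξ′) * ∑∈ A (h ξ ξ′))
          ≤⟨ ∑∈-mono X (λ {ξ} _ → ∑∈-mono X λ {ξ′} _ → *-mono-≤ (∑∈-∩ A (Aₓ ξ) (Aₓ ξ′)) (∑∈-∩ A (Bₓ ξ) (Bₓ ξ′))) ⟩
        ∑∈ X (λ ξ → ∑∈ X λ ξ′ → shared ξ ξ′) ∎
        where
        g h : Fin q → Fin q → Fin q → ℕ
        g ξ ξ′ a = ι (Aₓ ξ ∋? a) * ι (Aₓ ξ′ ∋? a)
        h ξ ξ′ b = ι (Bₓ ξ ∋? b) * ι (Bₓ ξ′ ∋? b)
        l1 : ∀ a b c d → a * b * (c * d) ≡ a * c * (b * d)
        l1 = solve-∀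

      NN>0 : 0 < N * N
      NN>0 = *-mono-≤ A>0 A>0

      -- Each rectangle has density at least κ₀⁻² in A × A, so by Cauchy-Schwarz two of them overlap
      -- with density κ₀⁻⁴ on average.
      total-overlap : # X * (# X * (N * N)) ≤ c₀ * ∑∈ X (λ ξ → ∑∈ X λ ξ′ → shared ξ ξ′)
      total-overlap = cancel-≤ NN>0 (begin
        N * N * (# X * (# X * (N * N)))
          ≡⟨ l1 (N * N) (# X) ⟩
        # X * (N * N) * (# X * (N * N))
          ≤⟨ *-mono-≤ first-moment first-moment ⟩
        κ₀ * κ₀ * I * (κ₀ * κ₀ * I)
          ≡⟨ l2 (κ₀ * κ₀) I ⟩
        c₀ * (I * I)
          ≤⟨ *-monoʳ-≤ c₀ (≤-trans (cauchy-schwarz₂ A incidence) (*-monoʳ-≤ (N * N) second-moment)) ⟩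
        c₀ * (N * N * O)
          ≡⟨ l3 c₀ (N * N) O ⟩
        N * N * (c₀ * O) ∎)
        where
        I = ∑∈ A (λ a → ∑∈ A (incidence a))
        O = ∑∈ X (λ ξ → ∑∈ X λ ξ′ → shared ξ ξ′)
        l1 : ∀ n x → n * (x * (x * n)) ≡ x * n * (x * n)
        l1 = solve-∀
        l2 : ∀ k i → k * i * (k * i) ≡ k * k * (i * i)
        l2 = solve-∀
        l3 : ∀ c n o → c * (n * o) ≡ n * (c * o)
        l3 = solve-∀

      centre : ∃[ x₀ ] (X ∋ x₀ × # X * (N * N) ≤ c₀ * ∑∈ X λ ξ → shared ξ x₀)
      centre = ∑∈-≤⇒∃ X (λ _ → # X * (N * N)) (λ x₀ → c₀ * ∑∈ X λ ξ → shared ξ x₀) X>0 (begin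
        ∑∈ X (λ _ → # X * (N * N))
          ≡⟨ ∑∈-const X _ ⟩
        # X * (# X * (N * N))
          ≤⟨ total-overlap ⟩
        c₀ * ∑∈ X (λ ξ → ∑∈ X λ ξ′ → shared ξ ξ′)
          ≡⟨ cong (c₀ *_) (∑∈-swap X X _) ⟩
        c₀ * ∑∈ X (λ x₀ → ∑∈ X λ ξ → shared ξ x₀)
          ≡⟨ sym (∑∈-scale X c₀ _) ⟩
        ∑∈ X (λ x₀ → c₀ * ∑∈ X λ ξ → shared ξ x₀) ∎)

    x₀ : Fin q
    x₀ = proj₁ centre

    x₀∈X : X ∋ x₀
    x₀∈X = proj₁ (proj₂ centre)

    x₀≢0 : x₀ ≢ 𝟘
    x₀≢0 = proj₁ (energetic x₀∈X)

    X″ : FSet q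
    X″ = restrict X λ ξ → N * N ≤? shared ξ x₀ * (2 * c₀)

    shared≤ : ∀ ξ ξ′ → shared ξ ξ′ ≤ N * N
    shared≤ ξ ξ′ = *-mono-≤ (#-mono {S = Aₓ ξ ∩ᶠ Aₓ ξ′} {A} (Aₓ⊑A ξ ∘ proj₁))
                             (#-mono {S = Bₓ ξ ∩ᶠ Bₓ ξ′} {A} (Bₓ⊑A ξ ∘ proj₁))

    X≤X″ : # X ≤ 2 * c₀ * # X″
    X≤X″ = cancel-≤ NN>0 (double-cancel (begin
      2 * (N * N * # X)
        ≡⟨ l1 (N * N) (# X) ⟩
      2 * (# X * (N * N))
        ≤⟨ *-monoʳ-≤ 2 (proj₂ (proj₂ centre)) ⟩
      2 * (c₀ * ∑∈ X (λ ξ → shared ξ x₀))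
        ≡⟨ sym (*-assoc 2 c₀ _) ⟩
      2 * c₀ * ∑∈ X (λ ξ → shared ξ x₀)
        ≤⟨ popular₁ X (λ ξ → shared ξ x₀) (N * N) (2 * c₀) (λ _ → shared≤ _ x₀) ⟩
      2 * c₀ * (N * N) * # X″ + # X * (N * N)
        ≡⟨ l2 (2 * c₀) (N * N) (# X″) (# X) ⟩
      N * N * (2 * c₀ * # X″) + N * N * # X ∎))
      where
      l1 : ∀ n x → 2 * (n * x) ≡ 2 * (x * n)
      l1 = solve-∀
      l2 : ∀ c n y x → c * n * y + x * n ≡ n * (c * y) + n * x
      l2 = solve-∀

    B₀ : FSet q
    B₀ = Bₓ x₀

    D : ℕ
    D = κ₀ ^ 8 * N

    B₀-B₀ : N * # (B₀ ⊟ B₀) ≤ κ₀ * (D * D)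
    B₀-B₀ = begin
      N * # (B₀ ⊟ B₀)
        ≤⟨ *-mono-≤ (N≤Aₓ x₀ x₀∈X) scaled ⟩
      κ₀ * # A₀ * # (x₀ ⊙ B₀ ⊟ x₀ ⊙ B₀)
        ≡⟨ l1 κ₀ (# A₀) _ ⟩
      κ₀ * (# (x₀ ⊙ B₀ ⊟ x₀ ⊙ B₀) * # A₀)
        ≤⟨ *-monoʳ-≤ κ₀ (ruzsa-triangle (x₀ ⊙ B₀) (x₀ ⊙ B₀) A₀) ⟩
      κ₀ * (# (x₀ ⊙ B₀ ⊟ A₀) * # (x₀ ⊙ B₀ ⊟ A₀))
        ≤⟨ *-monoʳ-≤ κ₀ (*-mono-≤ small small) ⟩
      κ₀ * (D * D) ∎
      where
      A₀ = Aₓ x₀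
      small : # (x₀ ⊙ B₀ ⊟ A₀) ≤ D
      small = ≤-trans (⊟-swap (x₀ ⊙ B₀) A₀) (Aₓ-ξBₓ x₀ x₀∈X)
      scaled : # (B₀ ⊟ B₀) ≤ # (x₀ ⊙ B₀ ⊟ x₀ ⊙ B₀)
      scaled = #-dilate {B₀ ⊟ B₀} {x₀ ⊙ B₀ ⊟ x₀ ⊙ B₀} x₀≢0 λ { (b , b′ , b∈ , b′∈ , refl) →
        x₀ ⊗ b , x₀ ⊗ b′ , (b , b∈ , refl) , (b′ , b′∈ , refl) ,
        solve 3 (λ x b c → x :* (b :- c) := x :* b :- x :* c) refl x₀ b b′ }
      l1 : ∀ k a s → k * a * s ≡ k * (s * a)
      l1 = solve-∀

    Y : FSet q
    Y = invˢ x₀ ⊙ X″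

    X≤Y : # X ≤ 2 * c₀ * # Y
    X≤Y = ≤-trans X≤X″ (*-monoʳ-≤ (2 * c₀) (#-bij {S = X″} {Y} (invˢ x₀ ⊗_) (x₀ ⊗_)
      (inv-cancelˡ x₀≢0) (inv-cancelʳ x₀≢0) λ {ξ} ξ∈ → ξ , ξ∈ , refl))

    -- After dilation by x₀ the set is x₀B₀ - ξB₀. The triangle inequality is applied along the
    -- chain x₀B₀, U, ξW, ξB₀, where U and W are the parts that the pieces of ξ and x₀ share; ξ ∈ X″
    -- makes the product |U||W| large.
    B₀-xB₀ : ∀ {x} → Y ∋ x → N * N * # (B₀ ⊟ x ⊙ B₀) ≤ 2 * c₀ * (D * D * # (B₀ ⊟ B₀))
    B₀-xB₀ {x} (ξ , (ξ∈X , N²≤) , refl) = begin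
      N * N * E
        ≤⟨ *-monoˡ-≤ E N²≤ ⟩
      # U * # W * (2 * c₀) * E
        ≤⟨ *-mono-≤ (*-monoˡ-≤ (2 * c₀) (*-monoʳ-≤ (# U) W≤ξW)) dilated ⟩
      # U * # (ξ ⊙ W) * (2 * c₀) * # (x₀ ⊙ B₀ ⊟ ξ ⊙ B₀)
        ≡⟨ l1 (# U) (# (ξ ⊙ W)) (2 * c₀) _ ⟩
      2 * c₀ * (# U * (# (x₀ ⊙ B₀ ⊟ ξ ⊙ B₀) * # (ξ ⊙ W)))
        ≤⟨ *-monoʳ-≤ (2 * c₀) (*-monoʳ-≤ (# U) (ruzsa-triangle (x₀ ⊙ B₀) (ξ ⊙ B₀) (ξ ⊙ W))) ⟩
      2 * c₀ * (# U * (# (x₀ ⊙ B₀ ⊟ ξ ⊙ W) * # (ξ ⊙ B₀ ⊟ ξ ⊙ W)))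
        ≡⟨ cong (2 * c₀ *_) (l2 (# U) (# (x₀ ⊙ B₀ ⊟ ξ ⊙ W)) (# (ξ ⊙ B₀ ⊟ ξ ⊙ W))) ⟩
      2 * c₀ * (# (x₀ ⊙ B₀ ⊟ ξ ⊙ W) * # U * # (ξ ⊙ B₀ ⊟ ξ ⊙ W))
        ≤⟨ *-monoʳ-≤ (2 * c₀) (*-mono-≤
             (≤-trans (ruzsa-triangle (x₀ ⊙ B₀) (ξ ⊙ W) U) (*-mono-≤ small₀ small₁))
             (≤-trans (⊙-⊟ ξ B₀ W) (⊟-mono {B₀} {B₀} {W} {B₀} id proj₂))) ⟩
      2 * c₀ * (D * D * # (B₀ ⊟ B₀)) ∎
      where
      U W : FSet q
      U = Aₓ ξ ∩ᶠ Aₓ x₀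
      W = Bₓ ξ ∩ᶠ Bₓ x₀
      E = # (B₀ ⊟ (invˢ x₀ ⊗ ξ) ⊙ B₀)
      ξ≢0 = proj₁ (energetic ξ∈X)
      W≤ξW : # W ≤ # (ξ ⊙ W)
      W≤ξW = #-dilate {W} {ξ ⊙ W} ξ≢0 λ {b} b∈ → b , b∈ , refl
      dilated : E ≤ # (x₀ ⊙ B₀ ⊟ ξ ⊙ B₀)
      dilated = #-dilate {B₀ ⊟ (invˢ x₀ ⊗ ξ) ⊙ B₀} {x₀ ⊙ B₀ ⊟ ξ ⊙ B₀} x₀≢0
        λ { (b , _ , b∈ , (c , c∈ , refl) , refl) →
            x₀ ⊗ b , ξ ⊗ c , (b , b∈ , refl) , (c , c∈ , refl) ,
            trans (solve 5 (λ x i ξ b c → x :* (b :- i :* ξ :* c) := x :* b :- x :* (i :* (ξ :* c))) refl x₀ (invˢ x₀) ξ b c)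
                  (cong (x₀ ⊗ b ⊝_) (inv-cancelʳ x₀≢0 (ξ ⊗ c))) }
      small₀ : # (x₀ ⊙ B₀ ⊟ U) ≤ D
      small₀ = ≤-trans (⊟-swap (x₀ ⊙ B₀) U)
        (≤-trans (⊟-mono {U} {Aₓ x₀} {x₀ ⊙ B₀} {x₀ ⊙ B₀} proj₂ id) (Aₓ-ξBₓ x₀ x₀∈X))
      small₁ : # (ξ ⊙ W ⊟ U) ≤ D
      small₁ = ≤-trans (⊟-swap (ξ ⊙ W) U)
        (≤-trans (⊟-mono {U} {Aₓ ξ} {ξ ⊙ W} {ξ ⊙ Bₓ ξ} proj₁ λ { (b , b∈ , eq) → b , proj₁ b∈ , eq }) (Aₓ-ξBₓ ξ ξ∈X))
      l1 : ∀ u w c e → u * w * c * e ≡ c * (u * (e * w))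
      l1 = solve-∀
      l2 : ∀ u e f → u * (e * f) ≡ e * u * f
      l2 = solve-∀

  -- Assembling the estimates over codes

  module OutcomeIdentities where
    open +-*-Solver

    B-B-identity : ∀ k n → k * (k ^ 8 * n * (k ^ 8 * n)) ≡ n * (k ^ 17 * n)
    B-B-identity = solve 2 (λ k n → k :* (k :^ 8 :* n :* (k :^ 8 :* n)) := n :* (k :^ 17 :* n)) refl

    B-xB-identity : ∀ k n → 2 * (k * k * (k * k)) * (k ^ 8 * n * (k ^ 8 * n) * (k ^ 17 * n)) ≡ n * n * (2 * k * k ^ 36 * n)
    B-xB-identity = solve 2 (λ k n → con 2 :* (k :* k :* (k :* k)) :* (k :^ 8 :* n :* (k :^ 8 :* n) :* (k :^ 17 :* n))
                                     := n :* n :* (con 2 :* k :* k :^ 36 :* n)) refl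

    four-identity : ∀ k → 2 * (k * k * (k * k)) ≡ 2 * k * k ^ 3
    four-identity = solve 1 (λ k → con 2 :* (k :* k :* (k :* k)) := con 2 :* k :* k :^ 3) refl

  -- R and V are the invariant subfield and subspace; those of the theorem, generated by Y and A₁,
  -- are later found inside them and inherit their bounds.
  record Outcome {q : ℕ} (C : CodeField q) (A X : FSet q) (κ : ℕ) : Set₁ where
    open Combinatorics C
    field
      ā x₀      : Fin q
      R V Y     : FSet q
      ā∈A       : A ∋ ā
      x₀∈X      : X ∋ x₀
      R∋0       : R ∋ 𝟘
      R∋1       : R ∋ 𝟙
      R-⊕       : ∀ {x y} → R ∋ x → R ∋ y → R ∋ (x ⊕ y)
      R-⊖       : ∀ {x} → R ∋ x → R ∋ (⊖ x)
      R-⊗       : ∀ {x y} → R ∋ x → R ∋ y → R ∋ (x ⊗ y)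
      R-inv     : ∀ {x} → x ≢ 𝟘 → R ∋ x → R ∋ invˢ x
      V∋0       : V ∋ 𝟘
      V-⊕       : ∀ {x y} → V ∋ x → V ∋ y → V ∋ (x ⊕ y)
      V-scale   : ∀ {c x} → R ∋ c → V ∋ x → V ∋ (c ⊗ x)
      Y⊑R       : Y ⊑ R
      Y⊑x₀⁻¹X   : ∀ {x} → Y ∋ x → ∃[ ξ ] (X ∋ ξ × x ≡ invˢ x₀ ⊗ ξ)
    A₁ : FSet q
    A₁ = restrict V (λ v → A ∋? (v ⊕ ā))
    field
      A₁-large  : # A ≤ κ * κ ^ 39 * # A₁
      V-small   : # V ≤ (κ ^ 39) ^ 11 * # A₁
      Y-large   : # X ≤ κ ^ 4 * # Y

  module Extraction {q : ℕ} (C : CodeField q) (A : FSet q) (A>0 : 0 < # A) (k : ℕ) (k>0 : 0 < k)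
              (X : FSet q) (X>0 : 0 < # X)
              (energetic : ∀ {ξ} → X ∋ ξ → ξ ≢ CodeField.𝟘 C ×
                 5 * (# A * # A * # A) ≤ k * BalogSzemerédiGowers.energy C A A>0 k k>0 ξ)
              (X-large : (2 * (2 * k)) ^ 5 * ((2 * (2 * k)) ^ 39) ^ 36 ≤ # X) where
    open Combinatorics C
    open Selection C A A>0 k k>0 X X>0 energetic

    -- One factor of κ absorbs the numerical constants of the preceding bounds.
    κ μ : ℕ
    κ = 2 * κ₀
    μ = κ ^ 39

    κ₀≤κ : κ₀ ≤ κ
    κ₀≤κ = m≤n*m κ₀ 2

    4≤κ : 4 ≤ κ
    4≤κ = *-monoʳ-≤ 2 (*-monoʳ-≤ 2 k>0)

    1<κ : 1 < κ
    1<κ = ≤-trans (s≤s (s≤s z≤n)) 4≤κ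

    κ^-mono : ∀ {a b} → a ≤ b → κ ^ a ≤ κ ^ b
    κ^-mono = ^-monoʳ-≤ κ {{>-nonZero (<⇒≤ 1<κ)}}

    κ₀^≤κ^ : ∀ a → κ₀ ^ a ≤ κ ^ a
    κ₀^≤κ^ a = ^-monoˡ-≤ a κ₀≤κ

    κκ₀^≤ : ∀ a → κ * κ₀ ^ a ≤ κ ^ suc a
    κκ₀^≤ a = *-monoʳ-≤ κ (κ₀^≤κ^ a)

    n : ℕ
    n = # B₀

    N≤n : N ≤ κ₀ * n
    N≤n = N≤Bₓ x₀ x₀∈X

    B₀>0 : 0 < n
    B₀>0 = n≢0⇒n>0 λ eq → <⇒≱ A>0 (≤-trans N≤n (≤-reflexive (trans (cong (κ₀ *_) eq) (*-zeroʳ κ₀))))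

    B₀-B₀≤ : # (B₀ ⊟ B₀) ≤ κ₀ ^ 17 * N
    B₀-B₀≤ = cancel-≤ A>0 (≤-trans B₀-B₀ (≤-reflexive (OutcomeIdentities.B-B-identity κ₀ N)))

    B₀-xB₀≤ : ∀ {x} → Y ∋ x → # (B₀ ⊟ x ⊙ B₀) ≤ κ * κ₀ ^ 36 * N
    B₀-xB₀≤ {x} x∈Y = cancel-≤ {N * N} (*-mono-≤ A>0 A>0) (≤-trans (B₀-xB₀ x∈Y)
      (≤-trans (*-monoʳ-≤ (2 * c₀) (*-monoʳ-≤ (D * D) B₀-B₀≤)) (≤-reflexive (OutcomeIdentities.B-xB-identity κ₀ N))))

    -- Two factors beyond κ³⁷ are spent, one on N ≤ κn and one on 4 ≤ κ; hence μ = κ³⁹.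
    weaken : ∀ {a s} → a ≤ 37 → s ≤ κ ^ a * N → 4 * s ≤ μ * n
    weaken {a} {s} a≤37 h = begin
      4 * s
        ≤⟨ *-mono-≤ 4≤κ (≤-trans h (*-mono-≤ (κ^-mono a≤37) (≤-trans N≤n (*-monoˡ-≤ n κ₀≤κ)))) ⟩
      κ * (κ ^ 37 * (κ * n))
        ≡⟨ l1 κ (κ ^ 37) n ⟩
      κ * (κ * κ ^ 37) * n ∎
      where
      l1 : ∀ k a n → k * (a * (k * n)) ≡ k * (k * a) * n
      l1 = solve-∀

    B-B-small : 4 * # (B₀ ⊟ B₀) ≤ μ * n
    B-B-small = weaken {17} (m≤m+n 17 20) (≤-trans B₀-B₀≤ (*-monoˡ-≤ N (κ₀^≤κ^ 17)))

    B-xB-small : ∀ {x} → Y ∋ x → 4 * # (B₀ ⊟ x ⊙ B₀) ≤ μ * n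
    B-xB-small x∈Y = weaken {37} ≤-refl (≤-trans (B₀-xB₀≤ x∈Y) (*-monoˡ-≤ N (κκ₀^≤ 36)))

    2c₀≤κ^4 : 2 * c₀ ≤ κ ^ 4
    2c₀≤κ^4 = ≤-trans (≤-reflexive (OutcomeIdentities.four-identity κ₀)) (κκ₀^≤ 3)

    X≤κ^4Y : # X ≤ κ ^ 4 * # Y
    X≤κ^4Y = ≤-trans X≤Y (*-monoˡ-≤ (# Y) 2c₀≤κ^4)

    μ^>0 : ∀ a → 0 < μ ^ a
    μ^>0 a = m^n>0 μ {{>-nonZero (m^n>0 κ {{>-nonZero (<⇒≤ 1<κ)}} 39)}} a

    -- Since |X| ≤ κ⁴|Y|, the fifth factor κ in `X-large` makes the inequality strict.
    Y-large : μ ^ 36 < # Y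
    Y-large = ≰⇒> λ Y≤ → <⇒≱ (*-monoˡ-< (μ ^ 36) {{>-nonZero (μ^>0 36)}}
        (≤-trans (s≤s (≤-reflexive (sym (*-identityˡ (κ ^ 4))))) (*-monoˡ-< (κ ^ 4) {{m^n≢0 κ 4 {{>-nonZero (<⇒≤ 1<κ)}}}} 1<κ)))
      (≤-trans X-large (≤-trans X≤κ^4Y (*-monoʳ-≤ (κ ^ 4) Y≤)))

    μ>1 : 1 < μ
    μ>1 = ≤-trans 1<κ (≤-trans (≤-reflexive (sym (*-identityʳ κ))) (κ^-mono {1} {39} (m≤m+n 1 38)))

    open InvariantSubspace C B₀ B₀>0 Y μ B-B-small B-xB-small Y-large μ>1

    ā : Fin q
    ā = proj₁ base-in-V

    n≤A₁ : n ≤ # (restrict V (λ v → A ∋? (v ⊕ ā))) * μ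
    n≤A₁ = ≤-trans (proj₂ (proj₂ base-in-V)) (*-monoˡ-≤ μ
      (#-translate {restrict B₀ λ b → V ∋? (b ⊝ ā)} {restrict V (λ v → A ∋? (v ⊕ ā))} ā
        λ {b} p → proj₂ p , subst (A ∋_) (sym (a⊝b⊕b≡a b ā)) (Bₓ⊑A x₀ (proj₁ p))))

    outcome : Outcome C A X κ
    outcome = record
      { ā = ā ; x₀ = x₀ ; R = R ; V = V ; Y = Y
      ; ā∈A = Bₓ⊑A x₀ (proj₁ (proj₂ base-in-V)) ; x₀∈X = x₀∈X
      ; R∋0 = R∋0 ; R∋1 = R∋1 ; R-⊕ = R-⊕ ; R-⊖ = R-⊖ ; R-⊗ = R-⊗ ; R-inv = R-inv
      ; V∋0 = V∋0 ; V-⊕ = V-⊕ ; V-scale = V-scale ; Y⊑R = Y⊑R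
      ; Y⊑x₀⁻¹X = λ { (ξ , ξ∈ , eq) → ξ , proj₁ ξ∈ , eq }
      ; A₁-large = ≤-trans N≤n (≤-trans (*-mono-≤ κ₀≤κ n≤A₁) (≤-reflexive (l1 κ A₁# μ)))
      ; V-small = ≤-trans V-size (≤-trans (*-monoʳ-≤ (μ ^ 10) n≤A₁) (≤-reflexive (l2 (μ ^ 10) A₁# μ)))
      ; Y-large = X≤κ^4Y
      }
      where
      A₁# = # (restrict V (λ v → A ∋? (v ⊕ ā)))
      l1 : ∀ k a m → k * (a * m) ≡ k * m * a
      l1 = solve-∀
      l2 : ∀ p a m → p * (a * m) ≡ m * p * a
      l2 = solve-∀

  open import Defs using (FiniteField; module Field)
  import Algebra.Morphism.RingMonomorphism as RingMonomorphism
  open import Algebra.Morphism.Structures using (IsRingMonomorphism)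
  open import Data.Fin.Subset using (Subset; ⁅_⁆; ⋃; ∣_∣; inside; outside; _⊆_; _∩_; Nonempty) renaming (_∈_ to _∈ˢ_)
  open import Data.Fin.Subset.Properties
    using (_∈?_; _⊆?_; x∈⁅x⁆; x∈p∪q⁺; x∈p∩q⁺; anySubset?; p⊆q⇒∣p∣≤∣q∣)
  open import Data.List.Base using (List; []; _∷_; map; filter; length; cartesianProduct; allFin; tabulate)
  open import Data.List.Membership.Propositional using () renaming (_∈_ to _∈ᴸ_)
  open import Data.List.Membership.Propositional.Properties using (∈-map⁺; ∈-filter⁺; ∈-allFin)
  open import Data.List.Properties using (filter-++; length-++)
  open import Data.List.Relation.Unary.Any using (here; there)
  import Data.Nat.ListAction as List
  import Data.Vec.Base as Vec
  import Data.Vec.Properties as Vec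
  open import Function.Bundles using (Inverse)
  open import Relation.Nullary.Decidable using (does; proof; map′; dec-true; _→-dec_)
  open import Relation.Nullary.Reflects using (Reflects; invert)
  open import Relation.Unary using (Decidable)

  -- From enumerated fields to codes

  module _ {a} {A : Set a} where

    length-filter : ∀ {p} {P : A → Set p} (P? : Decidable P) xs →
                    length (filter P? xs) ≡ List.sum (map (λ x → ι (P? x)) xs)
    length-filter P? [] = refl
    length-filter P? (x ∷ xs) with P? x
    ... | yes _ = cong suc (length-filter P? xs)
    ... | no _  = length-filter P? xs

    length-filter-map : ∀ {b p} {B : Set b} {P : A → Set p} (P? : Decidable P) (f : B → A) ys →
                        length (filter P? (map f ys)) ≡ length (filter (λ y → P? (f y)) ys)
    length-filter-map P? f [] = refl
    length-filter-map P? f (y ∷ ys) with P? (f y)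
    ... | yes _ = cong suc (length-filter-map P? f ys)
    ... | no _  = length-filter-map P? f ys

    listsum-cong : ∀ {f g : A → ℕ} → (∀ x → f x ≡ g x) → ∀ xs → List.sum (map f xs) ≡ List.sum (map g xs)
    listsum-cong h []       = refl
    listsum-cong h (x ∷ xs) = cong₂ _+_ (h x) (listsum-cong h xs)

  length-filter-× : ∀ {a b p} {A : Set a} {B : Set b} {P : A × B → Set p} (P? : Decidable P) xs ys →
    length (filter P? (cartesianProduct xs ys)) ≡
    List.sum (map (λ x → length (filter (λ y → P? (x , y)) ys)) xs)
  length-filter-× P? []       ys = refl
  length-filter-× P? (x ∷ xs) ys = trans
    (trans (cong length (filter-++ P? (map (x ,_) ys) _)) (length-++ (filter P? (map (x ,_) ys))))
    (cong₂ _+_ (length-filter-map P? (x ,_) ys) (length-filter-× P? xs ys))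

  opaque
    unfolding sum ∑∈ #_

    sum-filter-tabulate : ∀ {n a p} {A : Set a} {P : A → Set p} (P? : Decidable P) (g : A → ℕ) (h : Fin n → A) →
      List.sum (map g (filter P? (tabulate h))) ≡ sum (λ i → ι (P? (h i)) * g (h i))
    sum-filter-tabulate {zero}  P? g h = refl
    sum-filter-tabulate {suc n} P? g h with P? (h zero)
    ... | yes _ = cong₂ _+_ (sym (+-identityʳ _)) (sum-filter-tabulate P? g (h ∘ suc))
    ... | no _  = sum-filter-tabulate P? g (h ∘ suc)

    ι-map′ : ∀ {a b} {A : Set a} {B : Set b} {f : A → B} {g : B → A} (d : Dec A) → ι (map′ f g d) ≡ ι d
    ι-map′ (yes _) = refl
    ι-map′ (no _)  = refl

    ⟦_⟧ : ∀ {q} → Subset q → FSet q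
    ⟦ S ⟧ = mkF (_∈ˢ S) (_∈? S)

    #⟦⟧ : ∀ {q} (S : Subset q) → # ⟦ S ⟧ ≡ ∣ S ∣
    #⟦⟧ Vec.[] = refl
    #⟦⟧ (inside  Vec.∷ S) = cong suc (trans (sum-cong-≗ λ i → ι-map′ (i ∈? S)) (#⟦⟧ S))
    #⟦⟧ (outside Vec.∷ S) = trans (sum-cong-≗ λ i → ι-map′ (i ∈? S)) (#⟦⟧ S)

    ⟦⟧∋⇒∈ : ∀ {q} {S : Subset q} {i} → ⟦ S ⟧ ∋ i → i ∈ˢ S
    ⟦⟧∋⇒∈ h = h

    ∈⇒⟦⟧∋ : ∀ {q} {S : Subset q} {i} → i ∈ˢ S → ⟦ S ⟧ ∋ i
    ∈⇒⟦⟧∋ h = h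

  opaque

    subset : ∀ {q} → FSet q → Subset q
    subset F = Vec.tabulate λ i → does (F ∋? i)

    ∈-subset⁺ : ∀ {q} (F : FSet q) {i} → F ∋ i → i ∈ˢ subset F
    ∈-subset⁺ F {i} h = Vec.lookup⇒[]= i _ (trans (Vec.lookup∘tabulate _ i) (dec-true (F ∋? i) h))

    ∈-subset⁻ : ∀ {q} (F : FSet q) {i} → i ∈ˢ subset F → F ∋ i
    ∈-subset⁻ F {i} h = invert (subst (λ b → Reflects (F ∋ i) b)
      (trans (sym (Vec.lookup∘tabulate _ i)) (Vec.[]=⇒lookup h)) (proof (F ∋? i)))

  ∣subset∣ : ∀ {q} (F : FSet q) → ∣ subset F ∣ ≡ # F
  ∣subset∣ F = trans (sym (#⟦⟧ (subset F))) (≤-antisym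
    (#-mono {S = ⟦ subset F ⟧} {F} (∈-subset⁻ F ∘ ⟦⟧∋⇒∈))
    (#-mono {S = F} {⟦ subset F ⟧} (∈⇒⟦⟧∋ ∘ ∈-subset⁺ F)))

  ∈-⋃⁺ : ∀ {q} {S : Subset q} {Ss} {i} → S ∈ᴸ Ss → i ∈ˢ S → i ∈ˢ ⋃ Ss
  ∈-⋃⁺ (here refl) i∈S = x∈p∪q⁺ (inj₁ i∈S)
  ∈-⋃⁺ (there S∈)  i∈S = x∈p∪q⁺ (inj₂ (∈-⋃⁺ S∈ i∈S))

  module Codes {q : ℕ} (𝔽 : FiniteField q) where
    open Field 𝔽 using (elements; image; _≈?_; E; ∑E)
    open FiniteField 𝔽 using (Carrier; _≈_; _⁻¹; inverseʳ; enumeration; code; decode)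
      renaming (commutativeRing to 𝔽-ring; _+_ to _+ᶠ_; _·_ to _·ᶠ_; -_ to -ᶠ_; _-_ to _-ᶠ_; 0# to 0ᶠ; 1# to 1ᶠ)
    private module F = CommutativeRing 𝔽-ring

    decode-code : ∀ x → decode (code x) ≈ x
    decode-code = Inverse.strictlyInverseʳ enumeration

    code-decode : ∀ i → code (decode i) ≡ i
    code-decode = Inverse.strictlyInverseˡ enumeration

    code-cong : ∀ {x y} → x ≈ y → code x ≡ code y
    code-cong = Inverse.to-cong enumeration

    codeRing : RawRing 0ℓ 0ℓ
    codeRing = record
      { Carrier = Fin q ; _≈_ = _≡_
      ; _+_ = λ i j → code (decode i +ᶠ decode j)
      ; _*_ = λ i j → code (decode i ·ᶠ decode j)
      ; -_ = λ i → code (-ᶠ decode i)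
      ; 0# = code 0ᶠ ; 1# = code 1ᶠ }

    decode-monomorphism : IsRingMonomorphism codeRing F.rawRing decode
    decode-monomorphism = record
      { isRingHomomorphism = record
        { isSemiringHomomorphism = record
          { isNearSemiringHomomorphism = record
            { +-isMonoidHomomorphism = record
              { isMagmaHomomorphism = record
                { isRelHomomorphism = record { cong = λ { refl → F.refl } }
                ; homo = λ _ _ → decode-code _ }
              ; ε-homo = decode-code _ }
            ; *-homo = λ _ _ → decode-code _ }
          ; 1#-homo = decode-code _ }
        ; -‿homo = λ _ → decode-code _ }
      ; injective = λ {i} {j} eq → trans (sym (code-decode i)) (trans (code-cong eq) (code-decode j)) }

    codeField : CodeField q
    codeField = record
      { _⊕_ = RawRing._+_ codeRing ; _⊗_ = RawRing._*_ codeRing ; ⊖_ = RawRing.-_ codeRing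
      ; invˢ = λ i → code (decode i ⁻¹) ; 𝟘 = code 0ᶠ ; 𝟙 = code 1ᶠ
      ; isCommutativeRing = RingMonomorphism.isCommutativeRing decode-monomorphism F.isCommutativeRing
      ; ⊗-inverse = λ i i≢0 → code-cong (F.trans (F.*-congˡ (decode-code _))
          (inverseʳ (decode i) λ eq → i≢0 (trans (sym (code-decode i)) (code-cong eq)))) }

    open Combinatorics codeField

    code-+ : ∀ x y → code (x +ᶠ y) ≡ code x ⊕ code y
    code-+ x y = code-cong (F.+-cong (F.sym (decode-code x)) (F.sym (decode-code y)))

    code-· : ∀ x y → code (x ·ᶠ y) ≡ code x ⊗ code y
    code-· x y = code-cong (F.*-cong (F.sym (decode-code x)) (F.sym (decode-code y)))

    code-neg : ∀ x → code (-ᶠ x) ≡ ⊖ code x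
    code-neg x = code-cong (F.-‿cong (F.sym (decode-code x)))

    code-⊝ : ∀ x y → code (x -ᶠ y) ≡ code x ⊝ code y
    code-⊝ x y = trans (code-+ x (-ᶠ y)) (cong (code x ⊕_) (code-neg y))

    ∈-image⁺ : ∀ (f : Carrier → Carrier) {S i c} → i ∈ˢ S → c ≡ code (f (decode i)) → c ∈ˢ image f S
    ∈-image⁺ f {S} {i} i∈S refl = ∈-⋃⁺
      (∈-map⁺ (λ x → ⁅ code (f x) ⁆) (∈-map⁺ decode (∈-filter⁺ (_∈? S) (∈-allFin i) i∈S)))
      (x∈⁅x⁆ _)

    opaque
      unfolding ∑∈ ⟦_⟧

      sum-elements : ∀ (g : Carrier → ℕ) S → List.sum (map g (elements S)) ≡ ∑∈ ⟦ S ⟧ (g ∘ decode)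
      sum-elements g S = trans (lemma (filter (_∈? S) (allFin q)))
          (sum-filter-tabulate (_∈? S) (g ∘ decode) id)
        where
        lemma : ∀ xs → List.sum (map g (map decode xs)) ≡ List.sum (map (g ∘ decode) xs)
        lemma []       = refl
        lemma (x ∷ xs) = cong (g (decode x) +_) (lemma xs)

    ∑E≡ : ∀ A X → ∑E A X ≡ ∑∈ ⟦ X ⟧ (E A ∘ decode)
    ∑E≡ A X = sum-elements (E A) X

    E≡ : ∀ A ξ → E A ξ ≡ ∑∈ ⟦ A ⟧ λ a₁ → ∑∈ ⟦ A ⟧ λ a₂ → ∑∈ ⟦ A ⟧ λ a₃ → ∑∈ ⟦ A ⟧ λ a₄ →
           ι ((decode a₁ -ᶠ decode a₂) ≈? (ξ ·ᶠ (decode a₃ -ᶠ decode a₄)))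
    E≡ A ξ =
      trans (trans (length-filter-× _ as _) (sum-elements _ A)) (∑∈-cong ⟦ A ⟧ λ a₁ →
      trans (trans (length-filter-× _ as _) (sum-elements _ A)) (∑∈-cong ⟦ A ⟧ λ a₂ →
      trans (trans (length-filter-× _ as as) (sum-elements _ A)) (∑∈-cong ⟦ A ⟧ λ a₃ →
      trans (length-filter _ as) (sum-elements _ A))))
      where
      as : List Carrier
      as = elements A

  module Bridge {q : ℕ} (𝔽 : FiniteField q) where
    open Codes 𝔽
    open Combinatorics codeField
    open Field 𝔽 using (E; _≈?_; IsSubfield; IsSubspace; IsSubfieldGeneratedBy; IsSubspaceGeneratedBy; _-ˢ_; _·ˢ_)
      renaming (_∈_ to _∈ᶠ_)
    open FiniteField 𝔽 using (Carrier; _≈_; _≉_; _⁻¹; code; decode)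
      renaming (commutativeRing to 𝔽-ring; _·_ to _·ᶠ_; _-_ to _-ᶠ_; 0# to 0ᶠ)
    private module F = CommutativeRing 𝔽-ring

    ∑∈-unique : ∀ (S : FSet q) {P : Fin q → Set} (P? : ∀ a → Dec (P a)) c → (∀ {a} → P a → a ≡ c) →
                ∑∈ S (λ a → ι (P? a)) ≤ ι (S ∋? c)
    ∑∈-unique S {P} P? c h = ≤-trans (≤-reflexive (∑∈-restrict S P?)) (case (S ∋? c))
      where
      S∩P : FSet q
      S∩P = restrict S P?
      case : (d : Dec (S ∋ c)) → # S∩P ≤ ι d
      case (yes _)   = #-delta S∩P λ p r → trans (h (proj₂ p)) (sym (h (proj₂ r)))
      case (no c∉S) = ≮⇒≥ λ S∩P>0 → let (a , a∈S , p) = #>0⇒∃ S∩P S∩P>0 in c∉S (subst (S ∋_) (h p) a∈S)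

    module _ (A : Subset q) (A>0 : 0 < # ⟦ A ⟧) (k : ℕ) (k>0 : 0 < k) where

      private module BSG = BalogSzemerédiGowers codeField ⟦ A ⟧ A>0 k k>0

      -- The equation determines a₂ = a₁ - ξa₃ + ξa₄, so summing over a₂ leaves the indicator that
      -- this element lies in A.
      E≤energy : ∀ i → E A (decode i) ≤ BSG.energy i
      E≤energy i = begin
        E A (decode i)
          ≡⟨ E≡ A (decode i) ⟩
        (∑∈ ⟦ A ⟧ λ a₁ → ∑∈ ⟦ A ⟧ λ a₂ → ∑∈ ⟦ A ⟧ λ a₃ → ∑∈ ⟦ A ⟧ λ a₄ → e a₁ a₂ a₃ a₄)
          ≡⟨ ∑∈-cong ⟦ A ⟧ (λ a₁ → trans (∑∈-swap ⟦ A ⟧ ⟦ A ⟧ _) (∑∈-cong ⟦ A ⟧ λ a₃ → ∑∈-swap ⟦ A ⟧ ⟦ A ⟧ _)) ⟩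
        (∑∈ ⟦ A ⟧ λ a₁ → ∑∈ ⟦ A ⟧ λ a₃ → ∑∈ ⟦ A ⟧ λ a₄ → ∑∈ ⟦ A ⟧ λ a₂ → e a₁ a₂ a₃ a₄)
          ≤⟨ ∑∈-mono ⟦ A ⟧ (λ {a₁} _ → ∑∈-mono ⟦ A ⟧ λ {a₃} _ → ∑∈-mono ⟦ A ⟧ λ {a₄} _ →
               ∑∈-unique ⟦ A ⟧ (λ a₂ → (decode a₁ -ᶠ decode a₂) ≈? (decode i ·ᶠ (decode a₃ -ᶠ decode a₄))) _ (solution a₁ a₃ a₄)) ⟩
        BSG.energy i ∎
        where
        e : Fin q → Fin q → Fin q → Fin q → ℕ
        e a₁ a₂ a₃ a₄ = ι ((decode a₁ -ᶠ decode a₂) ≈? (decode i ·ᶠ (decode a₃ -ᶠ decode a₄)))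
        code-difference : ∀ a b → code (decode a -ᶠ decode b) ≡ a ⊝ b
        code-difference a b = trans (code-⊝ (decode a) (decode b)) (cong₂ _⊝_ (code-decode a) (code-decode b))
        solution : ∀ a₁ a₃ a₄ {a₂} → (decode a₁ -ᶠ decode a₂) ≈ (decode i ·ᶠ (decode a₃ -ᶠ decode a₄)) →
                   a₂ ≡ a₁ ⊝ i ⊗ a₃ ⊕ i ⊗ a₄
        solution a₁ a₃ a₄ {a₂} eq = trans (sym (a⊝[a⊝b]≡b a₁ a₂)) (trans (cong (a₁ ⊝_)
            (trans (sym (code-difference a₁ a₂)) (trans (code-cong eq)
              (trans (code-· (decode i) (decode a₃ -ᶠ decode a₄)) (cong₂ _⊗_ (code-decode i) (code-difference a₃ a₄))))))
          (solve 4 (λ a₁ i a₃ a₄ → a₁ :- i :* (a₃ :- a₄) := a₁ :- i :* a₃ :+ i :* a₄) refl a₁ i a₃ a₄))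

      energy≤N³ : ∀ i → BSG.energy i ≤ # ⟦ A ⟧ * # ⟦ A ⟧ * # ⟦ A ⟧
      energy≤N³ i = ≤-trans (∑∈-mono ⟦ A ⟧ λ _ → ∑∈-mono ⟦ A ⟧ λ _ → BSG.reps≤N i _)
        (≤-reflexive (trans (∑∈-cong ⟦ A ⟧ λ _ → ∑∈-const ⟦ A ⟧ _) (trans (∑∈-const ⟦ A ⟧ _) (sym (*-assoc (# ⟦ A ⟧) _ _)))))

    -- The intersection of all G ⊇ S with 𝒫 G, decidable since there are finitely many.
    module Closure (𝒫 : Subset q → Set) (𝒫? : ∀ G → Dec (𝒫 G)) (S : Subset q) where

      Excluding : Fin q → Subset q → Set
      Excluding c G = 𝒫 G × S ⊆ G × ¬ (c ∈ˢ G)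

      closure : Subset q
      closure = subset (mkF (λ c → ¬ (∃[ G ] Excluding c G))
        (λ c → ¬? (anySubset? λ G → 𝒫? G ×-dec (S ⊆? G) ×-dec ¬? (c ∈? G))))

      ∈-closure⁺ : ∀ {c} → (∀ {G} → 𝒫 G → S ⊆ G → c ∈ˢ G) → c ∈ˢ closure
      ∈-closure⁺ h = ∈-subset⁺ _ λ { (_ , p , s , c∉) → c∉ (h p s) }

      ∈-closure⁻ : ∀ {c} → c ∈ˢ closure → ∀ {G} → 𝒫 G → S ⊆ G → c ∈ˢ G
      ∈-closure⁻ {c} c∈ {G} p s = decidable-stable (c ∈? G) λ c∉ → ∈-subset⁻ _ c∈ (G , p , s , c∉)

    -- All quantifiers range over the finite type of codes, which makes the property decidable, as
    -- the intersection in `Closure` requires.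
    CodeSubfield : Subset q → Set
    CodeSubfield G = 𝟘 ∈ˢ G × 𝟙 ∈ˢ G × (∀ a b → a ∈ˢ G → b ∈ˢ G → (a ⊕ b) ∈ˢ G) × (∀ a → a ∈ˢ G → (⊖ a) ∈ˢ G) ×
      (∀ a b → a ∈ˢ G → b ∈ˢ G → (a ⊗ b) ∈ˢ G) × (∀ a → a ≢ 𝟘 → a ∈ˢ G → invˢ a ∈ˢ G)

    codeSubfield? : ∀ G → Dec (CodeSubfield G)
    codeSubfield? G = (𝟘 ∈? G) ×-dec (𝟙 ∈? G) ×-dec
      (Fin.all? λ a → Fin.all? λ b → (a ∈? G) →-dec ((b ∈? G) →-dec ((a ⊕ b) ∈? G))) ×-dec
      (Fin.all? λ a → (a ∈? G) →-dec ((⊖ a) ∈? G)) ×-dec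
      (Fin.all? λ a → Fin.all? λ b → (a ∈? G) →-dec ((b ∈? G) →-dec ((a ⊗ b) ∈? G))) ×-dec
      (Fin.all? λ a → ¬? (a Fin.≟ 𝟘) →-dec ((a ∈? G) →-dec (invˢ a ∈? G)))

    CodeSubspace : Subset q → Subset q → Set
    CodeSubspace F W = 𝟘 ∈ˢ W × (∀ a b → a ∈ˢ W → b ∈ˢ W → (a ⊕ b) ∈ˢ W) ×
      (∀ c a → c ∈ˢ F → a ∈ˢ W → (c ⊗ a) ∈ˢ W)

    codeSubspace? : ∀ F W → Dec (CodeSubspace F W)
    codeSubspace? F W = (𝟘 ∈? W) ×-dec
      (Fin.all? λ a → Fin.all? λ b → (a ∈? W) →-dec ((b ∈? W) →-dec ((a ⊕ b) ∈? W))) ×-dec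
      (Fin.all? λ c → Fin.all? λ a → (c ∈? F) →-dec ((a ∈? W) →-dec ((c ⊗ a) ∈? W)))

    decode-∈ : ∀ {G a} → a ∈ˢ G → decode a ∈ᶠ G
    decode-∈ {G} {a} = subst (_∈ˢ G) (sym (code-decode a))

    -- The operation `_⁻¹` is not assumed to respect ≈, so x ⁻¹ and (decode (code x)) ⁻¹ are
    -- identified by uniqueness of inverses.
    code-inverse : ∀ {x} → x ≉ 0ᶠ → code (x ⁻¹) ≡ invˢ (code x)
    code-inverse {x} x≉0 = ⊗-cancelˡ x≢𝟘 (trans (trans (sym (code-· x (x ⁻¹))) (code-cong (FiniteField.inverseʳ 𝔽 x x≉0)))
        (sym (⊗-inverse (code x) x≢𝟘)))
      where
      x≢𝟘 : code x ≢ 𝟘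
      x≢𝟘 eq = x≉0 (F.trans (F.sym (decode-code x))
        (F.trans (F.reflexive (cong decode eq)) (decode-code 0ᶠ)))

    code-≢𝟘 : ∀ {a} → a ≢ 𝟘 → decode a ≉ 0ᶠ
    code-≢𝟘 {a} a≢0 eq = a≢0 (trans (sym (code-decode a)) (code-cong eq))

    isSubfield⁺ : ∀ {G} → CodeSubfield G → IsSubfield G
    isSubfield⁺ {G} (z , o , p , n , m , i) = record
      { 0∈ = z ; 1∈ = o
      ; +-closed = λ {x} {y} x∈ y∈ → subst (_∈ˢ G) (sym (code-+ x y)) (p _ _ x∈ y∈)
      ; neg-closed = λ {x} x∈ → subst (_∈ˢ G) (sym (code-neg x)) (n _ x∈)
      ; ·-closed = λ {x} {y} x∈ y∈ → subst (_∈ˢ G) (sym (code-· x y)) (m _ _ x∈ y∈)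
      ; ⁻¹-closed = λ {x} x≉0 x∈ → subst (_∈ˢ G) (sym (code-inverse x≉0)) (i _ (λ eq → x≉0 (F.trans (F.sym (decode-code x))
          (F.trans (F.reflexive (cong decode eq)) (decode-code 0ᶠ)))) x∈) }

    isSubfield⁻ : ∀ {G} → IsSubfield G → CodeSubfield G
    isSubfield⁻ {G} s = S.0∈ , S.1∈ , (λ a b a∈ b∈ → S.+-closed (decode-∈ a∈) (decode-∈ b∈)) ,
      (λ a a∈ → S.neg-closed (decode-∈ a∈)) , (λ a b a∈ b∈ → S.·-closed (decode-∈ a∈) (decode-∈ b∈)) ,
      (λ a a≢0 a∈ → S.⁻¹-closed (code-≢𝟘 a≢0) (decode-∈ a∈))
      where module S = IsSubfield s

    isSubspace⁺ : ∀ {F W} → CodeSubspace F W → IsSubspace F W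
    isSubspace⁺ {F} {W} (z , p , m) = record
      { 0∈ = z
      ; +-closed = λ {x} {y} x∈ y∈ → subst (_∈ˢ W) (sym (code-+ x y)) (p _ _ x∈ y∈)
      ; ·-closed = λ {c} {x} c∈ x∈ → subst (_∈ˢ W) (sym (code-· c x)) (m _ _ c∈ x∈) }

    isSubspace⁻ : ∀ {F W} → IsSubspace F W → CodeSubspace F W
    isSubspace⁻ {F} {W} s = S.0∈ , (λ a b a∈ b∈ → S.+-closed (decode-∈ a∈) (decode-∈ b∈)) ,
      (λ c a c∈ a∈ → S.·-closed (decode-∈ c∈) (decode-∈ a∈))
      where module S = IsSubspace s

    generatedSubfield : Subset q → Subset q
    generatedSubfield = Closure.closure CodeSubfield codeSubfield?

    generatedSubfield-isGenerated : ∀ S → IsSubfieldGeneratedBy S (generatedSubfield S)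
    generatedSubfield-isGenerated S = record
      { isSubfield = isSubfield⁺
        ( ∈-closure⁺ (λ p _ → proj₁ p)
        , ∈-closure⁺ (λ p _ → proj₁ (proj₂ p))
        , (λ a b a∈ b∈ → ∈-closure⁺ λ p s → proj₁ (proj₂ (proj₂ p)) a b (∈-closure⁻ a∈ p s) (∈-closure⁻ b∈ p s))
        , (λ a a∈ → ∈-closure⁺ λ p s → proj₁ (proj₂ (proj₂ (proj₂ p))) a (∈-closure⁻ a∈ p s))
        , (λ a b a∈ b∈ → ∈-closure⁺ λ p s → proj₁ (proj₂ (proj₂ (proj₂ (proj₂ p)))) a b (∈-closure⁻ a∈ p s) (∈-closure⁻ b∈ p s))
        , (λ a a≢0 a∈ → ∈-closure⁺ λ p s → proj₂ (proj₂ (proj₂ (proj₂ (proj₂ p)))) a a≢0 (∈-closure⁻ a∈ p s)) )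
      ; contains = λ c∈S → ∈-closure⁺ λ _ s → s c∈S
      ; least = λ G isSub S⊆G c∈ → ∈-closure⁻ c∈ (isSubfield⁻ isSub) S⊆G }
      where open Closure CodeSubfield codeSubfield? S

    generatedSubspace : Subset q → Subset q → Subset q
    generatedSubspace F = Closure.closure (CodeSubspace F) (codeSubspace? F)

    generatedSubspace-isGenerated : ∀ F S → IsSubspaceGeneratedBy F S (generatedSubspace F S)
    generatedSubspace-isGenerated F S = record
      { isSubspace = isSubspace⁺
        ( ∈-closure⁺ (λ p _ → proj₁ p)
        , (λ a b a∈ b∈ → ∈-closure⁺ λ p s → proj₁ (proj₂ p) a b (∈-closure⁻ a∈ p s) (∈-closure⁻ b∈ p s))
        , (λ c a c∈ a∈ → ∈-closure⁺ λ p s → proj₂ (proj₂ p) c a c∈ (∈-closure⁻ a∈ p s)) )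
      ; contains = λ c∈S → ∈-closure⁺ λ _ s → s c∈S
      ; least = λ W isSub S⊆W c∈ → ∈-closure⁻ c∈ (isSubspace⁻ isSub) S⊆W }
      where open Closure (CodeSubspace F) (codeSubspace? F) S

    -- The conclusion with natural constants. The parameter x is the size of the part of X that was
    -- processed: all of X, or its energetic elements.
    record NaturalConclusion (A X : Subset q) (κ x : ℕ) : Set where
      field
        ā x₀         : Carrier
        F V A₁ X′    : Subset q
        ā∈A          : ā ∈ᶠ A
        x₀∈X         : x₀ ∈ᶠ X
        A₁⊆          : A₁ ⊆ (A -ˢ ā)
        X′⊆          : X′ ⊆ ((x₀ ⁻¹) ·ˢ X)
        F-generated  : IsSubfieldGeneratedBy X′ F
        V-generated  : IsSubspaceGeneratedBy F A₁ V
        A₁-large     : ∣ A ∣ ≤ κ * κ ^ 39 * ∣ A₁ ∣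
        V-small      : ∣ V ∣ ≤ (κ ^ 39) ^ 11 * ∣ A₁ ∣
        X′-large     : x ≤ κ ^ 4 * ∣ X′ ∣
        A₁≤V∩        : ∣ A₁ ∣ ≤ ∣ V ∩ (A -ˢ ā) ∣

    natural-conclusion : ∀ (A X : Subset q) κ (X₁ : FSet q) → X₁ ⊑ ⟦ X ⟧ → Outcome codeField ⟦ A ⟧ X₁ κ →
                         NaturalConclusion A X κ (# X₁)
    natural-conclusion A X κ X₁ X₁⊑X O = record
      { ā = decode O.ā ; x₀ = decode O.x₀ ; F = F ; V = V ; A₁ = A₁ ; X′ = X′
      ; ā∈A = decode-∈ (⟦⟧∋⇒∈ O.ā∈A)
      ; x₀∈X = decode-∈ (⟦⟧∋⇒∈ {S = X} (X₁⊑X O.x₀∈X))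
      ; A₁⊆ = A₁⊆
      ; X′⊆ = λ c∈ → X′⊆ (O.Y⊑x₀⁻¹X (∈-subset⁻ O.Y c∈))
      ; F-generated = generatedSubfield-isGenerated X′
      ; V-generated = generatedSubspace-isGenerated F A₁
      ; A₁-large = subst₂ (λ a b → a ≤ κ * κ ^ 39 * b) (#⟦⟧ A) (sym (∣subset∣ O.A₁)) O.A₁-large
      ; V-small = ≤-trans (≤-trans (p⊆q⇒∣p∣≤∣q∣ V⊆) (≤-reflexive (∣subset∣ O.V)))
          (subst (λ b → # O.V ≤ (κ ^ 39) ^ 11 * b) (sym (∣subset∣ O.A₁)) O.V-small)
      ; X′-large = subst (λ b → # X₁ ≤ κ ^ 4 * b) (sym (∣subset∣ O.Y)) O.Y-large
      ; A₁≤V∩ = p⊆q⇒∣p∣≤∣q∣ λ c∈ → x∈p∩q⁺ (IsSubspaceGeneratedBy.contains (generatedSubspace-isGenerated F A₁) c∈ , A₁⊆ c∈)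
      }
      where
      module O = Outcome O
      X′ F A₁ V : Subset q
      X′ = subset O.Y
      F = generatedSubfield X′
      A₁ = subset O.A₁
      V = generatedSubspace F A₁
      A₁⊆ : A₁ ⊆ (A -ˢ decode O.ā)
      A₁⊆ {c} c∈ = ∈-image⁺ (_-ᶠ decode O.ā) (⟦⟧∋⇒∈ (proj₂ (∈-subset⁻ O.A₁ c∈)))
        (sym (trans (code-⊝ _ _) (trans (cong₂ _⊝_ (code-decode _) (code-decode _)) (a⊕b⊝b≡a c O.ā))))
      X′⊆ : ∀ {c} → ∃[ ξ ] (X₁ ∋ ξ × c ≡ invˢ O.x₀ ⊗ ξ) → c ∈ˢ ((decode O.x₀ ⁻¹) ·ˢ X)
      X′⊆ {c} (ξ , ξ∈ , eq) = ∈-image⁺ (decode O.x₀ ⁻¹ ·ᶠ_) (⟦⟧∋⇒∈ {S = X} (X₁⊑X ξ∈))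
        (trans eq (sym (trans (code-· _ _) (cong (invˢ O.x₀ ⊗_) (code-decode ξ)))))
      subset-R : CodeSubfield (subset O.R)
      subset-R = ∈-subset⁺ O.R O.R∋0 , ∈-subset⁺ O.R O.R∋1 ,
        (λ a b a∈ b∈ → ∈-subset⁺ O.R (O.R-⊕ (∈-subset⁻ O.R a∈) (∈-subset⁻ O.R b∈))) ,
        (λ a a∈ → ∈-subset⁺ O.R (O.R-⊖ (∈-subset⁻ O.R a∈))) ,
        (λ a b a∈ b∈ → ∈-subset⁺ O.R (O.R-⊗ (∈-subset⁻ O.R a∈) (∈-subset⁻ O.R b∈))) ,
        (λ a a≢0 a∈ → ∈-subset⁺ O.R (O.R-inv a≢0 (∈-subset⁻ O.R a∈)))
      F⊆R : F ⊆ subset O.R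
      F⊆R c∈ = Closure.∈-closure⁻ CodeSubfield codeSubfield? X′ c∈ subset-R
        λ c∈X′ → ∈-subset⁺ O.R (O.Y⊑R (∈-subset⁻ O.Y c∈X′))
      -- Invariance under R gives invariance under F ⊆ R, so the F-subspace generated by A₁ stays
      -- inside `O.V`.
      subset-V : CodeSubspace F (subset O.V)
      subset-V = ∈-subset⁺ O.V O.V∋0 ,
        (λ a b a∈ b∈ → ∈-subset⁺ O.V (O.V-⊕ (∈-subset⁻ O.V a∈) (∈-subset⁻ O.V b∈))) ,
        (λ c a c∈ a∈ → ∈-subset⁺ O.V (O.V-scale (∈-subset⁻ O.R (F⊆R c∈)) (∈-subset⁻ O.V a∈)))
      V⊆ : V ⊆ subset O.V
      V⊆ c∈ = Closure.∈-closure⁻ (CodeSubspace F) (codeSubspace? F) A₁ c∈ subset-V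
        λ c∈A₁ → ∈-subset⁺ O.V (proj₁ (∈-subset⁻ O.A₁ c∈A₁))

  module Natural {q : ℕ} (𝔽 : FiniteField q) (A X : Subset q) (A≠∅ : Nonempty A) (X≠∅ : Nonempty X)
                 (0∉X : ¬ (Field._∈_ 𝔽 (FiniteField.0# 𝔽) X)) (K₀ : ℕ) (K₀>0 : 0 < K₀) where
    open Codes 𝔽
    open Bridge 𝔽
    open Combinatorics codeField using (𝟘)
    open Field 𝔽 using (E; ∑E) renaming (_∈_ to _∈ᶠ_)
    open FiniteField 𝔽 using (decode)

    k κ : ℕ
    -- Here 10 = 5 · 2: `dense-edges` asks for 5N³, and an element of X₁ is only known to have
    -- energy N³/(2K₀).
    k = 10 * K₀
    κ = 2 * (2 * k)

    k>0 : 0 < k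
    k>0 = ≤-trans K₀>0 (m≤n*m K₀ 10)

    κ>0 : 0 < κ
    κ>0 = ≤-trans k>0 (≤-trans (m≤n*m k 2) (m≤n*m (2 * k) 2))

    A>0 : 0 < # ⟦ A ⟧
    A>0 = ∋⇒#>0 ⟦ A ⟧ (∈⇒⟦⟧∋ (proj₂ A≠∅))

    X>0 : 0 < # ⟦ X ⟧
    X>0 = ∋⇒#>0 ⟦ X ⟧ (∈⇒⟦⟧∋ (proj₂ X≠∅))

    N³ : ℕ
    N³ = # ⟦ A ⟧ * # ⟦ A ⟧ * # ⟦ A ⟧

    ∣A∣³≡N³ : ∣ A ∣ ^ 3 ≡ N³
    ∣A∣³≡N³ = trans (cong (_^ 3) (sym (#⟦⟧ A))) (l1 (# ⟦ A ⟧))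
      where
      l1 : ∀ n → n * (n * (n * 1)) ≡ n * n * n
      l1 = solve-∀

    nonzero : ∀ {i} → ⟦ X ⟧ ∋ i → i ≢ 𝟘
    nonzero i∈X refl = 0∉X (⟦⟧∋⇒∈ i∈X)

    energetic : ∀ i → N³ ≤ 2 * K₀ * E A (decode i) →
                5 * N³ ≤ k * BalogSzemerédiGowers.energy codeField ⟦ A ⟧ A>0 k k>0 i
    energetic i h = begin
      5 * N³
        ≤⟨ *-monoʳ-≤ 5 h ⟩
      5 * (2 * K₀ * E A (decode i))
        ≡⟨ l1 K₀ (E A (decode i)) ⟩
      k * E A (decode i)
        ≤⟨ *-monoʳ-≤ k (E≤energy A A>0 k k>0 i) ⟩
      k * _ ∎
      where
      l1 : ∀ k e → 5 * (2 * k * e) ≡ 10 * k * e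
      l1 = solve-∀

    from-pointwise : κ ^ 5 * (κ ^ 39) ^ 36 ≤ ∣ X ∣ → (∀ ξ → ξ ∈ᶠ X → ∣ A ∣ ^ 3 ≤ K₀ * E A ξ) →
                     NaturalConclusion A X κ ∣ X ∣
    from-pointwise X-large h = subst (NaturalConclusion A X κ) (#⟦⟧ X) (natural-conclusion A X κ ⟦ X ⟧ id
      (Extraction.outcome codeField ⟦ A ⟧ A>0 k k>0 ⟦ X ⟧ X>0
        (λ {i} i∈X → nonzero i∈X , energetic i (≤-trans (≤-reflexive (sym ∣A∣³≡N³))
          (≤-trans (h (decode i) (decode-∈ (⟦⟧∋⇒∈ i∈X))) (*-monoˡ-≤ (E A (decode i)) (m≤n*m K₀ 2)))))
        (≤-trans X-large (≤-reflexive (sym (#⟦⟧ X))))))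

    X₁ : FSet q
    X₁ = restrict ⟦ X ⟧ λ i → N³ ≤? E A (decode i) * (2 * K₀)

    X≤X₁ : ∣ A ∣ ^ 3 * ∣ X ∣ ≤ K₀ * ∑E A X → ∣ X ∣ ≤ 2 * K₀ * # X₁
    X≤X₁ h = cancel-≤ {N³} (*-mono-≤ (*-mono-≤ A>0 A>0) A>0) (double-cancel (begin
      2 * (N³ * ∣ X ∣)
        ≤⟨ *-monoʳ-≤ 2 (subst (λ c → c * ∣ X ∣ ≤ K₀ * ∑E A X) ∣A∣³≡N³ h) ⟩
      2 * (K₀ * ∑E A X)
        ≡⟨ trans (sym (*-assoc 2 K₀ _)) (cong (2 * K₀ *_) (∑E≡ A X)) ⟩
      2 * K₀ * ∑∈ ⟦ X ⟧ (E A ∘ decode)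
        ≤⟨ popular₁ ⟦ X ⟧ (E A ∘ decode) N³ (2 * K₀)
             (λ {i} _ → ≤-trans (E≤energy A A>0 k k>0 i) (energy≤N³ A A>0 k k>0 i)) ⟩
      2 * K₀ * N³ * # X₁ + # ⟦ X ⟧ * N³
        ≡⟨ cong (λ x → 2 * K₀ * N³ * # X₁ + x * N³) (#⟦⟧ X) ⟩
      2 * K₀ * N³ * # X₁ + ∣ X ∣ * N³
        ≡⟨ l1 (2 * K₀) N³ (# X₁) ∣ X ∣ ⟩
      N³ * (2 * K₀ * # X₁) + N³ * ∣ X ∣ ∎))
      where
      l1 : ∀ k n x y → k * n * x + y * n ≡ n * (k * x) + n * y
      l1 = solve-∀

    X≤κX₁ : ∣ A ∣ ^ 3 * ∣ X ∣ ≤ K₀ * ∑E A X → ∣ X ∣ ≤ κ * # X₁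
    X≤κX₁ h = ≤-trans (X≤X₁ h) (*-monoˡ-≤ (# X₁) (≤-trans (m≤n*m (2 * K₀) 20) (≤-reflexive (l1 K₀))))
      where
      l1 : ∀ k → 20 * (2 * k) ≡ 2 * (2 * (10 * k))
      l1 = solve-∀

    -- The additional κ pays for replacing X by X₁; it is also the difference between the exponents
    -- 5 and 4 in the bounds on X′.
    from-average : κ * (κ ^ 5 * (κ ^ 39) ^ 36) ≤ ∣ X ∣ → ∣ A ∣ ^ 3 * ∣ X ∣ ≤ K₀ * ∑E A X →
                   NaturalConclusion A X κ (# X₁)
    from-average X-large h = natural-conclusion A X κ X₁ proj₁
      (Extraction.outcome codeField ⟦ A ⟧ A>0 k k>0 X₁ X₁>0
        (λ {i} i∈X₁ → nonzero (proj₁ i∈X₁) , energetic i (≤-trans (proj₂ i∈X₁) (≤-reflexive (*-comm _ (2 * K₀)))))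
        (cancel-≤ κ>0 (≤-trans X-large (X≤κX₁ h))))
      where
      ∣X∣>0 : 0 < ∣ X ∣
      ∣X∣>0 = subst (0 <_) (#⟦⟧ X) X>0
      X₁>0 : 0 < # X₁
      X₁>0 = n≢0⇒n>0 λ eq → <⇒≱ ∣X∣>0 (≤-trans (X≤κX₁ h) (≤-reflexive (trans (cong (κ *_) eq) (*-zeroʳ κ))))

open import Defs
open import Data.Fin.Subset using (Subset; Nonempty; ∣_∣; _∩_)
open import Data.Integer.Base as ℤ using (+_)
import Data.Integer.Properties as ℤ
open import Data.Nat.Base as ℕ using (ℕ; zero; suc; s≤s; z≤n)
open import Data.Nat.Tactic.RingSolver using (solve-∀)
open import Data.Product.Base using (∃-syntax; _×_; _,_; proj₁; proj₂)
open import Data.Rational.Base as ℚ using (ℚ; mkℚ; 0ℚ; 1ℚ; ½)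
import Data.Rational.Properties as ℚ
open import Data.Rational.Solver using (module +-*-Solver)
open import Data.Rational.Unnormalised.Base as ℚᵘ using (mkℚᵘ)
import Data.Rational.Unnormalised.Properties as ℚᵘ
open import Relation.Binary.PropositionalEquality using (_≡_; refl; sym; trans; cong; subst)
open import Relation.Nullary using (yes; no)
open Counting using (module Bridge; module Natural)

-- Real bounds

⌜_⌝ : ℕ → ℚ
⌜ n ⌝ = + n ℚ./ 1

⌜⌝-mono : ∀ {m n} → m ℕ.≤ n → ⌜ m ⌝ ℚ.≤ ⌜ n ⌝
⌜⌝-mono {m} {n} m≤n = /-mono m n 0 0 (ℕ.*-monoˡ-≤ 1 m≤n)

⌜⌝-suc : ∀ n → ⌜ suc n ⌝ ≡ ⌜ n ⌝ ℚ.+ 1ℚ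
⌜⌝-suc n = trans (cong ⌜_⌝ (ℕ.+-comm 1 n)) (/-+ n 1 0)

⌜⌝-* : ∀ m n → ⌜ m ℕ.* n ⌝ ≡ ⌜ m ⌝ ℚ.* ⌜ n ⌝
⌜⌝-* m n = ℚ.toℚᵘ-injective (begin
  ℚ.toℚᵘ ⌜ m ℕ.* n ⌝                    ≈⟨ ℚ.toℚᵘ-fromℚᵘ (mkℚᵘ (+ (m ℕ.* n)) 0) ⟩
  mkℚᵘ (+ (m ℕ.* n)) 0                  ≈⟨ ℚᵘ.*≡* (cong (ℤ._* + 1) (ℤ.pos-* m n)) ⟩
  mkℚᵘ (+ m) 0 ℚᵘ.* mkℚᵘ (+ n) 0        ≈⟨ ℚᵘ.*-cong (ℚᵘ.≃-sym (ℚ.toℚᵘ-fromℚᵘ (mkℚᵘ (+ m) 0)))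
                                                     (ℚᵘ.≃-sym (ℚ.toℚᵘ-fromℚᵘ (mkℚᵘ (+ n) 0))) ⟩
  ℚ.toℚᵘ ⌜ m ⌝ ℚᵘ.* ℚ.toℚᵘ ⌜ n ⌝        ≈⟨ ℚᵘ.≃-sym (ℚ.toℚᵘ-homo-* ⌜ m ⌝ ⌜ n ⌝) ⟩
  ℚ.toℚᵘ (⌜ m ⌝ ℚ.* ⌜ n ⌝) ∎)
  where open import Relation.Binary.Reasoning.Setoid ℚᵘ.≃-setoid

⌜⌝-nonneg : ∀ n → 0ℚ ℚ.≤ ⌜ n ⌝
⌜⌝-nonneg n = ⌜⌝-mono {0} {n} z≤n

⌜⌝-pos : ∀ {n} → 0 ℕ.< n → 0ℚ ℚ.< ⌜ n ⌝
⌜⌝-pos {n} 0<n = ℚ.<-≤-trans 0<1 (⌜⌝-mono {1} {n} 0<n)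

<+1⇒≤ : ∀ {m n} → ⌜ m ⌝ ℚ.< ⌜ n ⌝ ℚ.+ 1ℚ → m ℕ.≤ n
<+1⇒≤ {m} {n} lt = ℕ.≮⇒≥ λ n<m → ℚ.<-irrefl refl (ℚ.<-≤-trans lt
  (ℚ.≤-trans (ℚ.≤-reflexive (sym (⌜⌝-suc n))) (⌜⌝-mono n<m)))

*-monoˡ : ∀ {a b} c → 0ℚ ℚ.≤ c → a ℚ.≤ b → c ℚ.* a ℚ.≤ c ℚ.* b
*-monoˡ c 0≤c = ℚ.*-monoˡ-≤-nonNeg c {{ℚ.nonNegative 0≤c}}

*-monoʳ : ∀ {a b} c → 0ℚ ℚ.≤ c → a ℚ.≤ b → a ℚ.* c ℚ.≤ b ℚ.* c
*-monoʳ c 0≤c = ℚ.*-monoʳ-≤-nonNeg c {{ℚ.nonNegative 0≤c}}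

infixr 8 _^ℚ_
_^ℚ_ : ℚ → ℕ → ℚ
p ^ℚ zero  = ⌜ 1 ⌝
p ^ℚ suc e = p ℚ.* p ^ℚ e

^ℚ-nonneg : ∀ {p} e → 0ℚ ℚ.≤ p → 0ℚ ℚ.≤ p ^ℚ e
^ℚ-nonneg zero    0≤p = ⌜⌝-nonneg 1
^ℚ-nonneg {p} (suc e) 0≤p = subst (ℚ._≤ p ℚ.* p ^ℚ e) (ℚ.*-zeroʳ p) (*-monoˡ p 0≤p (^ℚ-nonneg e 0≤p))

⌜^⌝≤ : ∀ {κ s p} e → 0ℚ ℚ.≤ p → ⌜ κ ⌝ ℚ.≤ ⌜ s ⌝ ℚ.* p → ⌜ κ ℕ.^ e ⌝ ℚ.≤ ⌜ s ℕ.^ e ⌝ ℚ.* p ^ℚ e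
⌜^⌝≤ zero    0≤p h = ℚ.≤-reflexive (⌜⌝-* 1 1)
⌜^⌝≤ {κ} {s} {p} (suc e) 0≤p h = begin
  ⌜ κ ℕ.* κ ℕ.^ e ⌝
    ≡⟨ ⌜⌝-* κ (κ ℕ.^ e) ⟩
  ⌜ κ ⌝ ℚ.* ⌜ κ ℕ.^ e ⌝
    ≤⟨ *-mono (⌜⌝-nonneg (κ ℕ.^ e)) (ℚ.≤-trans (⌜⌝-nonneg κ) h) h (⌜^⌝≤ e 0≤p h) ⟩
  (⌜ s ⌝ ℚ.* p) ℚ.* (⌜ s ℕ.^ e ⌝ ℚ.* p ^ℚ e)
    ≡⟨ solve 4 (λ s p t r → (s :* p) :* (t :* r) := (s :* t) :* (p :* r)) refl ⌜ s ⌝ p _ _ ⟩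
  (⌜ s ⌝ ℚ.* ⌜ s ℕ.^ e ⌝) ℚ.* (p ℚ.* p ^ℚ e)
    ≡⟨ cong (ℚ._* (p ℚ.* p ^ℚ e)) (sym (⌜⌝-* s (s ℕ.^ e))) ⟩
  ⌜ s ℕ.* s ℕ.^ e ⌝ ℚ.* (p ℚ.* p ^ℚ e) ∎
  where
  open ℚ.≤-Reasoning
  open +-*-Solver

seq-^⁺ : ∀ K e n → seq (value (K ^⁺ e)) n ≡ seq (value K) n ^ℚ e
seq-^⁺ K zero    n = refl
seq-^⁺ K (suc e) n = cong (seq (value K) n ℚ.*_) (seq-^⁺ K e n)

p≤⌜∣↥p∣⌝ : ∀ p → p ℚ.≤ ⌜ ℤ.∣ ℚ.↥ p ∣ ⌝
p≤⌜∣↥p∣⌝ p@(mkℚ (+ n) d _) = ℚ.≤-trans (ℚ.≤-reflexive (sym (ℚ.↥p/↧p≡p p)))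
  (/-mono n n d 0 (ℕ.≤-trans (ℕ.≤-reflexive (ℕ.*-identityʳ n)) (ℕ.m≤m*n n (suc d))))
p≤⌜∣↥p∣⌝ p@(mkℚ ℤ.-[1+ n ] d _) = ℚ.≤-trans (ℚ.nonPositive⁻¹ p) (⌜⌝-nonneg (suc n))

ceiling : ∀ p → 0ℚ ℚ.≤ p → ∃[ m ] (p ℚ.≤ ⌜ m ⌝ × ⌜ m ⌝ ℚ.≤ p ℚ.+ 1ℚ)
ceiling p 0≤p = descend ℤ.∣ ℚ.↥ p ∣ (p≤⌜∣↥p∣⌝ p)
  where
  descend : ∀ m → p ℚ.≤ ⌜ m ⌝ → ∃[ m ] (p ℚ.≤ ⌜ m ⌝ × ⌜ m ⌝ ℚ.≤ p ℚ.+ 1ℚ)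
  descend zero    h = zero , h , ℚ.≤-trans 0≤p (ℚ.≤-trans (ℚ.≤-reflexive (sym (ℚ.+-identityʳ p)))
                                   (ℚ.+-monoʳ-≤ p (ℚ.<⇒≤ 0<1)))
  descend (suc m) h with p ℚ.≤? ⌜ m ⌝
  ... | yes p≤m = descend m p≤m
  ... | no p≰m  = suc m , h , ℚ.≤-trans (ℚ.≤-reflexive (⌜⌝-suc m)) (ℚ.+-monoˡ-≤ 1ℚ (ℚ.<⇒≤ (ℚ.≰⇒> p≰m)))

-- The bounds concern the terms of the sequence for K beyond a threshold, since inequalities between
-- reals are verified termwise.
record NaturalApproximation (K : ℝ⁺) : Set where
  field
    K₀       : ℕ
    K₀>0     : 0 ℕ.< K₀
    threshold    : ℕ
    K≤K₀     : ∀ n → threshold ℕ.≤ n → seq (value K) n ℚ.≤ ⌜ K₀ ⌝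
    K₀≤8K    : ∀ n → threshold ℕ.≤ n → ⌜ K₀ ⌝ ℚ.≤ ⌜ 8 ⌝ ℚ.* seq (value K) n
    K≥0      : ∀ n → threshold ℕ.≤ n → 0ℚ ℚ.≤ seq (value K) n

0<½ : 0ℚ ℚ.< ½
0<½ = ℚ.*<* (ℤ.+<+ (s≤s z≤n))

approximate : ∀ K → fromℕ 1 ≤ value K → NaturalApproximation K
approximate K 1≤K = record
  { K₀ = suc m ; K₀>0 = s≤s z≤n ; threshold = M
  ; K≤K₀ = λ n M≤n → ℚ.≤-trans (near n M M≤n ℕ.≤-refl)
      (ℚ.≤-trans (ℚ.+-monoˡ-≤ 1ℚ (proj₁ (proj₂ ceil))) (ℚ.≤-reflexive (sym (⌜⌝-suc m))))
  -- Beyond M the terms differ by at most 1 and are at least ½. So K₀ ≤ x M + 2 ≤ x n + 3, and 3 = 6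
  -- · ½ ≤ 6 x n; the resulting 7 is rounded up to 8.
  ; K₀≤8K = λ n M≤n → K₀≤8x (half n M≤n) (begin
      ⌜ suc m ⌝
        ≡⟨ ⌜⌝-suc m ⟩
      ⌜ m ⌝ ℚ.+ 1ℚ
        ≤⟨ ℚ.+-monoˡ-≤ 1ℚ (proj₂ (proj₂ ceil)) ⟩
      x M ℚ.+ 1ℚ ℚ.+ 1ℚ
        ≤⟨ ℚ.+-monoˡ-≤ 1ℚ (ℚ.+-monoˡ-≤ 1ℚ (near M n ℕ.≤-refl M≤n)) ⟩
      x n ℚ.+ 1ℚ ℚ.+ 1ℚ ℚ.+ 1ℚ ∎)
  ; K≥0 = λ n M≤n → ℚ.≤-trans (ℚ.<⇒≤ 0<½) (half n M≤n)
  }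
  where
  open ℚ.≤-Reasoning
  x : ℕ → ℚ
  x = seq (value K)
  N₀ = proj₁ (cauchy (value K) 1ℚ 0<1)
  N₁ = proj₁ (1≤K ½ 0<½)
  M = N₀ ℕ.⊔ N₁
  near : ∀ a b → M ℕ.≤ a → M ℕ.≤ b → x a ℚ.≤ x b ℚ.+ 1ℚ
  near a b M≤a M≤b = ∣-∣≤⇒≤+ {x a} {x b} (proj₂ (cauchy (value K) 1ℚ 0<1) a b
    (ℕ.m⊔n≤o⇒m≤o N₀ N₁ M≤a) (ℕ.m⊔n≤o⇒m≤o N₀ N₁ M≤b))
  half : ∀ n → M ℕ.≤ n → ½ ℚ.≤ x n
  half n M≤n = ℚ.≤-trans (ℚ.+-monoˡ-≤ (ℚ.- ½) (proj₂ (1≤K ½ 0<½) n (ℕ.m⊔n≤o⇒n≤o N₀ N₁ M≤n)))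
    (ℚ.≤-reflexive (solve 2 (λ x h → x :+ h :- h := x) refl (x n) ½))
    where open +-*-Solver
  ceil = ceiling (x M) (ℚ.≤-trans (ℚ.<⇒≤ 0<½) (half M ℕ.≤-refl))
  m = proj₁ ceil
  K₀≤8x : ∀ {k p} → ½ ℚ.≤ p → k ℚ.≤ p ℚ.+ 1ℚ ℚ.+ 1ℚ ℚ.+ 1ℚ → k ℚ.≤ ⌜ 8 ⌝ ℚ.* p
  K₀≤8x {k} {p} ½≤p h = begin
    k                                ≤⟨ h ⟩
    p ℚ.+ 1ℚ ℚ.+ 1ℚ ℚ.+ 1ℚ
      ≡⟨ solve 1 (λ p → p :+ con 1ℚ :+ con 1ℚ :+ con 1ℚ := p :+ con ⌜ 6 ⌝ :* con ½) refl p ⟩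
    p ℚ.+ ⌜ 6 ⌝ ℚ.* ½
      ≤⟨ ℚ.+-monoʳ-≤ p (*-monoˡ ⌜ 6 ⌝ (⌜⌝-nonneg 6) ½≤p) ⟩
    p ℚ.+ ⌜ 6 ⌝ ℚ.* p
      ≡⟨ solve 1 (λ p → p :+ con ⌜ 6 ⌝ :* p := con ⌜ 7 ⌝ :* p) refl p ⟩
    ⌜ 7 ⌝ ℚ.* p
      ≤⟨ *-monoʳ p (ℚ.≤-trans (ℚ.<⇒≤ 0<½) ½≤p) (⌜⌝-mono {7} {8} (ℕ.n≤1+n 7)) ⟩
    ⌜ 8 ⌝ ℚ.* p ∎
    where open +-*-Solver

inverse-bound : ∀ {p} (0<p : 0ℚ ℚ.< p) {a b} → a ℚ.≤ b ℚ.* p → a ℚ.* inv p 0<p ℚ.≤ b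
inverse-bound {p} 0<p {a} {b} h = begin
  a ℚ.* inv p 0<p
    ≤⟨ *-monoʳ (inv p 0<p) (ℚ.<⇒≤ (inv-pos p 0<p)) h ⟩
  b ℚ.* p ℚ.* inv p 0<p
    ≡⟨ trans (ℚ.*-assoc b p _) (trans (cong (b ℚ.*_) (inv-r p 0<p)) (ℚ.*-identityʳ b)) ⟩
  b ∎
  where open ℚ.≤-Reasoning

bound-inverse : ∀ {p} (0<p : 0ℚ ℚ.< p) {a b} → a ℚ.* inv p 0<p ℚ.≤ b → a ℚ.≤ b ℚ.* p
bound-inverse {p} 0<p {a} {b} h = begin
  a                              ≡⟨ sym (trans (ℚ.*-assoc a _ p) (trans (cong (a ℚ.*_) (trans (ℚ.*-comm _ p) (inv-r p 0<p))) (ℚ.*-identityʳ a))) ⟩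
  a ℚ.* inv p 0<p ℚ.* p
    ≤⟨ *-monoʳ p (ℚ.<⇒≤ 0<p) h ⟩
  b ℚ.* p ∎
  where open ℚ.≤-Reasoning

module Numerics (K : ℝ⁺) (approximation : NaturalApproximation K) where
  open NaturalApproximation approximation

  private
    x : ℕ → ℚ
    x = seq (value K)

  -- The denominators occurring in _⁻¹⁺.
  cut : ℝ⁺ → ℕ → ℚ
  cut L n = seq (value L) n ℚ.⊔ proj₁ (positive L)

  0<cut : ∀ L n → 0ℚ ℚ.< cut L n
  0<cut L n = ℚ.<-≤-trans (proj₁ (proj₂ (positive L))) (ℚ.p≤q⊔p (seq (value L) n) (proj₁ (positive L)))

  -- As both sides are integers, an error ε with ε K₀ < 1 does no harm.
  energy-bound : ∀ a b → fromℕ a * value (K ⁻¹⁺) ≤ fromℕ b → a ℕ.≤ K₀ ℕ.* b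
  energy-bound a b h = <+1⇒≤ (ℚ.≤-<-trans (begin
      ⌜ a ⌝
        ≤⟨ bound-inverse (0<cut K n) (proj₂ (h ε 0<ε) n (ℕ.≤-trans (ℕ.m≤m⊔n N₁ (threshold ℕ.⊔ N₂)) ℕ.≤-refl)) ⟩
      (⌜ b ⌝ ℚ.+ ε) ℚ.* cut K n
        ≤⟨ *-monoˡ (⌜ b ⌝ ℚ.+ ε) b+ε≥0 cut≤K₀ ⟩
      (⌜ b ⌝ ℚ.+ ε) ℚ.* ⌜ K₀ ⌝
        ≡⟨ solve 3 (λ b ε k → (b :+ ε) :* k := k :* b :+ ε :* k) refl ⌜ b ⌝ ε ⌜ K₀ ⌝ ⟩
      ⌜ K₀ ⌝ ℚ.* ⌜ b ⌝ ℚ.+ ε ℚ.* ⌜ K₀ ⌝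
        ≡⟨ cong (ℚ._+ ε ℚ.* ⌜ K₀ ⌝) (sym (⌜⌝-* K₀ b)) ⟩
      ⌜ K₀ ℕ.* b ⌝ ℚ.+ ε ℚ.* ⌜ K₀ ⌝ ∎)
    (ℚ.+-monoʳ-< ⌜ K₀ ℕ.* b ⌝ small))
    where
    open ℚ.≤-Reasoning
    open +-*-Solver
    0<K₀+1 = ⌜⌝-pos {suc K₀} (s≤s z≤n)
    ε = inv ⌜ suc K₀ ⌝ 0<K₀+1
    0<ε = inv-pos ⌜ suc K₀ ⌝ 0<K₀+1
    N₁ = proj₁ (h ε 0<ε)
    N₂ = proj₁ (proj₂ (proj₂ (positive K)))
    n = N₁ ℕ.⊔ (threshold ℕ.⊔ N₂)
    threshold⊔N₂≤n : threshold ℕ.⊔ N₂ ℕ.≤ n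
    threshold⊔N₂≤n = ℕ.m≤n⊔m N₁ (threshold ℕ.⊔ N₂)
    threshold≤n = ℕ.m⊔n≤o⇒m≤o threshold N₂ threshold⊔N₂≤n
    b+ε≥0 : 0ℚ ℚ.≤ ⌜ b ⌝ ℚ.+ ε
    b+ε≥0 = ℚ.+-mono-≤ (⌜⌝-nonneg b) (ℚ.<⇒≤ 0<ε)
    cut≤K₀ : cut K n ℚ.≤ ⌜ K₀ ⌝
    cut≤K₀ = ℚ.⊔-lub (K≤K₀ n threshold≤n) (ℚ.≤-trans
      (proj₂ (proj₂ (proj₂ (positive K))) n (ℕ.m⊔n≤o⇒n≤o threshold N₂ threshold⊔N₂≤n)) (K≤K₀ n threshold≤n))
    small : ε ℚ.* ⌜ K₀ ⌝ ℚ.< 1ℚ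
    small = ℚ.<-≤-trans (ℚ.*-monoʳ-<-pos ε {{ℚ.positive 0<ε}} K₀<K₀+1)
      (ℚ.≤-reflexive (trans (ℚ.*-comm ε _) (inv-r ⌜ suc K₀ ⌝ 0<K₀+1)))
      where
      K₀<K₀+1 : ⌜ K₀ ⌝ ℚ.< ⌜ suc K₀ ⌝
      K₀<K₀+1 = ℚ.<-≤-trans (ℚ.≤-<-trans (ℚ.≤-reflexive (sym (ℚ.+-identityʳ ⌜ K₀ ⌝))) (ℚ.+-monoʳ-< ⌜ K₀ ⌝ 0<1))
        (ℚ.≤-reflexive (sym (⌜⌝-suc K₀)))

  κ : ℕ
  κ = 2 ℕ.* (2 ℕ.* (10 ℕ.* K₀))

  -- The constant is 40 · 8, from κ = 40K₀ and K₀ ≤ 8K.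
  κ≤320K : ∀ n → threshold ℕ.≤ n → ⌜ κ ⌝ ℚ.≤ ⌜ 320 ⌝ ℚ.* x n
  κ≤320K n t≤n = begin
    ⌜ κ ⌝
      ≡⟨ trans (cong ⌜_⌝ (40K₀ K₀)) (⌜⌝-* 40 K₀) ⟩
    ⌜ 40 ⌝ ℚ.* ⌜ K₀ ⌝
      ≤⟨ *-monoˡ ⌜ 40 ⌝ (⌜⌝-nonneg 40) (K₀≤8K n t≤n) ⟩
    ⌜ 40 ⌝ ℚ.* (⌜ 8 ⌝ ℚ.* x n)
      ≡⟨ sym (ℚ.*-assoc ⌜ 40 ⌝ ⌜ 8 ⌝ (x n)) ⟩
    ⌜ 320 ⌝ ℚ.* x n ∎
    where
    open ℚ.≤-Reasoning
    40K₀ : ∀ k → 2 ℕ.* (2 ℕ.* (10 ℕ.* k)) ≡ 40 ℕ.* k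
    40K₀ = solve-∀

  module Scaled (Λ : ℝ⁺) (c : ℕ) (c≤Λ : ∀ n → ⌜ c ⌝ ℚ.≤ seq (value Λ) n) where

    κ^≤ : ∀ e → 320 ℕ.^ e ℕ.≤ c → ∀ n → threshold ℕ.≤ n → ⌜ κ ℕ.^ e ⌝ ℚ.≤ ⌜ c ⌝ ℚ.* seq (value (K ^⁺ e)) n
    κ^≤ e e≤c n t≤n = begin
      ⌜ κ ℕ.^ e ⌝
        ≤⟨ ⌜^⌝≤ {κ} {320} e (K≥0 n t≤n) (κ≤320K n t≤n) ⟩
      ⌜ 320 ℕ.^ e ⌝ ℚ.* x n ^ℚ e
        ≤⟨ *-monoʳ (x n ^ℚ e) (^ℚ-nonneg e (K≥0 n t≤n)) (⌜⌝-mono e≤c) ⟩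
      ⌜ c ⌝ ℚ.* x n ^ℚ e
        ≡⟨ cong (⌜ c ⌝ ℚ.*_) (sym (seq-^⁺ K e n)) ⟩
      ⌜ c ⌝ ℚ.* seq (value (K ^⁺ e)) n ∎
      where open ℚ.≤-Reasoning

    -- Both sides of the conclusion are integers, so the inequality of reals is needed only up to an
    -- error of ½.
    size-bound : ∀ e w → 320 ℕ.^ e ℕ.≤ c → value (Λ *⁺ K ^⁺ e) ≤ fromℕ w → κ ℕ.^ e ℕ.≤ w
    size-bound e w e≤c h = <+1⇒≤ (ℚ.≤-<-trans (begin
        ⌜ κ ℕ.^ e ⌝
          ≤⟨ κ^≤ e e≤c n t≤n ⟩
        ⌜ c ⌝ ℚ.* seq (value (K ^⁺ e)) n
          ≤⟨ *-monoʳ (seq (value (K ^⁺ e)) n)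
               (subst (0ℚ ℚ.≤_) (sym (seq-^⁺ K e n)) (^ℚ-nonneg e (K≥0 n t≤n))) (c≤Λ n) ⟩
        seq (value Λ) n ℚ.* seq (value (K ^⁺ e)) n
          ≤⟨ proj₂ (h ½ 0<½) n (ℕ.m≤m⊔n N₁ threshold) ⟩
        ⌜ w ⌝ ℚ.+ ½ ∎)
      (ℚ.+-monoʳ-< ⌜ w ⌝ (ℚ.*<* (ℤ.+<+ (s≤s (s≤s z≤n))))))
      where
      open ℚ.≤-Reasoning
      N₁ = proj₁ (h ½ 0<½)
      n = N₁ ℕ.⊔ threshold
      t≤n = ℕ.m≤n⊔m N₁ threshold

    -- The factor 320ᵉ lost in comparing κᵉ with Kᵉ is charged to c, which `Λ-bound` then cancels
    -- against Λ ⁻¹⁺.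
    ratio-bound : ∀ e v w → 320 ℕ.^ e ℕ.≤ c → v ℕ.≤ κ ℕ.^ e ℕ.* w → ∀ n → threshold ℕ.≤ n →
                  inv (cut (K ^⁺ e) n) (0<cut (K ^⁺ e) n) ℚ.* ⌜ v ⌝ ℚ.≤ ⌜ c ⌝ ℚ.* ⌜ w ⌝
    ratio-bound e v w e≤c h n t≤n = ℚ.≤-trans (ℚ.≤-reflexive (ℚ.*-comm _ ⌜ v ⌝)) (inverse-bound (0<cut (K ^⁺ e) n) (begin
      ⌜ v ⌝
        ≤⟨ ⌜⌝-mono h ⟩
      ⌜ κ ℕ.^ e ℕ.* w ⌝
        ≡⟨ ⌜⌝-* (κ ℕ.^ e) w ⟩
      ⌜ κ ℕ.^ e ⌝ ℚ.* ⌜ w ⌝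
        ≤⟨ *-monoʳ ⌜ w ⌝ (⌜⌝-nonneg w) (ℚ.≤-trans (κ^≤ e e≤c n t≤n)
             (*-monoˡ ⌜ c ⌝ (⌜⌝-nonneg c) (ℚ.p≤p⊔q (seq (value (K ^⁺ e)) n) _))) ⟩
      ⌜ c ⌝ ℚ.* cut (K ^⁺ e) n ℚ.* ⌜ w ⌝
        ≡⟨ solve 3 (λ c p w → c :* p :* w := c :* w :* p) refl ⌜ c ⌝ (cut (K ^⁺ e) n) ⌜ w ⌝ ⟩
      ⌜ c ⌝ ℚ.* ⌜ w ⌝ ℚ.* cut (K ^⁺ e) n ∎))
      where
      open ℚ.≤-Reasoning
      open +-*-Solver

    Λ-bound : ∀ {a} w n → a ℚ.≤ ⌜ c ⌝ ℚ.* ⌜ w ⌝ → inv (cut Λ n) (0<cut Λ n) ℚ.* a ℚ.≤ ⌜ w ⌝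
    Λ-bound {a} w n h = ℚ.≤-trans (ℚ.≤-reflexive (ℚ.*-comm _ a)) (inverse-bound (0<cut Λ n) (begin
      a                          ≤⟨ h ⟩
      ⌜ c ⌝ ℚ.* ⌜ w ⌝
        ≤⟨ *-monoʳ ⌜ w ⌝ (⌜⌝-nonneg w) (ℚ.≤-trans (c≤Λ n) (ℚ.p≤p⊔q (seq (value Λ) n) _)) ⟩
      cut Λ n ℚ.* ⌜ w ⌝
        ≡⟨ ℚ.*-comm (cut Λ n) ⌜ w ⌝ ⟩
      ⌜ w ⌝ ℚ.* cut Λ n ∎))
      where open ℚ.≤-Reasoning

    eventually : ∀ {z} w → (∀ n → threshold ℕ.≤ n → seq z n ℚ.≤ ⌜ w ⌝) → z ≤ fromℕ w
    eventually w h ε 0<ε = threshold , λ n t≤n → ℚ.≤-trans (h n t≤n)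
      (ℚ.≤-trans (ℚ.≤-reflexive (sym (ℚ.+-identityʳ ⌜ w ⌝))) (ℚ.+-monoʳ-≤ ⌜ w ⌝ (ℚ.<⇒≤ 0<ε)))

    lower-bound : ∀ e a w → 320 ℕ.^ e ℕ.≤ c → a ℕ.≤ κ ℕ.^ e ℕ.* w →
                  value (Λ ⁻¹⁺ *⁺ (K ^⁺ e) ⁻¹⁺) * fromℕ a ≤ fromℕ w
    lower-bound e a w e≤c h = eventually {value (Λ ⁻¹⁺ *⁺ (K ^⁺ e) ⁻¹⁺) * fromℕ a} w λ n t≤n →
      ℚ.≤-trans (ℚ.≤-reflexive (ℚ.*-assoc (inv (cut Λ n) (0<cut Λ n)) (inv (cut (K ^⁺ e) n) (0<cut (K ^⁺ e) n)) ⌜ a ⌝))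
        (Λ-bound w n (ratio-bound e a w e≤c h n t≤n))

    lower-bound-⊔ : ∀ e₁ e₂ v a w → 320 ℕ.^ e₁ ℕ.≤ c → 320 ℕ.^ e₂ ℕ.≤ c →
                    v ℕ.≤ κ ℕ.^ e₁ ℕ.* w → a ℕ.≤ κ ℕ.^ e₂ ℕ.* w →
                    value (Λ ⁻¹⁺) * (value ((K ^⁺ e₁) ⁻¹⁺) * fromℕ v ⊔ value ((K ^⁺ e₂) ⁻¹⁺) * fromℕ a) ≤ fromℕ w
    lower-bound-⊔ e₁ e₂ v a w e₁≤c e₂≤c h₁ h₂ =
      eventually {value (Λ ⁻¹⁺) * (value ((K ^⁺ e₁) ⁻¹⁺) * fromℕ v ⊔ value ((K ^⁺ e₂) ⁻¹⁺) * fromℕ a)} w λ n t≤n →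
        Λ-bound w n (ℚ.⊔-lub (ratio-bound e₁ v w e₁≤c h₁ n t≤n) (ratio-bound e₂ a w e₂≤c h₂ n t≤n))

-- The constants of the theorem

opaque
  -- The exponent 1505 is the largest power of K in the statement, so this one number dominates
  -- every 320ᵉ that arises. Opacity keeps the numeral from being evaluated.
  constant : ℕ
  constant = 320 ℕ.^ 1505

  320^≤constant : ∀ {e} → e ℕ.≤ 1505 → 320 ℕ.^ e ℕ.≤ constant
  320^≤constant = ℕ.^-monoʳ-≤ 320

constant⁺ : ℝ⁺
constant⁺ = mkℝ⁺ (fromℕ constant) (1ℚ , 0<1 , 0 , λ _ _ → ⌜⌝-mono {1} (320^≤constant {0} z≤n))

module Final {q : ℕ} (q-pp : PrimePower q) (𝔽 : FiniteField q) (A X : Subset q) (K : ℝ⁺)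
             (approximation : NaturalApproximation K) where
  open Field 𝔽
  open Bridge 𝔽 using (NaturalConclusion; module NaturalConclusion)
  open NaturalApproximation approximation using (K₀; K₀>0)
  open Numerics K approximation using (κ)

  Λ : ℝ⁺
  Λ = constant⁺ *⁺ log₂ q (primePower⇒>1 q-pp) ^⁺ 1

  -- Every term of the sequence for log₂ q is at least 1; this bound is part of the positivity proof
  -- that `log₂` carries.
  constant≤Λ : ∀ n → ⌜ constant ⌝ ℚ.≤ seq (value Λ) n
  constant≤Λ n = ℚ.≤-trans (ℚ.≤-reflexive (sym (ℚ.*-identityʳ ⌜ constant ⌝)))
    (*-monoˡ ⌜ constant ⌝ (⌜⌝-nonneg constant)
      (ℚ.≤-trans (proj₂ (proj₂ (proj₂ (positive (log₂ q (primePower⇒>1 q-pp))))) n z≤n)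
        (ℚ.≤-reflexive (sym (ℚ.*-identityʳ _)))))

  open Numerics.Scaled K approximation Λ constant constant≤Λ

  κ^-mono : ∀ {a b} → a ℕ.≤ b → κ ℕ.^ a ℕ.≤ κ ℕ.^ b
  κ^-mono = ℕ.^-monoʳ-≤ κ {{ℕ.m*n≢0 2 (2 ℕ.* (10 ℕ.* K₀)) {{_}} {{ℕ.m*n≢0 2 (10 ℕ.* K₀) {{_}} {{ℕ.m*n≢0 10 K₀ {{_}} {{ℕ.>-nonZero K₀>0}}}}}}}}

  conclude : ∀ {x} e → e ℕ.≤ 1505 → (N : NaturalConclusion A X κ x) →
             ∣ X ∣ ℕ.≤ κ ℕ.^ e ℕ.* ∣ NaturalConclusion.X′ N ∣ → Conclusion A X Λ K e
  conclude e e≤ N X≤ =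
    N.ā , N.F , N.V , N.ā∈A , IsSubfieldGeneratedBy.isSubfield N.F-generated ,
    IsSubspaceGeneratedBy.isSubspace N.V-generated ,
    lower-bound-⊔ 704 85 (∣ N.V ∣) (∣ A ∣) (∣ N.V ∩ (A -ˢ N.ā) ∣)
      (320^≤constant (ℕ.m≤m+n 704 801)) (320^≤constant (ℕ.m≤m+n 85 1420))
      (ℕ.≤-trans V≤ (ℕ.*-monoʳ-≤ (κ ℕ.^ 704) N.A₁≤V∩)) (ℕ.≤-trans A≤ (ℕ.*-monoʳ-≤ (κ ℕ.^ 85) N.A₁≤V∩)) ,
    N.x₀ , N.A₁ , N.X′ , N.x₀∈X , N.A₁⊆ , N.X′⊆ , N.F-generated , N.V-generated ,
    lower-bound 85 (∣ A ∣) (∣ N.A₁ ∣) (320^≤constant (ℕ.m≤m+n 85 1420)) A≤ ,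
    lower-bound e (∣ X ∣) (∣ N.X′ ∣) (320^≤constant e≤) X≤
    where
    module N = NaturalConclusion N
    -- The exponent obtained is 39 · 11 = 429: |V| ≤ μ¹⁰n, and n ≤ μ|A₁|.
    V≤ : ∣ N.V ∣ ℕ.≤ κ ℕ.^ 704 ℕ.* ∣ N.A₁ ∣
    V≤ = ℕ.≤-trans N.V-small (ℕ.*-monoˡ-≤ ∣ N.A₁ ∣ (ℕ.≤-trans
      (ℕ.≤-reflexive (ℕ.^-*-assoc κ 39 11)) (κ^-mono (ℕ.m≤m+n 429 275))))
    A≤ : ∣ A ∣ ℕ.≤ κ ℕ.^ 85 ℕ.* ∣ N.A₁ ∣
    A≤ = ℕ.≤-trans N.A₁-large (ℕ.*-monoˡ-≤ ∣ N.A₁ ∣ (κ^-mono {40} {85} (ℕ.m≤m+n 40 45)))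

  κ^1409 : κ ℕ.^ 5 ℕ.* (κ ℕ.^ 39) ℕ.^ 36 ≡ κ ℕ.^ 1409
  κ^1409 = trans (cong (κ ℕ.^ 5 ℕ.*_) (ℕ.^-*-assoc κ 39 36)) (sym (ℕ.^-distribˡ-+-* κ 5 1404))

  module _ (A≠∅ : Nonempty A) (X≠∅ : Nonempty X) (0∉X : 0# ∉ X) where
    open Natural 𝔽 A X A≠∅ X≠∅ 0∉X K₀ K₀>0 using (from-average; from-pointwise; X₁; X≤κX₁)
    open Numerics K approximation using (energy-bound)

    -- One κ for X₁ and κ⁴ for Y make up the fifth power. The size condition used is |X| ≥ κ¹⁴¹⁰,
    -- with 1410 = 1 + 5 + 36 · 39.
    from-sum : value (Λ *⁺ K ^⁺ 1505) ≤ fromℕ ∣ X ∣ →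
               fromℕ (∣ A ∣ ℕ.^ 3 ℕ.* ∣ X ∣) * value (K ⁻¹⁺) ≤ fromℕ (∑E A X) → Conclusion A X Λ K 5
    from-sum large h = conclude 5 (ℕ.m≤m+n 5 1500) conclusion
      (ℕ.≤-trans (X≤κX₁ bound) (ℕ.≤-trans (ℕ.*-monoʳ-≤ κ (NaturalConclusion.X′-large conclusion))
        (ℕ.≤-reflexive (sym (ℕ.*-assoc κ (κ ℕ.^ 4) _)))))
      where
      bound : ∣ A ∣ ℕ.^ 3 ℕ.* ∣ X ∣ ℕ.≤ K₀ ℕ.* ∑E A X
      bound = energy-bound (∣ A ∣ ℕ.^ 3 ℕ.* ∣ X ∣) (∑E A X) h
      conclusion = from-average
        (ℕ.≤-trans (ℕ.≤-reflexive (cong (κ ℕ.*_) κ^1409))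
          (ℕ.≤-trans (κ^-mono {1410} {1505} (ℕ.m≤m+n 1410 95)) (size-bound 1505 (∣ X ∣) (320^≤constant ℕ.≤-refl) large)))
        bound

    from-each : value (Λ *⁺ K ^⁺ 1504) ≤ fromℕ ∣ X ∣ →
                (∀ ξ → ξ ∈ X → fromℕ (∣ A ∣ ℕ.^ 3) * value (K ⁻¹⁺) ≤ fromℕ (E A ξ)) → Conclusion A X Λ K 4
    from-each large h = conclude 4 (ℕ.m≤m+n 4 1501) conclusion (NaturalConclusion.X′-large conclusion)
      where
      conclusion = from-pointwise
        (ℕ.≤-trans (ℕ.≤-reflexive κ^1409)
          (ℕ.≤-trans (κ^-mono {1409} {1504} (ℕ.m≤m+n 1409 95)) (size-bound 1504 (∣ X ∣) (320^≤constant (ℕ.n≤1+n 1504)) large)))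
        (λ ξ ξ∈X → energy-bound (∣ A ∣ ℕ.^ 3) (E A ξ) (h ξ ξ∈X))

theoremC : ∃[ C ] ∃[ k ] (0 ℕ.< k ×
    (∀ {q : ℕ} (q-pp : PrimePower q) (𝔽 : FiniteField q) →
      let open Field 𝔽
          Λ : ℝ⁺
          Λ = C *⁺ log₂ q (primePower⇒>1 q-pp) ^⁺ k
      in
      ∀ (A X : Subset q) → Nonempty A → Nonempty X → 0# ∉ A → 0# ∉ X →
      ∀ (K : ℝ⁺) → fromℕ 1 ≤ value K →
        (value (Λ *⁺ K ^⁺ 1505) ≤ fromℕ ∣ X ∣ →
         fromℕ (∣ A ∣ ℕ.^ 3 ℕ.* ∣ X ∣) * value (K ⁻¹⁺) ≤ fromℕ (∑E A X) →
         Conclusion A X Λ K 5)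
        ×
        (value (Λ *⁺ K ^⁺ 1504) ≤ fromℕ ∣ X ∣ →
         (∀ ξ → ξ ∈ X → fromℕ (∣ A ∣ ℕ.^ 3) * value (K ⁻¹⁺) ≤ fromℕ (E A ξ)) →
         Conclusion A X Λ K 4)))
theoremC = constant⁺ , 1 , s≤s z≤n , λ q-pp 𝔽 A X A≠∅ X≠∅ _ 0∉X K 1≤K →
  let open Final q-pp 𝔽 A X K (approximate K 1≤K) in
  from-sum A≠∅ X≠∅ 0∉X , from-each A≠∅ X≠∅ 0∉X
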